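{- Let $q=p^k$ be an odd prime power ($p$ an odd prime, $k\ge 1$). Let $X$ be a cubic arc-transitive graph of type $\{1,2^1\}$ whose full automorphism group is $G^*=\mathrm{PGL}(2,q)$ and such that $G=\mathrm{PSL}(2,q)\le G^*$ is a $1$-arc-regular subgroup of automorphisms. Then the weak intersection density array of $X$ is \[ \overline{\rho}(X)=\begin{cases} [\,3^{k-1}\,] & \text{if } q=3^k \text{ and } k \text{ odd},\\ [\,3^{\frac{k}{2}-1}\,] & \text{if } q=3^k \text{ and } k \text{ even},\\ [1,2] & \text{if } q\equiv 1 \pmod 3 \text{ and } p=5,\\ [1,\tfrac43] & \text{if } q\equiv 1 \pmod 3 \text{ and } p\neq 5,\\ [1] & \text{if } q\equiv 2 \pmod 3 \text{ and } q\equiv \pm 2 \pmod 5,\\ [1,\tfrac43] & \text{if } q\equiv 2 \pmod 3 \text{ and } (q\equiv \pm 1 \pmod 5 \text{ or } q\equiv 0 \pmod 5). \end{cases} \]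
   Context: For a transitive permutation group $H\le \mathrm{Sym}(V)$, a subset $\mathcal F\subseteq H$ is intersecting if any two $f,g\in\mathcal F$ satisfy $f(v)=g(v)$ for some $v\in V$; the intersection density of $H$ is $\rho(H)=\max\{|\mathcal F|:\mathcal F\subseteq H\text{ intersecting}\}/(|H|/|V|)$. For an arc-transitive graph $X$, the weak intersection density array $\overline{\rho}(X)$ is the increasing list of the distinct values $\rho(H)$ as $H$ ranges over the subgroups of $\mathrm{Aut}(X)$ acting arc-transitively on $X$ (each $H$ acting on the vertex set). An $s$-arc is a sequence $(u_0,\dots,u_s)$ of distinct vertices with consecutive ones adjacent; a group is $s$-arc-regular if it acts regularly on $s$-arcs. A cubic arc-transitive graph $X$ is of type $\{1,2^1\}$ if its full automorphism group acts regularly on $2$-arcs, it has a subgroup acting regularly on arcs ($1$-arcs), and the edge stabilizer in $\mathrm{Aut}(X)$ is isomorphic to $\mathbb{Z}_2^2$. -}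

module Defs where

open import Data.Nat using (ℕ; zero; suc; _+_; _*_; _∸_; _^_; _≤_)
open import Data.Bool using (Bool; true; false)
open import Data.Fin using (Fin)
open import Data.Vec using (Vec; lookup; tabulate; allFin)
open import Data.List using (List; length; filterᵇ; _∷_; [])
import Data.List as List
open import Data.List.Membership.Propositional using (_∈_)
open import Data.List.Relation.Unary.All using (All)
open import Data.List.Relation.Unary.Unique.Propositional using (Unique)
open import Data.Product using (Σ; ∃; ∃-syntax; _×_; _,_)
open import Relation.Binary.PropositionalEquality using (_≡_; _≢_)
open import Relation.Nullary using (¬_)
open import Algebra.Structures using (IsCommutativeRing)

record FiniteField (q : ℕ) : Set where
  field
    _+F_ _*F_ : Fin q → Fin q → Fin q
    -F_       : Fin q → Fin q
    0F 1F     : Fin q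
    isCommutativeRing : IsCommutativeRing _≡_ _+F_ _*F_ -F_ 0F 1F
    0≢1       : 0F ≢ 1F
    inverse   : ∀ x → x ≢ 0F → ∃[ y ] (x *F y ≡ 1F)

record Mat (q : ℕ) : Set where
  constructor mat
  field a b c d : Fin q

module Matrices {q : ℕ} (F : FiniteField q) where
  open FiniteField F

  _-F_ : Fin q → Fin q → Fin q
  x -F y = x +F (-F y)

  det : Mat q → Fin q
  det (mat a b c d) = (a *F d) -F (b *F c)

  _·_ : Mat q → Mat q → Mat q
  mat a b c d · mat a' b' c' d' =
    mat ((a *F a') +F (b *F c')) ((a *F b') +F (b *F d'))
        ((c *F a') +F (d *F c')) ((c *F b') +F (d *F d'))

  Invertible : Mat q → Set
  Invertible M = det M ≢ 0F

  Special : Mat q → Set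
  Special M = det M ≡ 1F

  Scalar : Mat q → Set
  Scalar (mat a b c d) = (b ≡ 0F) × (c ≡ 0F) × (a ≡ d)

record Graph (n : ℕ) : Set where
  field
    adj   : Fin n → Fin n → Bool
    sym   : ∀ u v → adj u v ≡ adj v u
    irrefl : ∀ u → adj u u ≡ false

module _ {n : ℕ} (X : Graph n) where
  open Graph X

  degree : Fin n → ℕ
  degree u = length (filterᵇ (adj u) (Data.List.allFin n))

  Cubic : Set
  Cubic = ∀ u → degree u ≡ 3

-- Maps Fin n → Fin n represented by their tables (so equality is ≡)

Perm : ℕ → Set
Perm n = Vec (Fin n) n

app : ∀ {n} → Perm n → Fin n → Fin n
app t i = lookup t i

idPerm : ∀ n → Perm n
idPerm n = allFin n

_∘P_ : ∀ {n} → Perm n → Perm n → Perm n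
s ∘P t = tabulate (λ i → app s (app t i))

IsPerm : ∀ {n} → Perm n → Set
IsPerm {n} t = ∀ i j → app t i ≡ app t j → i ≡ j

module _ {n : ℕ} (X : Graph n) where
  open Graph X

  Arc : Fin n → Fin n → Set
  Arc u v = adj u v ≡ true

  IsAut : Perm n → Set
  IsAut t = IsPerm t × (∀ u v → adj (app t u) (app t v) ≡ adj u v)

  IsAutSubgroup : List (Perm n) → Set
  IsAutSubgroup hs =
    Unique hs × All IsAut hs × (idPerm n ∈ hs)
    × (∀ {s t} → s ∈ hs → t ∈ hs → (s ∘P t) ∈ hs)
    × (∀ {t} → t ∈ hs → ∃[ s ] ((s ∈ hs) × (s ∘P t ≡ idPerm n)))

  ArcTransitive : List (Perm n) → Set
  ArcTransitive hs = ∀ u v u' v' → Arc u v → Arc u' v' →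
    ∃[ h ] ((h ∈ hs) × (app h u ≡ u') × (app h v ≡ v'))

  ArcTransitiveSubgroup : List (Perm n) → Set
  ArcTransitiveSubgroup hs = IsAutSubgroup hs × ArcTransitive hs

  -- 2-arcs (u0,u1,u2): u0 ~ u1 ~ u2, distinct (u0 ≠ u2 suffices as X is simple)
  TwoArc : Fin n → Fin n → Fin n → Set
  TwoArc u0 u1 u2 = Arc u0 u1 × Arc u1 u2 × (u0 ≢ u2)

  AutTwoArcRegular : Set
  AutTwoArcRegular =
    (∀ u0 u1 u2 w0 w1 w2 → TwoArc u0 u1 u2 → TwoArc w0 w1 w2 →
       ∃[ t ] (IsAut t × (app t u0 ≡ w0) × (app t u1 ≡ w1) × (app t u2 ≡ w2)))
    × (∀ u0 u1 u2 s t → TwoArc u0 u1 u2 → IsAut s → IsAut t →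
       app s u0 ≡ app t u0 → app s u1 ≡ app t u1 → app s u2 ≡ app t u2 → s ≡ t)

  HasArcRegularSubgroup : Set
  HasArcRegularSubgroup = ∃[ hs ] (IsAutSubgroup hs ×
    (∀ u v u' v' → Arc u v → Arc u' v' →
       ∃[ h ] ((h ∈ hs) × (app h u ≡ u') × (app h v ≡ v')))
    × (∀ u v s t → Arc u v → s ∈ hs → t ∈ hs →
       app s u ≡ app t u → app s v ≡ app t v → s ≡ t))

  StabEdge : Fin n → Fin n → Perm n → Set
  StabEdge u v t = IsAut t ×
    (((app t u ≡ u) × (app t v ≡ v)) ⊎' ((app t u ≡ v) × (app t v ≡ u)))
    where
      open import Data.Sum using () renaming (_⊎_ to _⊎'_)

  xor2 : Bool × Bool → Bool × Bool → Bool × Bool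
  xor2 (a , b) (c , d) = (Data.Bool._xor_ a c , Data.Bool._xor_ b d)
    where import Data.Bool

  EdgeStabZ2² : Set
  EdgeStabZ2² = ∀ u v → Arc u v → Σ (Bool × Bool → Perm n) λ ψ →
    ((∀ x y → ψ (xor2 x y) ≡ (ψ x ∘P ψ y))
    × (∀ x y → ψ x ≡ ψ y → x ≡ y)
    × (∀ x → StabEdge u v (ψ x))
    × (∀ t → StabEdge u v t → ∃[ x ] (ψ x ≡ t)))

  Type1-2¹ : Set
  Type1-2¹ = AutTwoArcRegular × HasArcRegularSubgroup × EdgeStabZ2²

module _ {n : ℕ} where

  Intersecting : List (Perm n) → Set
  Intersecting fs = ∀ {f g} → f ∈ fs → g ∈ fs → ∃[ v ] (app f v ≡ app g v)

  IntersectingFamily : List (Perm n) → List (Perm n) → Set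
  IntersectingFamily hs fs = Unique fs × All (_∈ hs) fs × Intersecting fs

  MaxIntersecting : List (Perm n) → ℕ → Set
  MaxIntersecting hs m =
    (∃[ fs ] (IntersectingFamily hs fs × (length fs ≡ m)))
    × (∀ fs → IntersectingFamily hs fs → length fs ≤ m)

  -- ρ(H) = a / b, i.e. m / (|H| / n) = a / b with m the maximum above
  DensityIs : List (Perm n) → ℕ × ℕ → Set
  DensityIs hs (a , b) =
    ∃[ m ] (MaxIntersecting hs m × (m * n * b ≡ a * length hs))

-- The weak intersection density array of X, as a set of fractions a/b (b ≥ 1):
-- every arc-transitive subgroup of Aut(X) has density in the list, and every
-- value in the list is attained by some arc-transitive subgroup.
WeakArrayIs : ∀ {n} → Graph n → List (ℕ × ℕ) → Set
WeakArrayIs {n} X vals =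
  (∀ hs → ArcTransitiveSubgroup X hs → ∃[ r ] ((r ∈ vals) × DensityIs hs r))
  × (∀ r → r ∈ vals → ∃[ hs ] (ArcTransitiveSubgroup X hs × DensityIs hs r))

-- Hypothesis: Aut(X) ≅ PGL(2,q) = GL(2,q)/Z via φ : GL(2,q) → Aut(X)
-- (surjective homomorphism with kernel the scalars), and the image of
-- SL(2,q), i.e. PSL(2,q), acts regularly on arcs.

module _ {q : ℕ} (F : FiniteField q) {n : ℕ} (X : Graph n) where
  open Matrices F

  AutIsPGL : (Mat q → Perm n) → Set
  AutIsPGL φ =
    (∀ A B → Invertible A → Invertible B → φ (A · B) ≡ (φ A ∘P φ B))
    × (∀ A → Invertible A → IsAut X (φ A))
    × (∀ t → IsAut X t → ∃[ A ] (Invertible A × (φ A ≡ t)))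
    × (∀ A → Invertible A → (φ A ≡ idPerm n → Scalar A) × (Scalar A → φ A ≡ idPerm n))

  PSLArcRegular : (Mat q → Perm n) → Set
  PSLArcRegular φ =
    (∀ u v u' v' → Arc X u v → Arc X u' v' →
       ∃[ A ] (Special A × (app (φ A) u ≡ u') × (app (φ A) v ≡ v')))
    × (∀ u v A B → Arc X u v → Special A → Special B →
       app (φ A) u ≡ app (φ B) u → app (φ A) v ≡ app (φ B) v → φ A ≡ φ B)

{-# OPTIONS --safe #-}
module Submission where

-- On 2 × 2 matrices put the polarisation ⟨ A , B ⟩ = tr (adj A · B) of det. An element of PSL(2,q) fixes a vertex
-- exactly when it is the identity or a nonscalar matrix of trace ±1, and an element outside PSL(2,q) only when its
-- trace is 0. So an intersecting family in PSL(2,q) is a set of unimodular matrices with pairwise products ±1, and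
-- one in PGL(2,q) is a pair of such sets, one multiplied by a reflection T, which are orthogonal to each other.
-- As the form lives on a 4-dimensional space, five matrices are dependent and their Gram matrix is singular: outside
-- characteristic 3 this leaves at most 4 matrices (6 if 5 = 0), and at most 6 for the two orthogonal sets; in
-- characteristic 3 the large families are the translates of commuting unipotents, and as the vertex stabiliser S₃ is
-- not contained in PSL(2,q) there, -1 is a nonsquare and even k cannot occur. Which configurations occur depends
-- on √-3 and √5 lying in the field, which is decided by counting fixed points of cyclic actions of order 3 and 5.
-- Finally an arc-transitive group contains all squares of automorphisms, hence the transvections and PSL(2,q), which
-- has index 2, so only PSL(2,q) and PGL(2,q) have to be considered.

open import Defs
open import Data.Nat as ℕ using (ℕ; zero; suc; _^_; _∸_; _/_; _%_; _≥_; z≤n; s≤s)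
import Data.Nat.Properties as ℕ
import Data.Nat.Divisibility as ℕ
open import Data.Nat.DivMod using (m≡m%n+[m/n]*n; m%n<n; [m+kn]%n≡m%n; %-distribˡ-+; %-distribˡ-*)
open import Data.Nat.Induction using (<-wellFounded)
open import Data.Nat.Primality using (Prime; prime?; prime[2]; euclidsLemma; prime⇒irreducible; prime⇒nonTrivial)
open import Data.Nat.Solver using (module +-*-Solver)
open import Data.Integer as ℤ using (ℤ; +_; -[1+_])
import Data.Integer.Properties as ℤ
open import Data.Sign using (Sign; opposite)
open import Data.Bool.Properties using (T?; T-≡)
open import Data.Fin using (Fin; zero; suc; punchIn)
open import Data.Fin.Properties using (_≟_; any?; all?; ¬Fin0)
open import Data.Fin.Permutation using (permutation)
open import Data.Vec using (lookup; tabulate; [])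
open import Data.Vec.Properties using (lookup∘tabulate; lookup-allFin; tabulate∘lookup; tabulate-cong; ≡-dec)
open import Data.Vec.Functional using (insertAt)
open import Data.Vec.Functional.Properties using (insertAt-lookup; insertAt-punchIn)
open import Data.List using (List; []; _∷_; _++_; length; map; filter; filterᵇ; applyUpTo; allFin)
open import Data.List.Properties using (length-++; length-map; length-applyUpTo; length-tabulate)
open import Data.List.Membership.Propositional using (_∈_; _∉_; find)
open import Data.List.Membership.Propositional.Properties using (∈-filter⁺; ∈-filter⁻; ∈-map⁺; ∈-map⁻; ∈-++⁺ˡ; ∈-++⁺ʳ; ∈-++⁻; ∈-∃++; ∈-applyUpTo⁺; ∈-applyUpTo⁻; ∈-allFin)
open import Data.List.Relation.Unary.Any using (here; there)
open import Data.List.Relation.Unary.All as All using (All; []; _∷_)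
import Data.List.Relation.Unary.All.Properties as All
open import Data.List.Relation.Unary.AllPairs as AllPairs using (AllPairs; []; _∷_; allPairs?)
import Data.List.Relation.Unary.AllPairs.Properties as AllPairs
open import Data.List.Relation.Unary.Unique.Propositional using (Unique)
import Data.List.Relation.Unary.Unique.Propositional.Properties as Unique
open import Data.List.Relation.Binary.Permutation.Propositional using (_↭_; prep; swap; ↭-refl; ↭-trans; ↭⇒↭ₛ)
open import Data.List.Relation.Binary.Permutation.Propositional.Properties using (All-resp-↭; ↭-length)
import Data.List.Relation.Binary.Permutation.Setoid.Properties as Permutation
import Data.Maybe
open import Data.Product using (∃; ∃-syntax; _×_; _,_; proj₁; proj₂)
import Data.Product.Properties as Product
open import Data.Sum using (_⊎_; inj₁; inj₂; [_,_]′)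
open import Data.Empty using (⊥; ⊥-elim)
open import Function using (_∘_)
open import Function.Bundles using (module Equivalence)
open import Induction.WellFounded using (Acc; acc)
open import Level using (0ℓ)
open import Relation.Nullary using (¬_; Dec; yes; no; ¬?)
open import Relation.Nullary.Decidable using (map′; toWitness; dec⇒maybe; decidable-stable; _×-dec_; _⊎-dec_; _→-dec_)
open import Relation.Unary using (Decidable)
open import Relation.Binary.Definitions using (DecidableEquality)
open import Relation.Binary.PropositionalEquality using (_≡_; _≢_; refl; sym; trans; cong; cong₂; subst; setoid; module ≡-Reasoning)
open import Algebra.Bundles using (CommutativeRing)
import Algebra.Solver.Ring
import Algebra.Solver.Ring.AlmostCommutativeRing as AlmostCommutativeRing
import Algebra.Properties.Ring
import Algebra.Properties.CommutativeMonoid.Sum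
import Algebra.Properties.Semiring.Sum
import Algebra.Properties.Semiring.Mult.TCOptimised
import Algebra.Properties.Monoid.Mult.TCOptimised

-- An element of PSL(2,q) fixes its matrix only up to sign, so one product ±1 says nothing; what is
-- invariant is the product of the three pairings in a triple. If all these products at one member
-- are +1, signs can be chosen so that every pairing is 1. The Gram matrix I + J of five such
-- matrices has determinant 6, and four of them force 5 to be a square. If some product is -1, signs
-- give a triple with Gram matrix 3I - J, singular with kernel (1,1,1). Any further member pairs
-- oddly with that kernel vector, so the vanishing Gram determinant of five matrices becomes one
-- integer for each sign pattern. Apart from factors 2 and 3 only 10 occurs, which is why
-- characteristic 5 is special. The number -3 enters as the discriminant of a unimodular matrix of
-- trace ±1. Lower bounds need the converse of the trace criterion: nonscalar matrices with equal
-- trace and determinant are conjugate, so one known element with a fixed vertex suffices. Counting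
-- fixed points replaces quadratic reciprocity and the cyclicity of the multiplicative group.

-- Counting in lists without repetition

module _ {A : Set} where

  Unique-⊆-length : ∀ {xs ys : List A} → Unique xs → (∀ {x} → x ∈ xs → x ∈ ys) → length xs ℕ.≤ length ys
  Unique-⊆-length {[]} u s = z≤n
  Unique-⊆-length {x ∷ xs} {ys} (x∉ ∷ u) s with ∈-∃++ (s (here refl))
  ... | as , bs , refl = ℕ.≤-trans (s≤s (Unique-⊆-length u s′)) (ℕ.≤-reflexive eq)
    where
    eq : suc (length (as ++ bs)) ≡ length (as ++ x ∷ bs)
    eq = trans (cong suc (length-++ as)) (trans (sym (ℕ.+-suc (length as) _)) (sym (length-++ as)))
    s′ : ∀ {y} → y ∈ xs → y ∈ as ++ bs
    s′ {y} y∈ with ∈-++⁻ as (s (there y∈))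
    ... | inj₁ p = ∈-++⁺ˡ p
    ... | inj₂ (here refl) = ⊥-elim (All.lookup x∉ y∈ refl)
    ... | inj₂ (there p) = ∈-++⁺ʳ as p

  Unique-≈-length : ∀ {xs ys : List A} → Unique xs → Unique ys →
    (∀ {x} → x ∈ xs → x ∈ ys) → (∀ {x} → x ∈ ys → x ∈ xs) → length xs ≡ length ys
  Unique-≈-length u v s t = ℕ.≤-antisym (Unique-⊆-length u s) (Unique-⊆-length v t)

  length-filter-split : ∀ {P : A → Set} (P? : Decidable P) (xs : List A) →
    length xs ≡ length (filter P? xs) ℕ.+ length (filter (¬? ∘ P?) xs)
  length-filter-split P? [] = refl
  length-filter-split P? (x ∷ xs) with P? x
  ... | yes _ = cong suc (length-filter-split P? xs)
  ... | no _ = trans (cong suc (length-filter-split P? xs)) (sym (ℕ.+-suc _ _))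

module _ {A B : Set} where

  dependentPairs : List A → (A → List B) → List (A × B)
  dependentPairs [] f = []
  dependentPairs (x ∷ xs) f = map (x ,_) (f x) ++ dependentPairs xs f

  ∈-dependentPairs⁺ : ∀ {xs f x y} → x ∈ xs → y ∈ f x → (x , y) ∈ dependentPairs xs f
  ∈-dependentPairs⁺ (here refl) q = ∈-++⁺ˡ (∈-map⁺ _ q)
  ∈-dependentPairs⁺ {x₀ ∷ _} {f} (there p) q = ∈-++⁺ʳ (map (x₀ ,_) (f x₀)) (∈-dependentPairs⁺ p q)

  ∈-dependentPairs⁻ : ∀ xs {f x y} → (x , y) ∈ dependentPairs xs f → x ∈ xs × y ∈ f x
  ∈-dependentPairs⁻ (x ∷ xs) {f} p with ∈-++⁻ (map (x ,_) (f x)) p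
  ... | inj₂ q = let a , b = ∈-dependentPairs⁻ xs q in there a , b
  ... | inj₁ q with ∈-map⁻ _ q
  ...   | _ , r , refl = here refl , r

  dependentPairs-Unique : ∀ {xs f} → Unique xs → (∀ x → Unique (f x)) → Unique (dependentPairs xs f)
  dependentPairs-Unique {[]} u v = []
  dependentPairs-Unique {x ∷ xs} {f} (x∉ ∷ u) v =
    Unique.++⁺ (Unique.map⁺ (cong proj₂) (v x)) (dependentPairs-Unique u v) disjoint
    where
    disjoint : ∀ {z} → ¬ (z ∈ map (x ,_) (f x) × z ∈ dependentPairs xs f)
    disjoint (p , q) with ∈-map⁻ _ p
    ... | _ , _ , refl = All.lookup x∉ (proj₁ (∈-dependentPairs⁻ xs q)) refl

  length-dependentPairs : ∀ m xs {f} → (∀ {x} → x ∈ xs → length (f x) ≡ m) →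
    length (dependentPairs xs f) ≡ length xs ℕ.* m
  length-dependentPairs m [] e = refl
  length-dependentPairs m (x ∷ xs) {f} e =
    trans (length-++ (map (x ,_) (f x)))
      (cong₂ ℕ._+_ (trans (length-map _ (f x)) (e (here refl))) (length-dependentPairs m xs (e ∘ there)))

module _ {A : Set} (_≟_ : DecidableEquality A) where

  open import Data.List.Membership.DecPropositional _≟_ using (_∈?_)

  without : List A → List A → List A
  without ys xs = filter (¬? ∘ (λ x → x ∈? ys)) xs

  length-without : ∀ {xs ys : List A} → Unique xs → Unique ys → (∀ {y} → y ∈ ys → y ∈ xs) →
    length xs ≡ length ys ℕ.+ length (without ys xs)
  length-without {xs} {ys} u v s = trans (length-filter-split (λ x → x ∈? ys) xs) (cong (ℕ._+ length (without ys xs))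
    (Unique-≈-length (Unique.filter⁺ (λ x → x ∈? ys) u) v
      (λ p → proj₂ (∈-filter⁻ (λ x → x ∈? ys) {xs = xs} p)) (λ p → ∈-filter⁺ (λ x → x ∈? ys) (s p) p)))

  ∈-without⁺ : ∀ {xs ys x} → x ∈ xs → x ∉ ys → x ∈ without ys xs
  ∈-without⁺ p q = ∈-filter⁺ _ p q

  ∈-without⁻ : ∀ ys xs {x} → x ∈ without ys xs → x ∈ xs × x ∉ ys
  ∈-without⁻ ys xs p = ∈-filter⁻ (λ x → ¬? (x ∈? ys)) {xs = xs} p

  without-Unique : ∀ {xs} ys → Unique xs → Unique (without ys xs)
  without-Unique ys = Unique.filter⁺ (λ x → ¬? (x ∈? ys))

  -- Cyclic actions on lists: orbits and fixed points

  module _ (f : A → A) (m : ℕ) where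

    iter : ℕ → A → A
    iter zero x = x
    iter (suc i) x = f (iter i x)

    iter-+ : ∀ i j x → iter (i ℕ.+ j) x ≡ iter i (iter j x)
    iter-+ zero j x = refl
    iter-+ (suc i) j x = cong f (iter-+ i j x)

    orbit : A → List A
    orbit x = applyUpTo (λ i → iter i x) (suc m)

    iter-period : ∀ {x} → iter (suc m) x ≡ x → ∀ k → iter (k ℕ.* suc m) x ≡ x
    iter-period p zero = refl
    iter-period {x} p (suc k) = trans (iter-+ (suc m) (k ℕ.* suc m) x) (trans (cong (iter (suc m)) (iter-period p k)) p)

    ∈-orbit : ∀ {x} → iter (suc m) x ≡ x → ∀ i → iter i x ∈ orbit x
    ∈-orbit {x} p i = subst (_∈ orbit x) eq (∈-applyUpTo⁺ (λ j → iter j x) (m%n<n i (suc m)))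
      where
      eq : iter (i % suc m) x ≡ iter i x
      eq = trans (cong (iter (i % suc m)) (sym (iter-period p (i / suc m))))
             (trans (sym (iter-+ (i % suc m) (i / suc m ℕ.* suc m) x))
               (cong (λ j → iter j x) (sym (m≡m%n+[m/n]*n i (suc m)))))

    orbit-Unique : ∀ {x} → (∀ i {d} → d ℕ.< m → iter (suc d) (iter i x) ≢ iter i x) → Unique (orbit x)
    orbit-Unique {x} free = Unique.applyUpTo⁺₁ (λ i → iter i x) (suc m) distinct
      where
      distinct : ∀ {i j} → i ℕ.< j → j ℕ.< suc m → iter i x ≢ iter j x
      distinct {i} {suc j} (s≤s i≤j) (s≤s j<m) e = free i (ℕ.≤-<-trans (ℕ.m∸n≤m j i) j<m)
        (trans (sym (iter-+ (suc (j ℕ.∸ i)) i x)) (trans (cong (λ l → iter (suc l) x) (ℕ.m∸n+n≡m i≤j)) (sym e)))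

    -- One orbit is stripped at a time. It has exactly `suc m` members because no shorter period
    -- occurs, and the rest is again closed under `f`.
    free-period-∣-length : ∀ xs → Unique xs → (∀ {x} → x ∈ xs → f x ∈ xs) →
      (∀ {x} → x ∈ xs → iter (suc m) x ≡ x) → (∀ {x d} → x ∈ xs → d ℕ.< m → iter (suc d) x ≢ x) →
      suc m ℕ.∣ length xs
    free-period-∣-length xs₀ u₀ = go xs₀ u₀ (<-wellFounded (length xs₀))
      where
      go : ∀ xs → Unique xs → Acc ℕ._<_ (length xs) → (∀ {x} → x ∈ xs → f x ∈ xs) →
        (∀ {x} → x ∈ xs → iter (suc m) x ≡ x) → (∀ {x d} → x ∈ xs → d ℕ.< m → iter (suc d) x ≢ x) →
        suc m ℕ.∣ length xs
      go [] _ _ _ _ _ = suc m ℕ.∣0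
      go xs@(a ∷ as) u (acc rec) closed period free =
        subst (suc m ℕ.∣_) (sym len)
          (ℕ.∣m∣n⇒∣m+n ℕ.∣-refl
            (go ys (without-Unique (orbit a) u) (rec (subst (length ys ℕ.<_) (sym len) (s≤s (ℕ.m≤n+m (length ys) m))))
              (λ p → let x∈ , x∉ = ∈-without⁻ (orbit a) xs p in
                ∈-without⁺ (closed x∈) λ q → x∉ (backward x∈ q))
              (period ∘ proj₁ ∘ ∈-without⁻ (orbit a) xs) (free ∘ proj₁ ∘ ∈-without⁻ (orbit a) xs)))
        where
        ys : List A
        ys = without (orbit a) xs
        a∈ : a ∈ xs
        a∈ = here refl
        closed* : ∀ i → iter i a ∈ xs
        closed* zero = a∈
        closed* (suc i) = closed (closed* i)
        orbit⊆ : ∀ {y} → y ∈ orbit a → y ∈ xs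
        orbit⊆ q with ∈-applyUpTo⁻ (λ j → iter j a) q
        ... | i , _ , refl = closed* i
        -- On the list the m-th iterate inverts `f`, so a point mapped into the orbit already lies
        -- in it; hence the complement of the orbit is closed.
        backward : ∀ {x} → x ∈ xs → f x ∈ orbit a → x ∈ orbit a
        backward {x} x∈ q with ∈-applyUpTo⁻ (λ j → iter j a) q
        ... | i , _ , e = subst (_∈ orbit a) (trans (iter-+ m i a) (trans (cong (iter m) (sym e))
                (trans (sym (iter-+ m 1 x)) (trans (cong (λ j → iter j x) (ℕ.+-comm m 1)) (period x∈)))))
                (∈-orbit (period a∈) (m ℕ.+ i))
        len : length xs ≡ suc m ℕ.+ length ys
        len = trans (length-without u (orbit-Unique (λ i → free (closed* i))) orbit⊆)
                (cong (ℕ._+ length ys) (length-applyUpTo (λ i → iter i a) (suc m)))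

    fixed : List A → List A
    fixed = filter (λ x → f x ≟ x)

    -- The moved points fall into orbits of full length `suc m`, so only the fixed points survive in
    -- the count.
    length-mod-fixed : ∀ xs → Unique xs → (∀ {x} → x ∈ xs → f x ∈ xs) →
      (∀ {x} → x ∈ xs → iter (suc m) x ≡ x) → (∀ {x d} → x ∈ xs → f x ≢ x → d ℕ.< m → iter (suc d) x ≢ x) →
      length xs % suc m ≡ length (fixed xs) % suc m
    length-mod-fixed xs u closed period free
      with free-period-∣-length moved (Unique.filter⁺ moved? u)
             (λ p → let x∈ , n = ∈-filter⁻ moved? {xs = xs} p in
               ∈-filter⁺ moved? (closed x∈) λ e → n (collapse x∈ e))
             (period ∘ proj₁ ∘ ∈-filter⁻ moved? {xs = xs})
             (λ p → let x∈ , n = ∈-filter⁻ moved? {xs = xs} p in free x∈ n)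
      where
      moved? : Decidable (λ x → f x ≢ x)
      moved? x = ¬? (f x ≟ x)
      moved : List A
      moved = filter moved? xs
      -- A moved point never lands on a fixed one: if `f x` is fixed, following the whole period
      -- gives x = f x.
      collapse : ∀ {x} → x ∈ xs → f (f x) ≡ f x → f x ≡ x
      collapse {x} x∈ e = trans (sym (trans (sym (iter-+ m 1 x)) (stable m))) back
        where
        stable : ∀ i → iter (i ℕ.+ 1) x ≡ f x
        stable zero = refl
        stable (suc i) = trans (cong f (stable i)) e
        back : iter m (f x) ≡ x
        back = trans (sym (iter-+ m 1 x)) (trans (cong (λ j → iter j x) (ℕ.+-comm m 1)) (period x∈))
    ... | ℕ.divides k e = trans (cong (_% suc m) (trans (length-filter-split (λ x → f x ≟ x) xs)
            (cong (length (fixed xs) ℕ.+_) e))) ([m+kn]%n≡m%n (length (fixed xs)) k (suc m))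

  module _ (f : A → A) where

    -- A period and a shorter one that is coprime to it generate 1; the orders used below, 3 and 5,
    -- are prime.
    period-3 : ∀ {x d} → iter f 2 3 x ≡ x → d ℕ.< 2 → iter f 2 (suc d) x ≡ x → f x ≡ x
    period-3 {d = zero} p _ e = e
    period-3 {d = suc zero} p _ e = trans (sym (cong f e)) p
    period-3 {d = suc (suc d)} _ (s≤s (s≤s ()))

    period-5 : ∀ {x d} → iter f 4 5 x ≡ x → d ℕ.< 4 → iter f 4 (suc d) x ≡ x → f x ≡ x
    period-5 {d = 0} p _ e = e
    period-5 {d = 1} p _ e = trans (sym (cong f (trans (cong (f ∘ f) e) e))) p
    period-5 {d = 2} p _ e = trans (cong f (sym p)) (trans (cong (f ∘ f ∘ f) e) e)
    period-5 {d = 3} p _ e = trans (sym (cong f e)) p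
    period-5 {d = suc (suc (suc (suc d)))} _ (s≤s (s≤s (s≤s (s≤s ()))))

-- Sign patterns against a triple with pairings -1

value : Sign → ℤ
value Sign.+ = + 1
value Sign.- = -[1+ 0 ]

Signs : Set
Signs = Sign × Sign × Sign

total : Signs → ℤ
total (x , y , z) = value x ℤ.+ value y ℤ.+ value z

dot : Signs → Signs → ℤ
dot (x , y , z) (x′ , y′ , z′) = value x ℤ.* value x′ ℤ.+ value y ℤ.* value y′ ℤ.+ value z ℤ.* value z′

-- The integer that has to vanish in the field when X, Y have sign vectors x, y against a minus triple and ⟨ X , Y ⟩ = g.
discrepancy : Signs → Signs → Sign → ℤ
discrepancy x y g = + 2 ℤ.* (total x ℤ.* total y) ℤ.* (+ 3 ℤ.* value g ℤ.- dot x y) ℤ.- + 3 ℤ.* (total x ℤ.* total x ℤ.+ total y ℤ.* total y)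

-- The class of a sign vector up to a global sign; zero is the constant vector.
class : Signs → Fin 4
class (Sign.+ , Sign.+ , Sign.+) = zero
class (Sign.- , Sign.- , Sign.-) = zero
class (Sign.- , Sign.+ , Sign.+) = suc zero
class (Sign.+ , Sign.- , Sign.-) = suc zero
class (Sign.+ , Sign.- , Sign.+) = suc (suc zero)
class (Sign.- , Sign.+ , Sign.-) = suc (suc zero)
class (Sign.+ , Sign.+ , Sign.-) = suc (suc (suc zero))
class (Sign.- , Sign.- , Sign.+) = suc (suc (suc zero))

-- A divisor of 162 = 2 · 3^4 cannot vanish where 2 and 3 do not; the value 162 itself comes from
-- constant patterns. The only other absolute value is 10, which vanishes only with 5, and there the
-- classes are recorded because they limit how many members can coexist.
Admissible : Signs → Signs → Sign → Set
Admissible x y g = ℤ.∣ discrepancy x y g ∣ ℕ.∣ 162 ⊎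
  (ℤ.∣ discrepancy x y g ∣ ≡ 10 × class x ≢ class y × class x ≢ zero × class y ≢ zero)

admissible? : ∀ x y g → Dec (Admissible x y g)
admissible? x y g = (ℤ.∣ discrepancy x y g ∣ ℕ.∣? 162) ⊎-dec
  ((ℤ.∣ discrepancy x y g ∣ ℕ.≟ 10) ×-dec ¬? (class x ≟ class y) ×-dec ¬? (class x ≟ zero) ×-dec ¬? (class y ≟ zero))

everySign? : {P : Sign → Set} → (∀ s → Dec (P s)) → Dec (∀ s → P s)
everySign? P? = map′ (λ (p , m) → λ { Sign.+ → p ; Sign.- → m }) (λ f → f Sign.+ , f Sign.-) (P? Sign.+ ×-dec P? Sign.-)

everySigns? : {P : Signs → Set} → (∀ x → Dec (P x)) → Dec (∀ x → P x)
everySigns? P? = map′ (λ f (x , y , z) → f x y z) (λ f x y z → f (x , y , z))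
  (everySign? λ x → everySign? λ y → everySign? λ z → P? (x , y , z))

abstract
  -- The 8 · 8 · 2 patterns are evaluated over ℤ, so the check does not depend on the field.
  admissible : ∀ x y g → Admissible x y g
  admissible = toWitness {a? = everySigns? λ x → everySigns? λ y → everySign? λ g → admissible? x y g} _

-- A sum of three signs is odd; hence it stays nonzero in every field where 3 is nonzero.
total-values : ∀ x → (ℤ.∣ total x ∣ ≡ 1) ⊎ (ℤ.∣ total x ∣ ≡ 3)
total-values (Sign.+ , Sign.+ , Sign.+) = inj₂ refl
total-values (Sign.- , Sign.- , Sign.-) = inj₂ refl
total-values (Sign.- , Sign.+ , Sign.+) = inj₁ refl
total-values (Sign.+ , Sign.- , Sign.-) = inj₁ refl
total-values (Sign.+ , Sign.- , Sign.+) = inj₁ refl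
total-values (Sign.- , Sign.+ , Sign.-) = inj₁ refl
total-values (Sign.+ , Sign.+ , Sign.-) = inj₁ refl
total-values (Sign.- , Sign.- , Sign.+) = inj₁ refl

-- Permutation tables and permutations of three points

module _ {n : ℕ} where

  app-∘ : ∀ (s t : Perm n) i → app (s ∘P t) i ≡ app s (app t i)
  app-∘ s t i = lookup∘tabulate (λ i → app s (app t i)) i

  app-id : ∀ i → app (idPerm n) i ≡ i
  app-id = lookup-allFin

  perm-ext : ∀ {s t : Perm n} → (∀ i → app s i ≡ app t i) → s ≡ t
  perm-ext {s} {t} e = trans (sym (tabulate∘lookup s)) (trans (tabulate-cong e) (tabulate∘lookup t))

  ∘P-assoc : ∀ (r s t : Perm n) → (r ∘P s) ∘P t ≡ r ∘P (s ∘P t)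
  ∘P-assoc r s t = perm-ext λ i → trans (app-∘ (r ∘P s) t i) (trans (app-∘ r s _)
    (sym (trans (app-∘ r (s ∘P t) i) (cong (app r) (app-∘ s t i)))))

  ∘P-idˡ : ∀ (t : Perm n) → idPerm n ∘P t ≡ t
  ∘P-idˡ t = perm-ext λ i → trans (app-∘ (idPerm n) t i) (app-id _)

  ∘P-idʳ : ∀ (t : Perm n) → t ∘P idPerm n ≡ t
  ∘P-idʳ t = perm-ext λ i → trans (app-∘ t (idPerm n) i) (cong (app t) (app-id i))

Triple3 : Set
Triple3 = Fin 3 × Fin 3 × Fin 3

at : Triple3 → Fin 3 → Fin 3
at (a , b , c) zero = a
at (a , b , c) (suc zero) = b
at (a , b , c) (suc (suc zero)) = c

-- Phrased by orders and not by cycle types: an equation between powers carries over to a power of a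
-- matrix being scalar.
ThreeCycleOrFixing : (Fin 3 → Fin 3) → Set
ThreeCycleOrFixing σ = (∀ i → σ (σ (σ i)) ≡ i) ⊎ (∃[ i ] σ i ≡ i) × (∀ i → σ (σ i) ≡ i)

abstract
  permutation-of-three : ∀ a b c → a ≢ b → a ≢ c → b ≢ c → ThreeCycleOrFixing (at (a , b , c))
  permutation-of-three = toWitness {a? = all? λ a → all? λ b → all? λ c →
    ¬? (a ≟ b) →-dec (¬? (a ≟ c) →-dec (¬? (b ≟ c) →-dec
      (all? (λ i → at (a , b , c) (at (a , b , c) (at (a , b , c) i)) ≟ i)
       ⊎-dec (any? (λ i → at (a , b , c) i ≟ i) ×-dec all? (λ i → at (a , b , c) (at (a , b , c) i) ≟ i)))))} _

injective-on-three : (σ : Fin 3 → Fin 3) → (∀ {i j} → σ i ≡ σ j → i ≡ j) → ThreeCycleOrFixing σ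
injective-on-three σ inj = transfer (permutation-of-three (σ zero) (σ (suc zero)) (σ (suc (suc zero)))
    (0≢1 ∘ inj) (0≢2 ∘ inj) (1≢2 ∘ inj))
  where
  0≢1 : zero ≢ suc zero
  0≢1 ()
  0≢2 : zero ≢ suc (suc zero)
  0≢2 ()
  1≢2 : suc zero ≢ suc (suc zero)
  1≢2 ()
  ρ : Fin 3 → Fin 3
  ρ = at (σ zero , σ (suc zero) , σ (suc (suc zero)))
  same : ∀ i → ρ i ≡ σ i
  same zero = refl
  same (suc zero) = refl
  same (suc (suc zero)) = refl
  same² : ∀ i → ρ (ρ i) ≡ σ (σ i)
  same² i = trans (same (ρ i)) (cong σ (same i))
  transfer : ThreeCycleOrFixing ρ → ThreeCycleOrFixing σ
  transfer (inj₁ c) = inj₁ λ i → trans (sym (trans (same (ρ (ρ i))) (cong σ (same² i)))) (c i)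
  transfer (inj₂ ((i , e) , c)) = inj₂ ((i , trans (sym (same i)) e) , λ j → trans (sym (same² j)) (c j))

-- Vertex stabilisers in a cubic 2-arc-regular graph

module CubicGraph {n : ℕ} (X : Graph n) (cubic : Cubic X) where
  open Graph X using (adj) renaming (sym to adj-sym; irrefl to adj-irrefl)

  neighbourList : Fin n → List (Fin n)
  neighbourList v = filterᵇ (adj v) (allFin n)

  neighbourList-Unique : ∀ v → Unique (neighbourList v)
  neighbourList-Unique v = Unique.filter⁺ (λ u → T? (adj v u)) (Unique.allFin⁺ n)
    where import Data.Bool.Properties

  ∈-neighbourList⁺ : ∀ {v u} → Arc X v u → u ∈ neighbourList v
  ∈-neighbourList⁺ {v} {u} a = ∈-filter⁺ (λ u → T? (adj v u)) (∈-allFin u) (Equivalence.from T-≡ a)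
    where import Data.Bool.Properties

  ∈-neighbourList⁻ : ∀ {v u} → u ∈ neighbourList v → Arc X v u
  ∈-neighbourList⁻ {v} {u} p = Equivalence.to T-≡ (proj₂ (∈-filter⁻ (λ u → T? (adj v u)) {xs = allFin n} p))
    where import Data.Bool.Properties

  Arc-sym : ∀ {u v} → Arc X u v → Arc X v u
  Arc-sym {u} {v} a = trans (adj-sym v u) a

  record Neighbours (v : Fin n) : Set where
    field
      nbr : Fin 3 → Fin n
      nbr-arc : ∀ i → Arc X v (nbr i)
      nbr-injective : ∀ {i j} → nbr i ≡ nbr j → i ≡ j
      index : ∀ {u} → Arc X v u → ∃[ i ] nbr i ≡ u

  abstract
    neighbours : ∀ v → Neighbours v
    neighbours v = build (neighbourList v) (cubic v) (neighbourList-Unique v) ∈-neighbourList⁻ ∈-neighbourList⁺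
      where
      build : ∀ L → length L ≡ 3 → Unique L → (∀ {u} → u ∈ L → Arc X v u) → (∀ {u} → Arc X v u → u ∈ L) → Neighbours v
      build (a ∷ b ∷ c ∷ []) _ ((ab ∷ ac ∷ []) ∷ (bc ∷ []) ∷ [] ∷ []) to from = record
        { nbr = nbr
        ; nbr-arc = λ { zero → to (here refl) ; (suc zero) → to (there (here refl)) ; (suc (suc zero)) → to (there (there (here refl))) }
        ; nbr-injective = injective
        ; index = λ p → locate (from p) }
        where
        nbr : Fin 3 → Fin n
        nbr zero = a
        nbr (suc zero) = b
        nbr (suc (suc zero)) = c
        injective : ∀ {i j} → nbr i ≡ nbr j → i ≡ j
        injective {zero} {zero} _ = refl
        injective {zero} {suc zero} e = ⊥-elim (ab e)
        injective {zero} {suc (suc zero)} e = ⊥-elim (ac e)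
        injective {suc zero} {zero} e = ⊥-elim (ab (sym e))
        injective {suc zero} {suc zero} _ = refl
        injective {suc zero} {suc (suc zero)} e = ⊥-elim (bc e)
        injective {suc (suc zero)} {zero} e = ⊥-elim (ac (sym e))
        injective {suc (suc zero)} {suc zero} e = ⊥-elim (bc (sym e))
        injective {suc (suc zero)} {suc (suc zero)} _ = refl
        locate : ∀ {u} → u ∈ (a ∷ b ∷ c ∷ []) → ∃[ i ] nbr i ≡ u
        locate (here refl) = zero , refl
        locate (there (here refl)) = suc zero , refl
        locate (there (there (here refl))) = suc (suc zero) , refl

  aut-∘ : ∀ s t → IsAut X s → IsAut X t → IsAut X (s ∘P t)
  aut-∘ s t (si , sa) (ti , ta) =
    (λ i j e → ti i j (si _ _ (trans (sym (app-∘ s t i)) (trans e (app-∘ s t j))))) ,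
    (λ u v → trans (cong₂ adj (app-∘ s t u) (app-∘ s t v)) (trans (sa _ _) (ta u v)))

  aut-id : IsAut X (idPerm n)
  aut-id = (λ i j e → trans (sym (app-id i)) (trans e (app-id j))) , (λ u v → cong₂ adj (app-id u) (app-id v))

  aut-arc : ∀ t {u v} → IsAut X t → Arc X u v → Arc X (app t u) (app t v)
  aut-arc t (_ , a) e = trans (a _ _) e

  module TwoArcRegular (regular : AutTwoArcRegular X) where

    fixes-two-arc : ∀ t {v u w} → IsAut X t → Arc X v u → Arc X v w → u ≢ w →
      app t v ≡ v → app t u ≡ u → app t w ≡ w → t ≡ idPerm n
    fixes-two-arc t {v} {u} {w} a vu vw u≢w ev eu ew = proj₂ regular u v w t (idPerm n)
      (Arc-sym vu , vw , u≢w) a aut-id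
      (trans eu (sym (app-id u))) (trans ev (sym (app-id v))) (trans ew (sym (app-id w)))

    module AtVertex (v : Fin n) where
      open Neighbours (neighbours v) public

      nbr-≢ : ∀ {i j} → i ≢ j → nbr i ≢ nbr j
      nbr-≢ n e = n (nbr-injective e)

      module _ (t : Perm n) (a : IsAut X t) (tv : app t v ≡ v) where
        local : ∀ i → ∃[ j ] nbr j ≡ app t (nbr i)
        local i = index (subst (λ u → Arc X u (app t (nbr i))) tv (aut-arc t a (nbr-arc i)))

        σ : Fin 3 → Fin 3
        σ i = proj₁ (local i)

        t-nbr : ∀ i → app t (nbr i) ≡ nbr (σ i)
        t-nbr i = sym (proj₂ (local i))

        σ-injective : ∀ {i j} → σ i ≡ σ j → i ≡ j
        σ-injective {i} {j} e = nbr-injective (proj₁ a _ _ (trans (t-nbr i) (trans (cong nbr e) (sym (t-nbr j)))))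

        t²-nbr : ∀ i → app (t ∘P t) (nbr i) ≡ nbr (σ (σ i))
        t²-nbr i = trans (app-∘ t t _) (trans (cong (app t) (t-nbr i)) (t-nbr _))

        t²-v : app (t ∘P t) v ≡ v
        t²-v = trans (app-∘ t t v) (trans (cong (app t) tv) tv)

        abstract
          -- A vertex and two of its neighbours form a 2-arc, so an automorphism fixing `v` is
          -- determined by its permutation `σ` of the three neighbours and inherits the order of
          -- `σ`.
          stabiliser-structure : t ∘P (t ∘P t) ≡ idPerm n ⊎ (∃[ i ] app t (nbr i) ≡ nbr i) × t ∘P t ≡ idPerm n
          stabiliser-structure = [ three-cycle , involution ]′ (injective-on-three σ σ-injective)
            where
            three-cycle : (∀ i → σ (σ (σ i)) ≡ i) → t ∘P (t ∘P t) ≡ idPerm n ⊎ (∃[ i ] app t (nbr i) ≡ nbr i) × t ∘P t ≡ idPerm n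
            three-cycle c = inj₁ (fixes-two-arc (t ∘P (t ∘P t)) (aut-∘ t (t ∘P t) a (aut-∘ t t a a)) (nbr-arc zero) (nbr-arc (suc zero)) (nbr-≢ λ ())
                (trans (app-∘ t (t ∘P t) v) (trans (cong (app t) t²-v) tv)) (t³-nbr zero) (t³-nbr (suc zero)))
              where
              t³-nbr : ∀ i → app (t ∘P (t ∘P t)) (nbr i) ≡ nbr i
              t³-nbr i = trans (app-∘ t (t ∘P t) (nbr i)) (trans (cong (app t) (t²-nbr i)) (trans (t-nbr (σ (σ i))) (cong nbr (c i))))
            involution : (∃[ i ] σ i ≡ i) × (∀ i → σ (σ i) ≡ i) → t ∘P (t ∘P t) ≡ idPerm n ⊎ (∃[ i ] app t (nbr i) ≡ nbr i) × t ∘P t ≡ idPerm n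
            involution ((i , e) , c) = inj₂ ((i , trans (t-nbr i) (cong nbr e)) ,
                fixes-two-arc (t ∘P t) (aut-∘ t t a a) (nbr-arc zero) (nbr-arc (suc zero)) (nbr-≢ λ ())
                  t²-v (trans (t²-nbr zero) (cong nbr (c zero))) (trans (t²-nbr (suc zero)) (cong nbr (c (suc zero)))))

pairs⁺ : ∀ {A : Set} {R : A → A → Set} xs → (∀ {x y} → x ∈ xs → y ∈ xs → R x y) → AllPairs R xs
pairs⁺ [] r = []
pairs⁺ (x ∷ xs) r = All.tabulate (λ y∈ → r (here refl) (there y∈)) ∷ pairs⁺ xs (λ p s → r (there p) (there s))

-- Explicit matrices over ℤ[r]/(r² - r + 1), with coefficients read modulo N.
Eisenstein : Set
Eisenstein = ℤ × ℤ

_⊞_ _⊠_ : Eisenstein → Eisenstein → Eisenstein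
(m , n) ⊞ (m′ , n′) = m ℤ.+ m′ , n ℤ.+ n′
(m , n) ⊠ (m′ , n′) = m ℤ.* m′ ℤ.+ ℤ.- (n ℤ.* n′) , m ℤ.* n′ ℤ.+ n ℤ.* m′ ℤ.+ n ℤ.* n′

⊟_ : Eisenstein → Eisenstein
⊟ (m , n) = ℤ.- m , ℤ.- n

EisensteinMatrix : Set
EisensteinMatrix = Eisenstein × Eisenstein × Eisenstein × Eisenstein

determinantᴱ : EisensteinMatrix → Eisenstein
determinantᴱ (a , b , c , d) = (a ⊠ d) ⊞ (⊟ (b ⊠ c))

formᴱ : EisensteinMatrix → EisensteinMatrix → Eisenstein
formᴱ (a , b , c , d) (a′ , b′ , c′ , d′) = (((a ⊠ d′) ⊞ (d ⊠ a′)) ⊞ (⊟ (b ⊠ c′))) ⊞ (⊟ (c ⊠ b′))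

-- Modulus 0 means equality, so one notion covers the matrices valid in every characteristic and
-- those valid only where 5 = 0.
CongruentTo : ℕ → ℤ → Eisenstein → Set
CongruentTo N i (m , n) = N ℕ.∣ ℤ.∣ m ℤ.- i ∣ × N ℕ.∣ ℤ.∣ n ∣

congruentTo? : ∀ N i x → Dec (CongruentTo N i x)
congruentTo? N i (m , n) = (N ℕ.∣? ℤ.∣ m ℤ.- i ∣) ×-dec (N ℕ.∣? ℤ.∣ n ∣)

CliqueModulo : ℕ → List EisensteinMatrix → Set
CliqueModulo N xs = All (λ x → CongruentTo N (+ 1) (determinantᴱ x)) xs × AllPairs (λ x y → CongruentTo N (+ 1) (formᴱ x y) ⊎ CongruentTo N -[1+ 0 ] (formᴱ x y)) xs

cliqueModulo? : ∀ N xs → Dec (CliqueModulo N xs)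
cliqueModulo? N xs = All.all? (λ x → congruentTo? N (+ 1) (determinantᴱ x)) xs ×-dec allPairs? (λ x y → congruentTo? N (+ 1) (formᴱ x y) ⊎-dec congruentTo? N -[1+ 0 ] (formᴱ x y)) xs

0ᴱ 1ᴱ ω ω² : Eisenstein
0ᴱ = + 0 , + 0
1ᴱ = + 1 , + 0
ω = + 0 , -[1+ 0 ]
ω² = -[1+ 0 ] , + 1

-- With ω = -r a primitive cube root of unity, the last three of the four matrices have trace ω + ω²
-- = -1. An upper and a lower triangular matrix with diagonal ω², ω pair to 2 minus the product of
-- their off-diagonal entries, so the entry 3 gives -1. The entry 1 gives +1, and modulo 5 two more
-- matrices then fit.
fourMatrices sixMatrices : List EisensteinMatrix
fourMatrices = (1ᴱ , 0ᴱ , 0ᴱ , 1ᴱ) ∷ (ω , 0ᴱ , 0ᴱ , ω²) ∷ (ω² , 1ᴱ , 0ᴱ , ω) ∷ (ω² , 0ᴱ , (+ 3 , + 0) , ω) ∷ []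
sixMatrices = (1ᴱ , 0ᴱ , 0ᴱ , 1ᴱ) ∷ (ω , 0ᴱ , 0ᴱ , ω²) ∷ (ω² , 1ᴱ , 0ᴱ , ω) ∷ (ω² , 0ᴱ , 1ᴱ , ω)
  ∷ ((+ 2 , -[1+ 2 ]) , 1ᴱ , 1ᴱ , (+ 4 , -[1+ 1 ])) ∷ ((+ 3 , -[1+ 1 ]) , 1ᴱ , 1ᴱ , (+ 1 , -[1+ 2 ])) ∷ []

abstract
  fourMatrices-clique : CliqueModulo 0 fourMatrices
  fourMatrices-clique = toWitness {a? = cliqueModulo? 0 fourMatrices} _

  sixMatrices-clique : CliqueModulo 5 sixMatrices
  sixMatrices-clique = toWitness {a? = cliqueModulo? 5 sixMatrices} _

-- Arithmetic of q

abstract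
  prime-5 : Prime 5
  prime-5 = toWitness {a? = prime? 5} _

prime-∣-power : ∀ {r p} k → Prime r → Prime p → r ℕ.∣ p ^ k → r ≡ p
prime-∣-power {r} {p} k pr pp d = conclude (prime⇒irreducible pp (base k d))
  where
  r≢1 : r ≢ 1
  r≢1 refl = ℕ.<-irrefl refl (ℕ.nonTrivial⇒n>1 1 {{prime⇒nonTrivial pr}})
  base : ∀ k → r ℕ.∣ p ^ k → r ℕ.∣ p
  base zero d = ⊥-elim (r≢1 (ℕ.∣1⇒≡1 d))
  base (suc k) d = pick (euclidsLemma p (p ^ k) pr d)
    where
    pick : r ℕ.∣ p ⊎ r ℕ.∣ p ^ k → r ℕ.∣ p
    pick (inj₁ e) = e
    pick (inj₂ e) = base k e
  conclude : r ≡ 1 ⊎ r ≡ p → r ≡ p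
  conclude (inj₁ e) = ⊥-elim (r≢1 e)
  conclude (inj₂ e) = e

odd-prime-power-≥3 : ∀ {p} k → Prime p → p ≢ 2 → k ≥ 1 → 3 ℕ.≤ p ^ k
odd-prime-power-≥3 {p} (suc k) pp p≢2 _ = ℕ.≤-trans (ℕ.≤∧≢⇒< (ℕ.nonTrivial⇒n>1 p {{prime⇒nonTrivial pp}}) (p≢2 ∘ sym))
  (subst (p ℕ.≤_) (ℕ.*-comm (p ^ k) p) (ℕ.m≤n*m p (p ^ k) {{ℕ.m^n≢0 p k {{nonZero}}}}))
  where
  nonZero : ℕ.NonZero p
  nonZero = ℕ.nonTrivial⇒nonZero p {{prime⇒nonTrivial pp}}

-- Since 9 = 1 modulo 4. This will clash with q = 3 modulo 4.
even-power-of-3 : ∀ k → k % 2 ≡ 0 → 3 ^ k % 4 ≡ 1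
even-power-of-3 zero _ = refl
even-power-of-3 (suc zero) ()
even-power-of-3 (suc (suc k)) e = trans (cong (_% 4) (sym (ℕ.*-assoc 3 3 (3 ^ k))))
  (trans (%-distribˡ-* 9 (3 ^ k) 4) (cong (λ t → (1 ℕ.* t) % 4) (even-power-of-3 k (trans (sym ([m+kn]%n≡m%n k 1 2)) (trans (cong (_% 2) (ℕ.+-comm k 2)) e)))))

-- Supplies the base vertex: over no vertices all permutations coincide, which the nontrivial group
-- PGL(2,q) excludes.
vertex : ∀ {n} → ((s t : Perm n) → s ≡ t) ⊎ Fin n
vertex {zero} = inj₁ λ { [] [] → refl }
vertex {suc n} = inj₂ zero

∈-singleton : ∀ {A : Set} {x y : A} → x ∈ y ∷ [] → x ≡ y
∈-singleton (here e) = e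

-- The field: numerals, certificates and squares

module Development {q : ℕ} (F : FiniteField q) where
  open FiniteField F public

  commutativeRing : CommutativeRing 0ℓ 0ℓ
  commutativeRing = record { isCommutativeRing = isCommutativeRing }

  open CommutativeRing commutativeRing using (ring; semiring; +-commutativeMonoid; +-monoid;
    +-assoc; +-comm; +-identityˡ; +-identityʳ; *-assoc; *-comm; *-identityˡ; *-identityʳ;
    distribˡ; distribʳ; zeroˡ; zeroʳ; -‿inverseˡ; -‿inverseʳ)
  open Algebra.Properties.Ring ring using (-‿involutive; -‿distribˡ-*; -‿distribʳ-*; -‿+-comm; -0#≈0#; +-cancelˡ; +-cancelʳ)
  open Algebra.Properties.Semiring.Mult.TCOptimised semiring using (×1-homo-*)
  open Algebra.Properties.Monoid.Mult.TCOptimised +-monoid using (1+×; ×-homo-+) renaming (_×_ to _⋆_)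

  ι : ℤ → Fin q
  ι (+ n) = n ⋆ 1F
  ι -[1+ n ] = -F (suc n ⋆ 1F)

  ι-suc : ∀ n → ι (+ suc n) ≡ 1F +F ι (+ n)
  ι-suc n = 1+× n 1F

  private
    shift-cancel : ∀ x y z → (x +F y) +F (-F (x +F z)) ≡ y +F (-F z)
    shift-cancel x y z = begin
      (x +F y) +F (-F (x +F z)) ≡⟨ cong ((x +F y) +F_) (sym (-‿+-comm x z)) ⟩
      (x +F y) +F ((-F x) +F (-F z)) ≡⟨ cong (_+F ((-F x) +F (-F z))) (+-comm x y) ⟩
      (y +F x) +F ((-F x) +F (-F z)) ≡⟨ +-assoc y x _ ⟩
      y +F (x +F ((-F x) +F (-F z))) ≡⟨ cong (y +F_) (sym (+-assoc x _ _)) ⟩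
      y +F ((x +F (-F x)) +F (-F z)) ≡⟨ cong (λ t → y +F (t +F (-F z))) (-‿inverseʳ x) ⟩
      y +F (0F +F (-F z)) ≡⟨ cong (y +F_) (+-identityˡ _) ⟩
      y +F (-F z) ∎
      where open ≡-Reasoning

  ι-⊖ : ∀ m n → ι (m ℤ.⊖ n) ≡ ι (+ m) +F (-F ι (+ n))
  ι-⊖ zero zero = sym (-‿inverseʳ 0F)
  ι-⊖ zero (suc n) = sym (+-identityˡ _)
  ι-⊖ (suc m) zero = sym (trans (cong (ι (+ suc m) +F_) -0#≈0#) (+-identityʳ _))
  ι-⊖ (suc m) (suc n) = begin
    ι (suc m ℤ.⊖ suc n) ≡⟨ cong ι (ℤ.[1+m]⊖[1+n]≡m⊖n m n) ⟩
    ι (m ℤ.⊖ n) ≡⟨ ι-⊖ m n ⟩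
    ι (+ m) +F (-F ι (+ n)) ≡⟨ sym (shift-cancel 1F _ _) ⟩
    (1F +F ι (+ m)) +F (-F (1F +F ι (+ n))) ≡⟨ cong₂ (λ x y → x +F (-F y)) (sym (ι-suc m)) (sym (ι-suc n)) ⟩
    ι (+ suc m) +F (-F ι (+ suc n)) ∎
    where open ≡-Reasoning

  ι-+ : ∀ i j → ι (i ℤ.+ j) ≡ ι i +F ι j
  ι-+ (+ m) (+ n) = ×-homo-+ 1F m n
  ι-+ (+ m) -[1+ n ] = ι-⊖ m (suc n)
  ι-+ -[1+ m ] (+ n) = trans (ι-⊖ n (suc m)) (+-comm _ _)
  ι-+ -[1+ m ] -[1+ n ] = trans (cong (λ t → -F (t ⋆ 1F)) (sym (ℕ.+-suc (suc m) n)))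
    (trans (cong -F_ (×-homo-+ 1F (suc m) (suc n))) (sym (-‿+-comm _ _)))

  ι-neg : ∀ i → ι (ℤ.- i) ≡ -F ι i
  ι-neg (+ zero) = sym -0#≈0#
  ι-neg (+ suc n) = refl
  ι-neg -[1+ n ] = sym (-‿involutive _)

  ι-*⁺ : ∀ m n → ι (+ m ℤ.* + n) ≡ ι (+ m) *F ι (+ n)
  ι-*⁺ m n = trans (cong ι (sym (ℤ.pos-* m n))) (×1-homo-* m n)

  ι-* : ∀ i j → ι (i ℤ.* j) ≡ ι i *F ι j
  ι-* (+ m) (+ n) = ι-*⁺ m n
  ι-* (+ m) -[1+ n ] = trans (cong ι (sym (ℤ.neg-distribʳ-* (+ m) (+ suc n))))
    (trans (ι-neg (+ m ℤ.* + suc n)) (trans (cong -F_ (ι-*⁺ m (suc n))) (-‿distribʳ-* _ _)))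
  ι-* -[1+ m ] j = trans (cong ι (sym (ℤ.neg-distribˡ-* (+ suc m) j)))
    (trans (ι-neg (+ suc m ℤ.* j)) (trans (cong -F_ (pos j)) (-‿distribˡ-* _ _)))
    where
    pos : ∀ j → ι (+ suc m ℤ.* j) ≡ ι (+ suc m) *F ι j
    pos (+ n) = ι-*⁺ (suc m) n
    pos -[1+ n ] = trans (cong ι (sym (ℤ.neg-distribʳ-* (+ suc m) (+ suc n))))
      (trans (ι-neg (+ suc m ℤ.* + suc n)) (trans (cong -F_ (ι-*⁺ (suc m) (suc n))) (-‿distribʳ-* _ _)))

  almost = AlmostCommutativeRing.fromCommutativeRing commutativeRing

  -- With ℤ as coefficient ring the solver normalises numerals although the characteristic of the
  -- field is not known.
  ι-morphism : ℤ.+-*-rawRing AlmostCommutativeRing.-Raw-AlmostCommutative⟶ almost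
  ι-morphism = record
    { ⟦_⟧ = ι ; +-homo = ι-+ ; *-homo = ι-* ; -‿homo = ι-neg ; 0-homo = refl ; 1-homo = refl }

  open Algebra.Solver.Ring ℤ.+-*-rawRing almost ι-morphism
    (λ i j → Data.Maybe.map (cong ι) (dec⇒maybe (i ℤ.≟ j))) public

  open Matrices F public using (_-F_)

  :-1 :-2 :-3 :-4 :0 :1 :2 :3 :4 :5 :6 : ∀ {m} → Polynomial m
  :-1 = con -[1+ 0 ]
  :-2 = con -[1+ 1 ]
  :-3 = con -[1+ 2 ]
  :-4 = con -[1+ 3 ]
  :0 = con (+ 0)
  :1 = con (+ 1)
  :2 = con (+ 2)
  :3 = con (+ 3)
  :4 = con (+ 4)
  :5 = con (+ 5)
  :6 = con (+ 6)

  infixl 6 _⊕_ _⊖_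
  infixl 7 _⊛_
  _⊕_ _⊛_ _⊖_ : Fin q → Fin q → Fin q
  _⊕_ = _+F_
  _⊛_ = _*F_
  _⊖_ = _-F_

  -1F : Fin q
  -1F = ι -[1+ 0 ]

  ⊖-self : ∀ x → x ⊖ x ≡ 0F
  ⊖-self = -‿inverseʳ

  diff-0 : ∀ {x y} → x ≡ y → x ⊖ y ≡ 0F
  diff-0 {x} refl = ⊖-self x

  0-diff : ∀ {x y} → x ⊖ y ≡ 0F → x ≡ y
  0-diff {x} {y} e = trans (solve 2 (λ x y → x := (x :- y) :+ y) refl x y) (trans (cong (_⊕ y) e) (+-identityˡ y))

  vanish : ∀ c {a b} → a ≡ b → c ⊛ (a ⊖ b) ≡ 0F
  vanish c h = trans (cong (c ⊛_) (diff-0 h)) (zeroʳ c)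

  infixl 6 _⊕₀_
  _⊕₀_ : ∀ {x y} → x ≡ 0F → y ≡ 0F → x ⊕ y ≡ 0F
  p ⊕₀ r = trans (cong₂ _⊕_ p r) (+-identityˡ 0F)

  -- The difference of the two sides is written as a combination of the differences in the
  -- hypotheses. The coefficients are a certificate of ideal membership, and the solver checks the
  -- identity; nearly all algebra below has this form.
  comb₁ : ∀ {l r a b} c → l ⊖ r ≡ c ⊛ (a ⊖ b) →
    a ≡ b → l ≡ r
  comb₁ c e h = 0-diff (trans e (vanish c h))

  comb₂ : ∀ {l r a b a′ b′} c c′ → l ⊖ r ≡ c ⊛ (a ⊖ b) ⊕ c′ ⊛ (a′ ⊖ b′) →
    a ≡ b → a′ ≡ b′ → l ≡ r
  comb₂ c c′ e h h′ = 0-diff (trans e (vanish c h ⊕₀ vanish c′ h′))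

  comb₃ : ∀ {l r a b a′ b′ a″ b″} c c′ c″ → l ⊖ r ≡ c ⊛ (a ⊖ b) ⊕ c′ ⊛ (a′ ⊖ b′) ⊕ c″ ⊛ (a″ ⊖ b″) →
    a ≡ b → a′ ≡ b′ → a″ ≡ b″ → l ≡ r
  comb₃ c c′ c″ e h h′ h″ = 0-diff (trans e (vanish c h ⊕₀ vanish c′ h′ ⊕₀ vanish c″ h″))

  comb₄ : ∀ {l r a b a′ b′ a″ b″ a‴ b‴} c c′ c″ c‴ → l ⊖ r ≡ c ⊛ (a ⊖ b) ⊕ c′ ⊛ (a′ ⊖ b′) ⊕ c″ ⊛ (a″ ⊖ b″) ⊕ c‴ ⊛ (a‴ ⊖ b‴) →
    a ≡ b → a′ ≡ b′ → a″ ≡ b″ → a‴ ≡ b‴ → l ≡ r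
  comb₄ c c′ c″ c‴ e h h′ h″ h‴ = 0-diff (trans e (vanish c h ⊕₀ vanish c′ h′ ⊕₀ vanish c″ h″ ⊕₀ vanish c‴ h‴))

  comb₅ : ∀ {l r a b a′ b′ a″ b″ a‴ b‴ a⁗ b⁗} c c′ c″ c‴ c⁗ → l ⊖ r ≡ c ⊛ (a ⊖ b) ⊕ c′ ⊛ (a′ ⊖ b′) ⊕ c″ ⊛ (a″ ⊖ b″) ⊕ c‴ ⊛ (a‴ ⊖ b‴) ⊕ c⁗ ⊛ (a⁗ ⊖ b⁗) →
    a ≡ b → a′ ≡ b′ → a″ ≡ b″ → a‴ ≡ b‴ → a⁗ ≡ b⁗ → l ≡ r
  comb₅ c c′ c″ c‴ c⁗ e h h′ h″ h‴ h⁗ = 0-diff (trans e (vanish c h ⊕₀ vanish c′ h′ ⊕₀ vanish c″ h″ ⊕₀ vanish c‴ h‴ ⊕₀ vanish c⁗ h⁗))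

  1≢0 : 1F ≢ 0F
  1≢0 e = 0≢1 (sym e)

  abstract
    -- Total, with value 0 at 0, so that no proof of nonvanishing occurs inside terms passed to the
    -- solver.
    inv : Fin q → Fin q
    inv x with x ≟ 0F
    ... | yes _ = 0F
    ... | no x≢0 = proj₁ (inverse x x≢0)

    inv-* : ∀ {x} → x ≢ 0F → x ⊛ inv x ≡ 1F
    inv-* {x} x≢0 with x ≟ 0F
    ... | yes e = ⊥-elim (x≢0 e)
    ... | no n = proj₂ (inverse x n)

  cancel-* : ∀ {x y} → x ≢ 0F → x ⊛ y ≡ 0F → y ≡ 0F
  cancel-* {x} {y} x≢0 e = comb₂ (-F y) (inv x)
    (solve 3 (λ x y i → y :- :0 := (:- y) :* (x :* i :- :1) :+ i :* (x :* y :- :0)) refl x y (inv x))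
    (inv-* x≢0) e

  *-cancelˡ : ∀ {x y z} → x ≢ 0F → x ⊛ y ≡ x ⊛ z → y ≡ z
  *-cancelˡ {x} {y} {z} x≢0 e = 0-diff (cancel-* x≢0
    (trans (solve 3 (λ x y z → x :* (y :- z) := x :* y :- x :* z) refl x y z) (diff-0 e)))

  *-≢0 : ∀ {x y} → x ≢ 0F → y ≢ 0F → x ⊛ y ≢ 0F
  *-≢0 x≢0 y≢0 e = y≢0 (cancel-* x≢0 e)

  integral : ∀ {x y} → x ⊛ y ≡ 0F → x ≡ 0F ⊎ y ≡ 0F
  integral {x} e with x ≟ 0F
  ... | yes z = inj₁ z
  ... | no n = inj₂ (cancel-* n e)

  square-0 : ∀ {x} → x ⊛ x ≡ 0F → x ≡ 0F
  square-0 e with integral e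
  ... | inj₁ z = z
  ... | inj₂ z = z

  inv-≢0 : ∀ {x} → x ≢ 0F → inv x ≢ 0F
  inv-≢0 {x} x≢0 e = 1≢0 (trans (sym (inv-* x≢0)) (trans (cong (x ⊛_) e) (zeroʳ x)))

  divide : ∀ {x y z} → x ≢ 0F → x ⊛ z ≡ y → y ⊛ inv x ≡ z
  divide {x} {y} {z} x≢0 e = comb₂ (-F inv x) z
    (solve 4 (λ x y z i → y :* i :- z := (:- i) :* (x :* z :- y) :+ z :* (x :* i :- :1)) refl x y z (inv x))
    e (inv-* x≢0)

  divide-* : ∀ {x} y → x ≢ 0F → x ⊛ (y ⊛ inv x) ≡ y
  divide-* {x} y x≢0 = comb₁ y
    (solve 3 (λ x y i → x :* (y :* i) :- y := y :* (x :* i :- :1)) refl x y (inv x)) (inv-* x≢0)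

  neg-≢0 : ∀ {x} → x ≢ 0F → -F x ≢ 0F
  neg-≢0 {x} n e = n (comb₁ -1F (solve 1 (λ x → x :- :0 := :-1 :* ((:- x) :- :0)) refl x) e)

  IsSquare : Fin q → Set
  IsSquare x = ∃[ y ] y ⊛ y ≡ x

  isSquare? : ∀ x → Dec (IsSquare x)
  isSquare? x = any? (λ y → y ⊛ y ≟ x)

  same-square : ∀ {x y} → x ⊛ x ≡ y ⊛ y → x ≡ y ⊎ x ≡ -F y
  same-square {x} {y} e = [ (λ z → inj₁ (0-diff z))
      , (λ z → inj₂ (comb₁ 1F (solve 2 (λ x y → x :- (:- y) := :1 :* ((x :+ y) :- :0)) refl x y) z)) ]′
    (integral {x ⊖ y} {x ⊕ y} (comb₁ 1F (solve 2 (λ x y → (x :- y) :* (x :+ y) :- :0 := :1 :* (x :* x :- y :* y)) refl x y) e))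

  -- Summing x ↦ x + 1 over the whole field.
  ι-q : ι (+ q) ≡ 0F
  ι-q = trans (sym (trans (sum-replicate q) (×ᵤ≈× q 1F))) (+-cancelˡ (sum id′) _ _
    (trans (sym (trans (sum-permute id′ shift) (∑-distrib-+ id′ (λ _ → 1F)))) (sym (+-identityʳ _))))
    where
    open Algebra.Properties.CommutativeMonoid.Sum +-commutativeMonoid
    open Algebra.Properties.Monoid.Mult.TCOptimised +-monoid using (×ᵤ≈×)
    id′ : Fin q → Fin q
    id′ x = x
    shift = permutation (_⊕ 1F) (_⊖ 1F)
      (solve 1 (λ x → (x :- :1) :+ :1 := x) refl)
      (solve 1 (λ x → (x :+ :1) :- :1 := x) refl)

  -- As q itself vanishes in the field, reducing it modulo a vanishing m shows which characteristics
  -- are impossible; used for m = 2, 3, 5.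
  ι-remainder : ∀ m .{{_ : ℕ.NonZero m}} → ι (+ m) ≡ 0F → ι (+ (q % m)) ≡ 0F
  ι-remainder m z = begin
    ι (+ (q % m)) ≡⟨ sym (+-identityʳ _) ⟩
    ι (+ (q % m)) ⊕ 0F ≡⟨ cong (ι (+ (q % m)) ⊕_) (sym (trans (cong (ι (+ (q / m)) ⊛_) z) (zeroʳ _))) ⟩
    ι (+ (q % m)) ⊕ ι (+ (q / m)) ⊛ ι (+ m) ≡⟨ cong (ι (+ (q % m)) ⊕_) (sym (trans (cong ι (ℤ.pos-* (q / m) m)) (ι-* (+ (q / m)) (+ m)))) ⟩
    ι (+ (q % m)) ⊕ ι (+ (q / m ℕ.* m)) ≡⟨ sym (ι-+ (+ (q % m)) (+ (q / m ℕ.* m))) ⟩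
    ι (+ (q % m ℕ.+ q / m ℕ.* m)) ≡⟨ cong (λ t → ι (+ t)) (sym (m≡m%n+[m/n]*n q m)) ⟩
    ι (+ q) ≡⟨ ι-q ⟩
    0F ∎
    where open ≡-Reasoning

  ι-power : ∀ p k → q ≡ p ℕ.^ k → ι (+ p) ≡ 0F
  ι-power p k e = go k (trans (cong (λ t → ι (+ t)) (sym e)) ι-q)
    where
    go : ∀ k → ι (+ (p ℕ.^ k)) ≡ 0F → ι (+ p) ≡ 0F
    go zero z = ⊥-elim (1≢0 z)
    go (suc k) z with integral (trans (sym (trans (cong ι (ℤ.pos-* p (p ℕ.^ k))) (ι-* (+ p) (+ (p ℕ.^ k))))) z)
    ... | inj₁ z′ = z′
    ... | inj₂ z′ = go k z′

  -- Square roots of -3, 5 and -1 by counting fixed points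

  elements : List (Fin q)
  elements = allFin q

  elements-Unique : Unique elements
  elements-Unique = Unique.allFin⁺ q

  ≢-list₂ : ∀ {A : Set} {x a b : A} → x ≢ a → x ≢ b → x ∉ (a ∷ b ∷ [])
  ≢-list₂ n m (here e) = n e
  ≢-list₂ n m (there (here e)) = m e

  ≢-list₃ : ∀ {A : Set} {x a b c : A} → x ≢ a → x ≢ b → x ≢ c → x ∉ (a ∷ b ∷ c ∷ [])
  ≢-list₃ n m o (here e) = n e
  ≢-list₃ n m o (there p) = ≢-list₂ m o p

  -- The cyclic action x ↦ 1/(1 - x) on the projective line minus {0, 1, ∞}; its fixed points are
  -- the primitive sixth roots of unity.
  module OrderThree where
    f : Fin q → Fin q
    f x = inv (1F ⊖ x)

    domain : List (Fin q)
    domain = without _≟_ (0F ∷ 1F ∷ []) elements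

    domain-Unique : Unique domain
    domain-Unique = without-Unique _≟_ _ elements-Unique

    length-domain : q ≡ 2 ℕ.+ length domain
    length-domain = trans (sym (length-tabulate (λ x → x))) (length-without _≟_ elements-Unique ((0≢1 ∷ []) ∷ [] ∷ []) λ _ → ∈-allFin _)
      where import Data.List.Properties

    in⁺ : ∀ {x} → x ≢ 0F → x ≢ 1F → x ∈ domain
    in⁺ a b = ∈-without⁺ _≟_ (∈-allFin _) (≢-list₂ a b)

    in⁻ : ∀ {x} → x ∈ domain → x ≢ 0F × x ≢ 1F
    in⁻ p = let _ , n = ∈-without⁻ _≟_ _ elements p in (λ e → n (here e)) , (λ e → n (there (here e)))

    1-x : ∀ {x} → x ∈ domain → 1F ⊖ x ≢ 0F
    1-x p e = proj₂ (in⁻ p) (sym (0-diff e))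

    closed : ∀ {x} → x ∈ domain → f x ∈ domain
    closed {x} p = in⁺ (inv-≢0 (1-x p)) λ e → proj₁ (in⁻ p)
      (comb₂ -1F (1F ⊖ x) (solve 2 (λ x i → x :- :0 := :-1 :* ((:1 :- x) :* i :- :1) :+ (:1 :- x) :* (i :- :1)) refl x (f x))
        (inv-* (1-x p)) e)

    inv-unique : ∀ {x y} → x ⊛ y ≡ 1F → inv x ≡ y
    inv-unique {x} {y} e = trans (sym (*-identityˡ _)) (divide (λ z → 1≢0 (trans (sym e) (trans (cong (_⊛ y) z) (zeroˡ y)))) e)

    f³ : ∀ {x} → x ∈ domain → f (f (f x)) ≡ x
    f³ {x} p = inv-unique {1F ⊖ f (f x)} {x}
      (comb₂ (f (f x)) (1F ⊖ x)
        (solve 3 (λ x y z → (:1 :- z) :* x :- :1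
           := z :* ((:1 :- x) :* y :- :1) :+ (:1 :- x) :* ((:1 :- y) :* z :- :1)) refl x (f x) (f (f x)))
        (inv-* (1-x p)) (inv-* (1-x (closed p))))

    no-smaller-period : ∀ {x d} → x ∈ domain → f x ≢ x → d ℕ.< 2 → iter _≟_ f 2 (suc d) x ≢ x
    no-smaller-period p n d<2 = n ∘ period-3 _≟_ f (f³ p) d<2

    count : length domain % 3 ≡ length (fixed _≟_ f 2 domain) % 3
    count = length-mod-fixed _≟_ f 2 domain domain-Unique closed f³ no-smaller-period

    SixthRoot : Fin q → Set
    SixthRoot r = r ⊛ r ≡ r ⊖ 1F

    fixed⇒root : ∀ {x} → x ∈ domain → f x ≡ x → SixthRoot x
    fixed⇒root {x} p e = comb₂ -1F (1F ⊖ x)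
      (solve 2 (λ x i → x :* x :- (x :- :1) := :-1 :* ((:1 :- x) :* i :- :1) :+ (:1 :- x) :* (i :- x)) refl x (f x))
      (inv-* (1-x p)) e

    root⇒fixed : ∀ {x} → SixthRoot x → x ∈ domain × f x ≡ x
    root⇒fixed {x} r = in⁺
        (λ e → 1≢0 (comb₂ 1F (1F ⊖ x) (solve 1 (λ x → :1 :- :0 := :1 :* (x :* x :- (x :- :1)) :+ (:1 :- x) :* (x :- :0)) refl x) r e))
        (λ e → 1≢0 (comb₂ 1F (-F x) (solve 1 (λ x → :1 :- :0 := :1 :* (x :* x :- (x :- :1)) :+ (:- x) :* (x :- :1)) refl x) r e))
      , inv-unique (comb₁ -1F (solve 1 (λ x → (:1 :- x) :* x :- :1 := :-1 :* (x :* x :- (x :- :1))) refl x) r)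

    no-root⇒fixed-0 : (∀ r → ¬ SixthRoot r) → length (fixed _≟_ f 2 domain) ≡ 0
    no-root⇒fixed-0 none with fixed _≟_ f 2 domain in eq
    ... | [] = refl
    ... | x ∷ _ = let p , e = ∈-filter⁻ (λ x → f x ≟ x) {xs = domain} (subst (x ∈_) (sym eq) (here refl)) in
                  ⊥-elim (none x (fixed⇒root p e))

    -- The roots are r and 1 - r, distinct because the discriminant -3 is nonzero.
    root⇒fixed-2 : ι (+ 3) ≢ 0F → ∀ r → SixthRoot r → length (fixed _≟_ f 2 domain) ≡ 2
    root⇒fixed-2 3≢0 r h = Unique-≈-length (Unique.filter⁺ (λ x → f x ≟ x) domain-Unique) ((r≢r′ ∷ []) ∷ [] ∷ []) to from
      where
      r≢r′ : r ≢ 1F ⊖ r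
      r≢r′ e = 3≢0 (comb₂ (ι (+ 4)) (1F ⊖ ι (+ 2) ⊛ r) (solve 1 (λ r → :3 :- :0 := :4 :* (r :* r :- (r :- :1)) :+ (:1 :- :2 :* r) :* (r :- (:1 :- r))) refl r) h e)
      to : ∀ {x} → x ∈ fixed _≟_ f 2 domain → x ∈ (r ∷ (1F ⊖ r) ∷ [])
      to {x} p = let p′ , e = ∈-filter⁻ (λ x → f x ≟ x) {xs = domain} p in
        [ (λ z → here (0-diff z)) , (λ z → there (here (0-diff z))) ]′ (integral {x ⊖ r} {x ⊖ (1F ⊖ r)} (comb₂ 1F -1F
          (solve 2 (λ x r → (x :- r) :* (x :- (:1 :- r)) :- :0 := :1 :* (x :* x :- (x :- :1)) :+ :-1 :* (r :* r :- (r :- :1))) refl x r)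
          (fixed⇒root p′ e) h))
      into : ∀ {x} → SixthRoot x → x ∈ fixed _≟_ f 2 domain
      into s = let p , e = root⇒fixed s in ∈-filter⁺ (λ x → f x ≟ x) p e
      from : ∀ {x} → x ∈ (r ∷ (1F ⊖ r) ∷ []) → x ∈ fixed _≟_ f 2 domain
      from (here refl) = into h
      from (there (here refl)) = into (comb₁ 1F (solve 1 (λ r → (:1 :- r) :* (:1 :- r) :- ((:1 :- r) :- :1) := :1 :* (r :* r :- (r :- :1))) refl r) h)

    -- The domain has q - 2 points, which is 2 modulo 3 here, so the action cannot be free.
    q%3≡1⇒root : q % 3 ≡ 1 → ∃ SixthRoot
    q%3≡1⇒root e with any? (λ r → r ⊛ r ≟ r ⊖ 1F)
    ... | yes r = r
    ... | no n = ⊥-elim (absurd (length domain) (trans (sym (cong (_% 3) length-domain)) e)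
            (trans count (cong (_% 3) (no-root⇒fixed-0 (λ r h → n (r , h))))))
      where
      absurd : ∀ k → (2 ℕ.+ k) % 3 ≡ 1 → k % 3 ≢ 0
      absurd k a b with trans (sym a) (trans (%-distribˡ-+ 2 k 3) (cong (λ t → (2 ℕ.+ t) % 3) b))
      ... | ()

    -- A root would give exactly two fixed points, and q - 2 = 2 modulo 3 contradicts q = 2.
    q%3≡2⇒no-root : ι (+ 3) ≢ 0F → q % 3 ≡ 2 → ∀ r → ¬ SixthRoot r
    q%3≡2⇒no-root 3≢0 e r h = absurd (length domain) (trans (sym (cong (_% 3) length-domain)) e)
        (trans count (cong (_% 3) (root⇒fixed-2 3≢0 r h)))
      where
      absurd : ∀ k → (2 ℕ.+ k) % 3 ≡ 2 → k % 3 ≢ 2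
      absurd k a b with trans (sym a) (trans (%-distribˡ-+ 2 k 3) (cong (λ t → (2 ℕ.+ t) % 3) b))
      ... | ()

  module PentagonRecurrence where
    -- The order five action (x, y) ↦ (y, (1 + y)/x) on the part of the plane where the whole cycle
    -- is defined and nonzero; its fixed points are the roots of x² = x + 1.
    f : Fin q × Fin q → Fin q × Fin q
    f (x , y) = y , (1F ⊕ y) ⊛ inv x

    _≟²_ : (p r : Fin q × Fin q) → Dec (p ≡ r)
    _≟²_ = Product.≡-dec _≟_ _≟_

    -- With x = -a and y = b - 1 the conditions say that 0, 1, a, b are distinct: these are the
    -- points of the moduli space of five points on the projective line.
    Good : Fin q → Fin q → Set
    Good x y = (x ≢ 0F × 1F ⊕ x ≢ 0F) × (y ≢ 0F × 1F ⊕ y ≢ 0F × 1F ⊕ x ⊕ y ≢ 0F)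

    abscissas : List (Fin q)
    abscissas = without _≟_ (0F ∷ -1F ∷ []) elements

    ordinates : Fin q → List (Fin q)
    ordinates x = without _≟_ (0F ∷ -1F ∷ (-1F ⊖ x) ∷ []) elements

    domain : List (Fin q × Fin q)
    domain = dependentPairs abscissas ordinates

    0≢-1 : 0F ≢ -1F
    0≢-1 e = 1≢0 (comb₁ 1F (solve 0 (:1 :- :0 := :1 :* (:0 :- :-1)) refl) e)

    1+-1 : ∀ {x} → x ≡ -1F → 1F ⊕ x ≡ 0F
    1+-1 {x} e = comb₁ 1F (solve 1 (λ x → :1 :+ x :- :0 := :1 :* (x :- :-1)) refl x) e

    -1-1+ : ∀ {x} → 1F ⊕ x ≡ 0F → x ≡ -1F
    -1-1+ {x} e = comb₁ 1F (solve 1 (λ x → x :- :-1 := :1 :* (:1 :+ x :- :0)) refl x) e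

    abscissa⁻ : ∀ {x} → x ∈ abscissas → x ≢ 0F × 1F ⊕ x ≢ 0F
    abscissa⁻ p = let _ , n = ∈-without⁻ _≟_ _ elements p in
      (λ e → n (here e)) , (λ e → n (there (here (-1-1+ e))))

    in⁺ : ∀ {x y} → Good x y → (x , y) ∈ domain
    in⁺ {x} {y} ((a , b) , (c , d , e)) = ∈-dependentPairs⁺
      (∈-without⁺ _≟_ (∈-allFin x) (≢-list₂ a (b ∘ 1+-1)))
      (∈-without⁺ _≟_ (∈-allFin y) (≢-list₃ c (d ∘ 1+-1)
        (e ∘ comb₁ 1F (solve 2 (λ x y → :1 :+ x :+ y :- :0 := :1 :* (y :- (:-1 :- x))) refl x y))))

    in⁻ : ∀ {x y} → (x , y) ∈ domain → Good x y
    in⁻ {x} {y} p with ∈-dependentPairs⁻ abscissas p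
    ... | p₁ , p₂ with ∈-without⁻ _≟_ _ elements p₂
    ...   | _ , n = abscissa⁻ p₁ , (λ e → n (here e)) , (λ e → n (there (here (-1-1+ e)))) ,
            (λ e → n (there (there (here (comb₁ 1F (solve 2 (λ x y → y :- (:-1 :- x) := :1 :* (:1 :+ x :+ y :- :0)) refl x y) e)))))

    domain-Unique : Unique domain
    domain-Unique = dependentPairs-Unique (without-Unique _≟_ _ elements-Unique) (λ _ → without-Unique _≟_ _ elements-Unique)

    length-elements : length elements ≡ q
    length-elements = length-tabulate (λ x → x)
      where import Data.List.Properties

    length-abscissas : q ≡ 2 ℕ.+ length abscissas
    length-abscissas = trans (sym length-elements) (length-without _≟_ elements-Unique ((0≢-1 ∷ []) ∷ [] ∷ []) λ _ → ∈-allFin _)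

    -- The excluded values 0, -1, -1 - x are distinct precisely because x is neither 0 nor -1, so
    -- all fibres have q - 3 points.
    length-ordinates : ∀ {x} → x ∈ abscissas → q ≡ 3 ℕ.+ length (ordinates x)
    length-ordinates {x} p = trans (sym length-elements) (length-without _≟_ elements-Unique
      ((0≢-1 ∷ (λ e → proj₂ (abscissa⁻ p) (comb₁ 1F (solve 1 (λ x → :1 :+ x :- :0 := :1 :* (:0 :- (:-1 :- x))) refl x) e)) ∷ [])
       ∷ ((λ e → proj₁ (abscissa⁻ p) (comb₁ 1F (solve 1 (λ x → x :- :0 := :1 :* (:-1 :- (:-1 :- x))) refl x) e)) ∷ []) ∷ [] ∷ []) λ _ → ∈-allFin _)

    length-domain : ∀ k → q ≡ 3 ℕ.+ k → length domain ≡ suc k ℕ.* k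
    length-domain k e = trans (length-dependentPairs k abscissas λ p → ℕ.+-cancelˡ-≡ 3 _ _ (trans (sym (length-ordinates p)) e))
      (cong (ℕ._* k) (ℕ.+-cancelˡ-≡ 2 _ _ (trans (sym length-abscissas) e)))

    step : ∀ {x y z} → x ≢ 0F → x ⊛ z ≡ 1F ⊕ y → f (x , y) ≡ (y , z)
    step a e = cong (_ ,_) (divide a e)

    -- The recurrence cannot leave the domain: 1 + z = 0 would give 1 + x + y = 0, and 1 + y + z = 0
    -- would give (1 + x)(1 + y) = 0.
    next : ∀ {x y} → Good x y → ∃[ z ] (x ⊛ z ≡ 1F ⊕ y × Good y z)
    next {x} {y} ((a , b) , (c , d , e)) = z , xz , (c , d) , *-≢0 d (inv-≢0 a) , s₁ , s₂
      where
      z : Fin q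
      z = (1F ⊕ y) ⊛ inv x
      xz : x ⊛ z ≡ 1F ⊕ y
      xz = divide-* (1F ⊕ y) a
      s₁ : 1F ⊕ z ≢ 0F
      s₁ h = e (comb₂ x -1F (solve 3 (λ x y z → :1 :+ x :+ y :- :0 := x :* (:1 :+ z :- :0) :+ :-1 :* (x :* z :- (:1 :+ y))) refl x y z) h xz)
      s₂ : 1F ⊕ y ⊕ z ≢ 0F
      s₂ h = *-≢0 d b (comb₂ x -1F (solve 3 (λ x y z → (:1 :+ y) :* (:1 :+ x) :- :0 := x :* (:1 :+ y :+ z :- :0) :+ :-1 :* (x :* z :- (:1 :+ y))) refl x y z) h xz)

    closed : ∀ {p} → p ∈ domain → f p ∈ domain
    closed {x , y} p = let z , xz , g = next (in⁻ p) in
      subst (_∈ domain) (sym (step (proj₁ (proj₁ (in⁻ p))) xz)) (in⁺ g)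

    -- Closes the cycle: after x, y, z, w, v the recurrence continues with x and then y.
    pentagon : ∀ {x y z w v} → y ≢ 0F → z ≢ 0F → x ⊛ z ≡ 1F ⊕ y → y ⊛ w ≡ 1F ⊕ z → z ⊛ v ≡ 1F ⊕ w →
      v ⊛ y ≡ 1F ⊕ x × w ⊛ x ≡ 1F ⊕ v
    pentagon {x} {y} {z} {w} {v} b c xz yw zv = vy ,
      *-cancelˡ b (comb₃ x 1F -1F (solve 5 (λ x y z w v → y :* (w :* x) :- y :* (:1 :+ v) := x :* (y :* w :- (:1 :+ z)) :+ :1 :* (x :* z :- (:1 :+ y)) :+ :-1 :* (v :* y :- (:1 :+ x))) refl x y z w v) yw xz vy)
      where
      vy : v ⊛ y ≡ 1F ⊕ x
      vy = *-cancelˡ c (comb₃ y 1F -1F (solve 5 (λ x y z w v → z :* (v :* y) :- z :* (:1 :+ x) := y :* (z :* v :- (:1 :+ w)) :+ :1 :* (y :* w :- (:1 :+ z)) :+ :-1 :* (x :* z :- (:1 :+ y))) refl x y z w v) zv yw xz)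

    cycle : ∀ {x y z w v} → x ≢ 0F → y ≢ 0F → z ≢ 0F → w ≢ 0F → v ≢ 0F →
      x ⊛ z ≡ 1F ⊕ y → y ⊛ w ≡ 1F ⊕ z → z ⊛ v ≡ 1F ⊕ w → f (f (f (f (f (x , y))))) ≡ (x , y)
    cycle a b c d e xz yw zv = begin
      f (f (f (f (f _)))) ≡⟨ cong (λ p → f (f (f (f p)))) (step a xz) ⟩
      f (f (f (f _))) ≡⟨ cong (λ p → f (f (f p))) (step b yw) ⟩
      f (f (f _)) ≡⟨ cong (λ p → f (f p)) (step c zv) ⟩
      f (f _) ≡⟨ cong f (step d (proj₂ (pentagon b c xz yw zv))) ⟩
      f _ ≡⟨ step e (proj₁ (pentagon b c xz yw zv)) ⟩
      _ ∎
      where open ≡-Reasoning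

    f⁵ : ∀ {p} → p ∈ domain → f (f (f (f (f p)))) ≡ p
    f⁵ p = let g₀ = in⁻ p ; z , xz , g₁ = next g₀ ; w , yw , g₂ = next g₁ ; v , zv , g₃ = next g₂ in
      cycle (proj₁ (proj₁ g₀)) (proj₁ (proj₁ g₁)) (proj₁ (proj₁ g₂)) (proj₁ (proj₁ g₃)) (proj₁ (proj₂ g₃)) xz yw zv

    no-smaller-period : ∀ {p d} → p ∈ domain → f p ≢ p → d ℕ.< 4 → iter _≟²_ f 4 (suc d) p ≢ p
    no-smaller-period p n d<4 = n ∘ period-5 _≟²_ f (f⁵ p) d<4

    fixedPoints : List (Fin q × Fin q)
    fixedPoints = fixed _≟²_ f 4 domain

    count : length domain % 5 ≡ length fixedPoints % 5
    count = length-mod-fixed _≟²_ f 4 domain domain-Unique closed f⁵ no-smaller-period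

    GoldenRatio : Fin q → Set
    GoldenRatio t = t ⊛ t ≡ 1F ⊕ t

    fixed⇒golden : ∀ {x y} → (x , y) ∈ domain → f (x , y) ≡ (x , y) → x ≡ y × GoldenRatio y
    fixed⇒golden {x} {y} p e = sym (cong proj₁ e) ,
      trans (cong (_⊛ y) (cong proj₁ e)) (trans (cong (x ⊛_) (sym (cong proj₂ e))) (divide-* _ (proj₁ (proj₁ (in⁻ p)))))

    golden⇒fixed : ∀ {t} → GoldenRatio t → (t , t) ∈ fixedPoints
    golden⇒fixed {t} g = ∈-filter⁺ (λ p → f p ≟² p)
        (in⁺ ((t≢0 , 1+t≢0) , (t≢0 , 1+t≢0 , 1+2t≢0))) (cong (t ,_) (divide t≢0 g))
      where
      t≢0 : t ≢ 0F
      t≢0 e = 1≢0 (comb₂ -1F (t ⊖ 1F) (solve 1 (λ t → :1 :- :0 := :-1 :* (t :* t :- (:1 :+ t)) :+ (t :- :1) :* (t :- :0)) refl t) g e)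
      1+t≢0 : 1F ⊕ t ≢ 0F
      1+t≢0 e = *-≢0 t≢0 t≢0 (trans g e)
      1+2t≢0 : 1F ⊕ t ⊕ t ≢ 0F
      1+2t≢0 e = 1≢0 (comb₂ (ι -[1+ 3 ]) (ι (+ 2) ⊛ t ⊖ ι (+ 3)) (solve 1 (λ t → :1 :- :0 := :-4 :* (t :* t :- (:1 :+ t)) :+ (:2 :* t :- :3) :* (:1 :+ t :+ t :- :0)) refl t) g e)

    no-golden⇒fixed-0 : (∀ t → ¬ GoldenRatio t) → length fixedPoints ≡ 0
    no-golden⇒fixed-0 none with fixedPoints in eq
    ... | [] = refl
    ... | (x , y) ∷ _ = let p , e = ∈-filter⁻ (λ p → f p ≟² p) {xs = domain} (subst ((x , y) ∈_) (sym eq) (here refl)) in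
                        ⊥-elim (none y (proj₂ (fixed⇒golden p e)))

    golden⇒fixed-2 : ι (+ 5) ≢ 0F → ∀ t → GoldenRatio t → length fixedPoints ≡ 2
    golden⇒fixed-2 5≢0 t g = Unique-≈-length (Unique.filter⁺ (λ p → f p ≟² p) domain-Unique)
        (((t≢t′ ∘ cong proj₁) ∷ []) ∷ [] ∷ []) to from
      where
      t′ : Fin q
      t′ = 1F ⊖ t
      t≢t′ : t ≢ t′
      t≢t′ e = 5≢0 (comb₂ (ι -[1+ 3 ]) (ι (+ 2) ⊛ t ⊖ ι (+ 1)) (solve 1 (λ t → :5 :- :0 := :-4 :* (t :* t :- (:1 :+ t)) :+ (:2 :* t :- :1) :* (t :- (:1 :- t))) refl t) g e)
      to : ∀ {p} → p ∈ fixedPoints → p ∈ ((t , t) ∷ (t′ , t′) ∷ [])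
      to {x , y} p = let p′ , e = ∈-filter⁻ (λ p → f p ≟² p) {xs = domain} p in golden-pair (fixed⇒golden p′ e)
        where
        golden-pair : ∀ {x y} → x ≡ y × GoldenRatio y → (x , y) ∈ ((t , t) ∷ (t′ , t′) ∷ [])
        golden-pair {x} (refl , h) =
          [ (λ z → here (cong₂ _,_ (0-diff z) (0-diff z))) , (λ z → there (here (cong₂ _,_ (0-diff z) (0-diff z)))) ]′ (integral {x ⊖ t} {x ⊖ t′} (comb₂ 1F -1F
            (solve 2 (λ x t → (x :- t) :* (x :- (:1 :- t)) :- :0 := :1 :* (x :* x :- (:1 :+ x)) :+ :-1 :* (t :* t :- (:1 :+ t))) refl x t) h g))
      from : ∀ {p} → p ∈ ((t , t) ∷ (t′ , t′) ∷ []) → p ∈ fixedPoints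
      from (here refl) = golden⇒fixed g
      from (there (here refl)) = golden⇒fixed (comb₁ 1F (solve 1 (λ t → (:1 :- t) :* (:1 :- t) :- (:1 :+ (:1 :- t)) := :1 :* (t :* t :- (:1 :+ t))) refl t) g)

    domain-mod : ∀ k → q ≡ 3 ℕ.+ k → length domain % 5 ≡ ((1 ℕ.+ k % 5) % 5 ℕ.* (k % 5)) % 5
    domain-mod k e = trans (cong (_% 5) (length-domain k e)) (trans (%-distribˡ-* (suc k) k 5)
      (cong (λ t → (t ℕ.* (k % 5)) % 5) (%-distribˡ-+ 1 k 5)))

    q-mod : ∀ k → q ≡ 3 ℕ.+ k → q % 5 ≡ (3 ℕ.+ k % 5) % 5
    q-mod k e = trans (cong (_% 5) e) (%-distribˡ-+ 3 k 5)

    isGolden? : Dec (∃ GoldenRatio)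
    isGolden? = any? (λ t → t ⊛ t ≟ 1F ⊕ t)

    -- The domain has (q - 2)(q - 3) points, that is 2 modulo 5 for q = ±1 and 0 for q = ±2. The
    -- fixed points number 0 or, where 5 is nonzero, 2, so the residue of q decides.
    q%5≡±1⇒golden : ∀ k → q ≡ 3 ℕ.+ k → q % 5 ≡ 1 ⊎ q % 5 ≡ 4 → ∃ GoldenRatio
    q%5≡±1⇒golden k e r with isGolden?
    ... | yes g = g
    ... | no n = ⊥-elim (absurd (k % 5) (m%n<n k 5) (case r)
            (trans (sym (domain-mod k e)) (trans count (cong (_% 5) (no-golden⇒fixed-0 (λ t g → n (t , g)))))))
      where
      case : q % 5 ≡ 1 ⊎ q % 5 ≡ 4 → (3 ℕ.+ k % 5) % 5 ≡ 1 ⊎ (3 ℕ.+ k % 5) % 5 ≡ 4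
      case (inj₁ r) = inj₁ (trans (sym (q-mod k e)) r)
      case (inj₂ r) = inj₂ (trans (sym (q-mod k e)) r)
      absurd : ∀ j → j ℕ.< 5 → (3 ℕ.+ j) % 5 ≡ 1 ⊎ (3 ℕ.+ j) % 5 ≡ 4 → ((1 ℕ.+ j) % 5 ℕ.* j) % 5 ≢ 0
      absurd 0 _ (inj₁ ())
      absurd 0 _ (inj₂ ())
      absurd 1 _ _ ()
      absurd 2 _ (inj₁ ())
      absurd 2 _ (inj₂ ())
      absurd 3 _ _ ()
      absurd 4 _ (inj₁ ())
      absurd 4 _ (inj₂ ())
      absurd (suc (suc (suc (suc (suc j))))) (s≤s (s≤s (s≤s (s≤s (s≤s ())))))

    q%5≡±2⇒no-golden : ∀ k → q ≡ 3 ℕ.+ k → ι (+ 5) ≢ 0F → q % 5 ≡ 2 ⊎ q % 5 ≡ 3 → ∀ t → ¬ GoldenRatio t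
    q%5≡±2⇒no-golden k e 5≢0 r t g = absurd (k % 5) (m%n<n k 5) (case r)
            (trans (sym (domain-mod k e)) (trans count (cong (_% 5) (golden⇒fixed-2 5≢0 t g))))
      where
      case : q % 5 ≡ 2 ⊎ q % 5 ≡ 3 → (3 ℕ.+ k % 5) % 5 ≡ 2 ⊎ (3 ℕ.+ k % 5) % 5 ≡ 3
      case (inj₁ r) = inj₁ (trans (sym (q-mod k e)) r)
      case (inj₂ r) = inj₂ (trans (sym (q-mod k e)) r)
      absurd : ∀ j → j ℕ.< 5 → (3 ℕ.+ j) % 5 ≡ 2 ⊎ (3 ℕ.+ j) % 5 ≡ 3 → ((1 ℕ.+ j) % 5 ℕ.* j) % 5 ≢ 2
      absurd 0 _ _ ()
      absurd 1 _ (inj₁ ())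
      absurd 1 _ (inj₂ ())
      absurd 2 _ _ ()
      absurd 3 _ (inj₁ ())
      absurd 3 _ (inj₂ ())
      absurd 4 _ _ ()
      absurd (suc (suc (suc (suc (suc j))))) (s≤s (s≤s (s≤s (s≤s (s≤s ())))))

  module SquareRootOfMinusOne where
    module _ (2≢0 : ι (+ 2) ≢ 0F) (nonsquare : ¬ IsSquare -1F) where

      -- Of order four on the projective line minus {0, 1, -1, ∞}, with ±√-1 as fixed points.
      abstract
        f : Fin q → Fin q
        f x = (1F ⊕ x) ⊛ inv (1F ⊖ x)

        f-spec : ∀ {x} → 1F ⊖ x ≢ 0F → (1F ⊖ x) ⊛ f x ≡ 1F ⊕ x
        f-spec {x} = divide-* (1F ⊕ x)

      domain : List (Fin q)
      domain = without _≟_ (0F ∷ 1F ∷ -1F ∷ []) elements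

      1≢-1 : 1F ≢ -1F
      1≢-1 e = 2≢0 (comb₁ 1F (solve 0 (:2 :- :0 := :1 :* (:1 :- :-1)) refl) e)

      0≢-1 : 0F ≢ -1F
      0≢-1 e = 1≢0 (comb₁ 1F (solve 0 (:1 :- :0 := :1 :* (:0 :- :-1)) refl) e)

      length-domain : q ≡ 3 ℕ.+ length domain
      length-domain = trans (sym (length-tabulate (λ x → x)))
          (length-without _≟_ elements-Unique ((0≢1 ∷ 0≢-1 ∷ []) ∷ (1≢-1 ∷ []) ∷ [] ∷ []) λ _ → ∈-allFin _)
        where import Data.List.Properties

      in⁻ : ∀ {x} → x ∈ domain → x ≢ 0F × x ≢ 1F × x ≢ -1F
      in⁻ p = let _ , n = ∈-without⁻ _≟_ _ elements p in
        (λ e → n (here e)) , (λ e → n (there (here e))) , (λ e → n (there (there (here e))))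

      1-x : ∀ {x} → x ∈ domain → 1F ⊖ x ≢ 0F
      1-x p e = proj₁ (proj₂ (in⁻ p)) (sym (0-diff e))

      f-* : ∀ {x} → x ∈ domain → (1F ⊖ x) ⊛ f x ≡ 1F ⊕ x
      f-* p = f-spec (1-x p)

      closed : ∀ {x} → x ∈ domain → f x ∈ domain
      closed {x} p = ∈-without⁺ _≟_ (∈-allFin _) (≢-list₃
        (λ e → proj₂ (proj₂ (in⁻ p)) (comb₂ -1F (1F ⊖ x)
          (solve 2 (λ x y → x :- :-1 := :-1 :* ((:1 :- x) :* y :- (:1 :+ x)) :+ (:1 :- x) :* (y :- :0)) refl x (f x)) (f-* p) e))
        (λ e → proj₁ (in⁻ p) (cancel-* 2≢0 (comb₂ -1F (1F ⊖ x)
          (solve 2 (λ x y → :2 :* x :- :0 := :-1 :* ((:1 :- x) :* y :- (:1 :+ x)) :+ (:1 :- x) :* (y :- :1)) refl x (f x)) (f-* p) e)))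
        (λ e → 2≢0 (comb₂ -1F (1F ⊖ x)
          (solve 2 (λ x y → :2 :- :0 := :-1 :* ((:1 :- x) :* y :- (:1 :+ x)) :+ (:1 :- x) :* (y :- :-1)) refl x (f x)) (f-* p) e)))

      -- Two steps compose to x ↦ -1/x; a fixed point or a point of period two would therefore be a
      -- square root of -1.
      double-step : ∀ {x y z} → (1F ⊖ x) ⊛ y ≡ 1F ⊕ x → (1F ⊖ y) ⊛ z ≡ 1F ⊕ y → x ⊛ z ≡ -1F
      double-step {x} {y} {z} h h′ = *-cancelˡ 2≢0 (comb₂ (-1F ⊛ (z ⊕ 1F)) (x ⊖ 1F)
        (solve 3 (λ x y z → :2 :* (x :* z) :- :2 :* :-1 :=
          (:-1 :* (z :+ :1)) :* ((:1 :- x) :* y :- (:1 :+ x)) :+ (x :- :1) :* ((:1 :- y) :* z :- (:1 :+ y))) refl x y z)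
        h h′)

      f² : ∀ {x} → x ∈ domain → x ⊛ f (f x) ≡ -1F
      f² p = double-step (f-* p) (f-* (closed p))

      f⁴ : ∀ {x} → x ∈ domain → f (f (f (f x))) ≡ x
      f⁴ {x} p = sym (*-cancelˡ {f (f x)} (proj₁ (in⁻ (closed (closed p))))
        (trans (*-comm _ x) (trans (f² p) (sym (f² (closed (closed p)))))))

      no-fixed : ∀ {x} → x ∈ domain → f x ≢ x
      no-fixed {x} p e = nonsquare (x , double-step (trans (cong ((1F ⊖ x) ⊛_) (sym e)) (f-* p)) (trans (cong ((1F ⊖ x) ⊛_) (sym e)) (f-* p)))

      free : ∀ {x d} → x ∈ domain → d ℕ.< 3 → iter _≟_ f 3 (suc d) x ≢ x
      free {d = 0} p _ e = no-fixed p e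
      free {x} {d = 1} p _ e = nonsquare (x , trans (cong (x ⊛_) (sym e)) (f² p))
      free {d = 2} p _ e = no-fixed p (trans (sym (cong f e)) (f⁴ p))
      free {d = suc (suc (suc d))} _ (s≤s (s≤s (s≤s ())))

      q≡3-mod-4 : ∃[ k ] q ≡ 3 ℕ.+ k ℕ.* 4
      q≡3-mod-4 = quotient divisible , trans length-domain (cong (3 ℕ.+_) (ℕ._∣_.equality divisible))
        where
        open ℕ._∣_ using (quotient)
        divisible : 4 ℕ.∣ length domain
        divisible = free-period-∣-length _≟_ f 3 domain (without-Unique _≟_ _ elements-Unique) closed f⁴ free

    -- If neither -1 nor some 1 + x² is a square, their product -(1 + x²) is one. If all 1 + x² are
    -- squares, the squares are closed under adding 1, and going from 0 up to q - 1 makes -1 a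
    -- square.
    minus-one-as-two-squares : (∀ {x y} → ¬ IsSquare x → ¬ IsSquare y → IsSquare (x ⊛ y)) →
      ∃[ x ] ∃[ y ] x ⊛ x ⊕ y ⊛ y ≡ -1F
    minus-one-as-two-squares nonsquares with isSquare? -1F
    ... | yes (i , e) = i , 0F , trans (cong (i ⊛ i ⊕_) (zeroˡ 0F)) (trans (+-identityʳ _) e)
    ... | no n with any? (λ x → ¬? (isSquare? (1F ⊕ x ⊛ x)))
    ...   | yes (x , m) = let s , e = nonsquares n m in x , s ,
              comb₁ 1F (solve 2 (λ x s → x :* x :+ s :* s :- :-1 := :1 :* (s :* s :- :-1 :* (:1 :+ x :* x))) refl x s) e
    ...   | no none = ⊥-elim (n (go q refl ι-q))
      where
      successor : ∀ x → IsSquare (1F ⊕ x ⊛ x)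
      successor x = decidable-stable (isSquare? _) λ m → none (x , m)
      numeral : ∀ m → IsSquare (ι (+ m))
      numeral zero = 0F , zeroˡ 0F
      numeral (suc m) with numeral m
      ... | s , e = subst IsSquare (trans (cong (1F ⊕_) e) (sym (ι-suc m))) (successor s)
      go : ∀ m → m ≡ q → ι (+ m) ≡ 0F → IsSquare -1F
      go zero e _ = ⊥-elim (¬Fin0 (subst Fin (sym e) 0F))
      go (suc m) _ e = subst IsSquare (comb₁ 1F
        (solve 1 (λ x → x :- :-1 := :1 :* (:1 :+ x :- :0)) refl (ι (+ m))) (trans (sym (ι-suc m)) e)) (numeral m)

  -- Linear dependence and the determinant form on 2 × 2 matrices

  open Algebra.Properties.CommutativeMonoid.Sum +-commutativeMonoid using (sum; sum-remove; sum-cong-≗; ∑-distrib-+) public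
  open Algebra.Properties.Semiring.Sum semiring using (*-distribˡ-sum; *-distribʳ-sum)

  Nontrivial : ∀ {n} → (Fin n → Fin q) → Set
  Nontrivial c = ∃[ i ] c i ≢ 0F

  -- Elimination, by induction on the dimension: a pivot in the zeroth coordinate clears that
  -- coordinate from the other vectors, and its own coefficient is chosen afterwards to balance the
  -- sum.
  dependence : ∀ m (v : Fin (suc m) → Fin m → Fin q) →
    ∃[ c ] (Nontrivial c × (∀ j → sum (λ i → c i ⊛ v i j) ≡ 0F))
  dependence zero v = (λ _ → 1F) , (zero , 1≢0) , λ ()
  dependence (suc m) v with any? (λ i → ¬? (v i zero ≟ 0F))
    where open import Relation.Nullary using (¬?)
  ... | no none = c , (suc (proj₁ (proj₁ (proj₂ rest))) , proj₂ (proj₁ (proj₂ rest))) , relation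
    where
    rest : ∃[ c ] (Nontrivial c × (∀ j → sum (λ i → c i ⊛ v (suc i) (suc j)) ≡ 0F))
    rest = dependence m (λ i j → v (suc i) (suc j))
    c : Fin (suc (suc m)) → Fin q
    c zero = 0F
    c (suc i) = proj₁ rest i
    column-0 : ∀ i → v i zero ≡ 0F
    column-0 i with v i zero ≟ 0F
    ... | yes e = e
    ... | no n = ⊥-elim (none (i , n))
    relation : ∀ j → sum (λ i → c i ⊛ v i j) ≡ 0F
    relation zero = trans (sum-cong-≗ (λ i → trans (cong (c i ⊛_) (column-0 i)) (zeroʳ (c i)))) (sum-zero (suc (suc m)))
      where
      sum-zero : ∀ n → sum {n} (λ _ → 0F) ≡ 0F
      sum-zero zero = refl
      sum-zero (suc n) = trans (+-identityˡ _) (sum-zero n)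
    relation (suc j) = zeroˡ _ ⊕₀ proj₂ (proj₂ rest) j
  ... | yes (i₀ , d≢0) = c , (punchIn i₀ (proj₁ (proj₁ (proj₂ rest))) ,
        λ e → *-≢0 d≢0 (proj₂ (proj₁ (proj₂ rest))) (trans (sym (c-other _)) e)) , relation
    where
    d : Fin q
    d = v i₀ zero
    u : Fin (suc m) → Fin (suc m) → Fin q
    u i = v (punchIn i₀ i)
    -- The row operation is cross-multiplied to avoid division, which is why the coefficients found
    -- for `w` are multiplied by the pivot `d` in `c`.
    w : Fin (suc m) → Fin m → Fin q
    w i j = d ⊛ u i (suc j) ⊖ u i zero ⊛ v i₀ (suc j)
    rest : ∃[ c ] (Nontrivial c × (∀ j → sum (λ i → c i ⊛ w i j) ≡ 0F))
    rest = dependence m w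
    b : Fin (suc m) → Fin q
    b = proj₁ rest
    s : Fin q
    s = sum (λ i → b i ⊛ u i zero)
    c : Fin (suc (suc m)) → Fin q
    c = insertAt (λ i → d ⊛ b i) i₀ (-F s)
    c-other : ∀ i → c (punchIn i₀ i) ≡ d ⊛ b i
    c-other = insertAt-punchIn (λ i → d ⊛ b i) i₀ (-F s)
    split : ∀ j → sum (λ i → c i ⊛ v i j) ≡ (-F s) ⊛ v i₀ j ⊕ sum (λ i → (d ⊛ b i) ⊛ u i j)
    split j = trans (sum-remove {i = i₀} (λ i → c i ⊛ v i j))
      (cong₂ _⊕_ (cong (_⊛ v i₀ j) (insertAt-lookup (λ i → d ⊛ b i) i₀ (-F s)))
        (sum-cong-≗ (λ i → cong (_⊛ u i j) (c-other i))))
    relation : ∀ j → sum (λ i → c i ⊛ v i j) ≡ 0F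
    relation zero = trans (split zero) (trans (cong ((-F s) ⊛ d ⊕_)
        (trans (sum-cong-≗ (λ i → *-assoc d (b i) (u i zero))) (sym (*-distribˡ-sum d (λ i → b i ⊛ u i zero)))))
      (solve 2 (λ s d → (:- s) :* d :+ d :* s := :0) refl s d))
    relation (suc j) = trans (split (suc j)) (trans (+-comm _ _) (trans (cong (sum (λ i → (d ⊛ b i) ⊛ u i (suc j)) ⊕_) scaled)
      (trans (sym (∑-distrib-+ (λ i → (d ⊛ b i) ⊛ u i (suc j)) (λ i → (b i ⊛ u i zero) ⊛ (-F t)))) (trans (sum-cong-≗ combine) (proj₂ (proj₂ rest) j)))))
      where
      t : Fin q
      t = v i₀ (suc j)
      scaled : (-F s) ⊛ t ≡ sum (λ i → (b i ⊛ u i zero) ⊛ (-F t))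
      scaled = trans (solve 2 (λ s t → (:- s) :* t := s :* (:- t)) refl s t) (*-distribʳ-sum (-F t) (λ i → b i ⊛ u i zero))
      combine : ∀ i → (d ⊛ b i) ⊛ u i (suc j) ⊕ (b i ⊛ u i zero) ⊛ (-F t) ≡ b i ⊛ w i j
      combine i = solve 5 (λ d b x y t → (d :* b) :* x :+ (b :* y) :* (:- t) := b :* (d :* x :- y :* t)) refl d (b i) (u i (suc j)) (u i zero) t

  open Matrices F public hiding (_-F_)

  adj : Mat q → Mat q
  adj (mat a b c d) = mat d (-F b) (-F c) a

  I 0M : Mat q
  I = mat 1F 0F 0F 1F
  0M = mat 0F 0F 0F 0F

  infixr 7 _•_
  infixl 6 _+M_
  _•_ : Fin q → Mat q → Mat q
  s • mat a b c d = mat (s ⊛ a) (s ⊛ b) (s ⊛ c) (s ⊛ d)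

  _+M_ : Mat q → Mat q → Mat q
  mat a b c d +M mat a′ b′ c′ d′ = mat (a ⊕ a′) (b ⊕ b′) (c ⊕ c′) (d ⊕ d′)

  tr : Mat q → Fin q
  tr (mat a b c d) = a ⊕ d

  -- The polarisation of det, ⟨ A , B ⟩ = tr (adj A · B).
  ⟨_,_⟩ : Mat q → Mat q → Fin q
  ⟨ mat a b c d , mat a′ b′ c′ d′ ⟩ = a ⊛ d′ ⊕ d ⊛ a′ ⊖ b ⊛ c′ ⊖ c ⊛ b′

  mat-cong : ∀ {a b c d a′ b′ c′ d′ : Fin q} → a ≡ a′ → b ≡ b′ → c ≡ c′ → d ≡ d′ → mat a b c d ≡ mat a′ b′ c′ d′
  mat-cong refl refl refl refl = refl

  det-· : ∀ A B → det (A · B) ≡ det A ⊛ det B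
  det-· (mat a b c d) (mat a′ b′ c′ d′) = solve 8 (λ a b c d a′ b′ c′ d′ →
    (a :* a′ :+ b :* c′) :* (c :* b′ :+ d :* d′) :- (a :* b′ :+ b :* d′) :* (c :* a′ :+ d :* c′)
      := (a :* d :- b :* c) :* (a′ :* d′ :- b′ :* c′)) refl a b c d a′ b′ c′ d′

  det-adj : ∀ A → det (adj A) ≡ det A
  det-adj (mat a b c d) = solve 4 (λ a b c d → d :* a :- (:- b) :* (:- c) := a :* d :- b :* c) refl a b c d

  det-• : ∀ s A → det (s • A) ≡ (s ⊛ s) ⊛ det A
  det-• s (mat a b c d) = solve 5 (λ s a b c d → (s :* a) :* (s :* d) :- (s :* b) :* (s :* c) := (s :* s) :* (a :* d :- b :* c)) refl s a b c d

  det-I : det I ≡ 1F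
  det-I = solve 0 (:1 :* :1 :- :0 :* :0 := :1) refl

  ·-assoc : ∀ A B C → (A · B) · C ≡ A · (B · C)
  ·-assoc (mat a b c d) (mat a′ b′ c′ d′) (mat a″ b″ c″ d″) =
    mat-cong (entry a b a″ c″) (entry a b b″ d″) (entry c d a″ c″) (entry c d b″ d″)
    where
    entry : ∀ x y z w → (x ⊛ a′ ⊕ y ⊛ c′) ⊛ z ⊕ (x ⊛ b′ ⊕ y ⊛ d′) ⊛ w ≡ x ⊛ (a′ ⊛ z ⊕ b′ ⊛ w) ⊕ y ⊛ (c′ ⊛ z ⊕ d′ ⊛ w)
    entry x y z w = solve 8 (λ x y z w a b c d → (x :* a :+ y :* c) :* z :+ (x :* b :+ y :* d) :* w
      := x :* (a :* z :+ b :* w) :+ y :* (c :* z :+ d :* w)) refl x y z w a′ b′ c′ d′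

  adj-·ˡ : ∀ A → adj A · A ≡ det A • I
  adj-·ˡ (mat a b c d) = mat-cong
    (solve 4 (λ a b c d → d :* a :+ (:- b) :* c := (a :* d :- b :* c) :* :1) refl a b c d)
    (solve 4 (λ a b c d → d :* b :+ (:- b) :* d := (a :* d :- b :* c) :* :0) refl a b c d)
    (solve 4 (λ a b c d → (:- c) :* a :+ a :* c := (a :* d :- b :* c) :* :0) refl a b c d)
    (solve 4 (λ a b c d → (:- c) :* b :+ a :* d := (a :* d :- b :* c) :* :1) refl a b c d)

  adj-·ʳ : ∀ A → A · adj A ≡ det A • I
  adj-·ʳ (mat a b c d) = mat-cong
    (solve 4 (λ a b c d → a :* d :+ b :* (:- c) := (a :* d :- b :* c) :* :1) refl a b c d)
    (solve 4 (λ a b c d → a :* (:- b) :+ b :* a := (a :* d :- b :* c) :* :0) refl a b c d)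
    (solve 4 (λ a b c d → c :* d :+ d :* (:- c) := (a :* d :- b :* c) :* :0) refl a b c d)
    (solve 4 (λ a b c d → c :* (:- b) :+ d :* a := (a :* d :- b :* c) :* :1) refl a b c d)

  •I-· : ∀ s A → (s • I) · A ≡ s • A
  •I-· s (mat a b c d) = mat-cong
    (solve 3 (λ s a c → (s :* :1) :* a :+ (s :* :0) :* c := s :* a) refl s a c)
    (solve 3 (λ s a c → (s :* :1) :* a :+ (s :* :0) :* c := s :* a) refl s b d)
    (solve 3 (λ s a c → (s :* :0) :* a :+ (s :* :1) :* c := s :* c) refl s a c)
    (solve 3 (λ s a c → (s :* :0) :* a :+ (s :* :1) :* c := s :* c) refl s b d)

  ⟨⟩-sym : ∀ A B → ⟨ A , B ⟩ ≡ ⟨ B , A ⟩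
  ⟨⟩-sym (mat a b c d) (mat a′ b′ c′ d′) = solve 8 (λ a b c d a′ b′ c′ d′ →
    a :* d′ :+ d :* a′ :- b :* c′ :- c :* b′ := a′ :* d :+ d′ :* a :- b′ :* c :- c′ :* b) refl a b c d a′ b′ c′ d′

  ⟨⟩-self : ∀ A → ⟨ A , A ⟩ ≡ ι (+ 2) ⊛ det A
  ⟨⟩-self (mat a b c d) = solve 4 (λ a b c d → a :* d :+ d :* a :- b :* c :- c :* b := :2 :* (a :* d :- b :* c)) refl a b c d

  ⟨⟩-+ˡ : ∀ A B C → ⟨ A +M B , C ⟩ ≡ ⟨ A , C ⟩ ⊕ ⟨ B , C ⟩
  ⟨⟩-+ˡ (mat a b c d) (mat a′ b′ c′ d′) (mat x y z w) = solve 12 (λ a b c d a′ b′ c′ d′ x y z w →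
    (a :+ a′) :* w :+ (d :+ d′) :* x :- (b :+ b′) :* z :- (c :+ c′) :* y
      := (a :* w :+ d :* x :- b :* z :- c :* y) :+ (a′ :* w :+ d′ :* x :- b′ :* z :- c′ :* y)) refl a b c d a′ b′ c′ d′ x y z w

  ⟨⟩-•ˡ : ∀ s A B → ⟨ s • A , B ⟩ ≡ s ⊛ ⟨ A , B ⟩
  ⟨⟩-•ˡ s (mat a b c d) (mat x y z w) = solve 9 (λ s a b c d x y z w →
    (s :* a) :* w :+ (s :* d) :* x :- (s :* b) :* z :- (s :* c) :* y := s :* (a :* w :+ d :* x :- b :* z :- c :* y)) refl s a b c d x y z w

  ⟨⟩-•ʳ : ∀ s A B → ⟨ A , s • B ⟩ ≡ s ⊛ ⟨ A , B ⟩
  ⟨⟩-•ʳ s A B = trans (⟨⟩-sym A (s • B)) (trans (⟨⟩-•ˡ s B A) (cong (s ⊛_) (⟨⟩-sym B A)))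

  ⟨⟩-+ʳ : ∀ A B C → ⟨ A , B +M C ⟩ ≡ ⟨ A , B ⟩ ⊕ ⟨ A , C ⟩
  ⟨⟩-+ʳ A B C = trans (⟨⟩-sym A (B +M C)) (trans (⟨⟩-+ˡ B C A) (cong₂ _⊕_ (⟨⟩-sym B A) (⟨⟩-sym C A)))

  -- Polarised multiplicativity of `det`; translation by a unimodular matrix is an isometry, and
  -- translation by a reflection multiplies the form by its determinant.
  ⟨⟩-·ˡ : ∀ Z A B → ⟨ Z · A , Z · B ⟩ ≡ det Z ⊛ ⟨ A , B ⟩
  ⟨⟩-·ˡ (mat x y z w) (mat a b c d) (mat a′ b′ c′ d′) = solve 12 (λ x y z w a b c d a′ b′ c′ d′ →
     (x :* a :+ y :* c) :* (z :* b′ :+ w :* d′) :+ (z :* b :+ w :* d) :* (x :* a′ :+ y :* c′)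
       :- (x :* b :+ y :* d) :* (z :* a′ :+ w :* c′) :- (z :* a :+ w :* c) :* (x :* b′ :+ y :* d′)
     := (x :* w :- y :* z) :* (a :* d′ :+ d :* a′ :- b :* c′ :- c :* b′)) refl x y z w a b c d a′ b′ c′ d′

  ⟨⟩-·ʳ : ∀ Z A B → ⟨ A · Z , B · Z ⟩ ≡ det Z ⊛ ⟨ A , B ⟩
  ⟨⟩-·ʳ (mat x y z w) (mat a b c d) (mat a′ b′ c′ d′) = solve 12 (λ x y z w a b c d a′ b′ c′ d′ →
     (a :* x :+ b :* z) :* (c′ :* y :+ d′ :* w) :+ (c :* y :+ d :* w) :* (a′ :* x :+ b′ :* z)
       :- (a :* y :+ b :* w) :* (c′ :* x :+ d′ :* z) :- (c :* x :+ d :* z) :* (a′ :* y :+ b′ :* w)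
     := (x :* w :- y :* z) :* (a :* d′ :+ d :* a′ :- b :* c′ :- c :* b′)) refl x y z w a b c d a′ b′ c′ d′

  -- The adjoint of right multiplication by Z; it lets the two halves of a family in PGL(2,q)
  -- exchange roles.
  ⟨⟩-adjʳ : ∀ A B Z → ⟨ A · adj Z , B ⟩ ≡ ⟨ A , B · Z ⟩
  ⟨⟩-adjʳ (mat a b c d) (mat a′ b′ c′ d′) (mat x y z w) = solve 12 (λ x y z w a b c d a′ b′ c′ d′ →
     (a :* w :+ b :* (:- z)) :* d′ :+ (c :* (:- y) :+ d :* x) :* a′ :- (a :* (:- y) :+ b :* x) :* c′ :- (c :* w :+ d :* (:- z)) :* b′
     := a :* (c′ :* y :+ d′ :* w) :+ d :* (a′ :* x :+ b′ :* z) :- b :* (c′ :* x :+ d′ :* z) :- c :* (a′ :* y :+ b′ :* w)) refl x y z w a b c d a′ b′ c′ d′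

  ⟨⟩-tr : ∀ A B → ⟨ A , B ⟩ ≡ tr (adj A · B)
  ⟨⟩-tr (mat a b c d) (mat a′ b′ c′ d′) = solve 8 (λ a b c d a′ b′ c′ d′ →
    a :* d′ :+ d :* a′ :- b :* c′ :- c :* b′ := (d :* a′ :+ (:- b) :* c′) :+ ((:- c) :* b′ :+ a :* d′)) refl a b c d a′ b′ c′ d′

  ⟨⟩-I : ∀ A → ⟨ I , A ⟩ ≡ tr A
  ⟨⟩-I (mat a b c d) = solve 4 (λ a b c d → :1 :* d :+ :1 :* a :- :0 :* c :- :0 :* b := a :+ d) refl a b c d

  combination : ∀ {n} → (Fin n → Fin q) → (Fin n → Mat q) → Mat q
  combination {zero} c X = 0M
  combination {suc n} c X = c zero • X zero +M combination (c ∘ suc) (X ∘ suc)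

  ⟨⟩-combination : ∀ {n} c (X : Fin n → Mat q) Y → ⟨ combination c X , Y ⟩ ≡ sum (λ i → c i ⊛ ⟨ X i , Y ⟩)
  ⟨⟩-combination {zero} c X (mat a b c′ d) = solve 4 (λ a b c d → :0 :* d :+ :0 :* a :- :0 :* c :- :0 :* b := :0) refl a b c′ d
  ⟨⟩-combination {suc n} c X Y = trans (⟨⟩-+ˡ (c zero • X zero) _ Y)
    (cong₂ _⊕_ (⟨⟩-•ˡ (c zero) (X zero) Y) (⟨⟩-combination (c ∘ suc) (X ∘ suc) Y))

  entries : Mat q → Fin 4 → Fin q
  entries A zero = Mat.a A
  entries A (suc zero) = Mat.b A
  entries A (suc (suc zero)) = Mat.c A
  entries A (suc (suc (suc zero))) = Mat.d A

  five-dependent : (X : Fin 5 → Mat q) → ∃[ c ] (Nontrivial c × combination c X ≡ 0M)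
  five-dependent X with dependence 4 (λ i → entries (X i))
  ... | c , n , r = c , n , mat-cong (r zero) (r (suc zero)) (r (suc (suc zero))) (r (suc (suc (suc zero))))

  -- Only the pairings of the relation with test matrices are kept. These form the Gram system, and
  -- no coordinates are needed from here on.
  record Dependent (X₁ X₂ X₃ X₄ X₅ : Mat q) : Set where
    field
      c₁ c₂ c₃ c₄ c₅ : Fin q
      nontrivial : ¬ (c₁ ≡ 0F × c₂ ≡ 0F × c₃ ≡ 0F × c₄ ≡ 0F × c₅ ≡ 0F)
      pair : ∀ Y {g₁ g₂ g₃ g₄ g₅} → ⟨ X₁ , Y ⟩ ≡ g₁ → ⟨ X₂ , Y ⟩ ≡ g₂ → ⟨ X₃ , Y ⟩ ≡ g₃ → ⟨ X₄ , Y ⟩ ≡ g₄ → ⟨ X₅ , Y ⟩ ≡ g₅ →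
        c₁ ⊛ g₁ ⊕ c₂ ⊛ g₂ ⊕ c₃ ⊛ g₃ ⊕ c₄ ⊛ g₄ ⊕ c₅ ⊛ g₅ ≡ 0F

  dependent : ∀ X₁ X₂ X₃ X₄ X₅ → Dependent X₁ X₂ X₃ X₄ X₅
  dependent X₁ X₂ X₃ X₄ X₅ = record
    { c₁ = c i₁ ; c₂ = c i₂ ; c₃ = c i₃ ; c₄ = c i₄ ; c₅ = c i₅
    ; nontrivial = λ (z₁ , z₂ , z₃ , z₄ , z₅) → proj₂ (proj₁ (proj₂ D)) (all-zero z₁ z₂ z₃ z₄ z₅ (proj₁ (proj₁ (proj₂ D))))
    ; pair = pair
    }
    where
    i₁ i₂ i₃ i₄ i₅ : Fin 5
    i₁ = zero
    i₂ = suc zero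
    i₃ = suc (suc zero)
    i₄ = suc (suc (suc zero))
    i₅ = suc (suc (suc (suc zero)))
    X : Fin 5 → Mat q
    X zero = X₁
    X (suc zero) = X₂
    X (suc (suc zero)) = X₃
    X (suc (suc (suc zero))) = X₄
    X (suc (suc (suc (suc zero)))) = X₅
    D : ∃[ c ] (Nontrivial c × combination c X ≡ 0M)
    D = five-dependent X
    c : Fin 5 → Fin q
    c = proj₁ D
    all-zero : c i₁ ≡ 0F → c i₂ ≡ 0F → c i₃ ≡ 0F → c i₄ ≡ 0F → c i₅ ≡ 0F → ∀ i → c i ≡ 0F
    all-zero z₁ z₂ z₃ z₄ z₅ zero = z₁
    all-zero z₁ z₂ z₃ z₄ z₅ (suc zero) = z₂
    all-zero z₁ z₂ z₃ z₄ z₅ (suc (suc zero)) = z₃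
    all-zero z₁ z₂ z₃ z₄ z₅ (suc (suc (suc zero))) = z₄
    all-zero z₁ z₂ z₃ z₄ z₅ (suc (suc (suc (suc zero)))) = z₅
    pair : ∀ Y {g₁ g₂ g₃ g₄ g₅} → ⟨ X₁ , Y ⟩ ≡ g₁ → ⟨ X₂ , Y ⟩ ≡ g₂ → ⟨ X₃ , Y ⟩ ≡ g₃ → ⟨ X₄ , Y ⟩ ≡ g₄ → ⟨ X₅ , Y ⟩ ≡ g₅ →
      c i₁ ⊛ g₁ ⊕ c i₂ ⊛ g₂ ⊕ c i₃ ⊛ g₃ ⊕ c i₄ ⊛ g₄ ⊕ c i₅ ⊛ g₅ ≡ 0F
    pair Y refl refl refl refl refl = trans
      (solve 5 (λ x y z w v → x :+ y :+ z :+ w :+ v := x :+ (y :+ (z :+ (w :+ (v :+ :0))))) refl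
        (c i₁ ⊛ ⟨ X₁ , Y ⟩) (c i₂ ⊛ ⟨ X₂ , Y ⟩) (c i₃ ⊛ ⟨ X₃ , Y ⟩) (c i₄ ⊛ ⟨ X₄ , Y ⟩) (c i₅ ⊛ ⟨ X₅ , Y ⟩))
      (trans (sym (⟨⟩-combination c X Y)) (trans (cong (λ Z → ⟨ Z , Y ⟩) (proj₂ (proj₂ D))) (⟨⟩-combination {0} (λ ()) (λ ()) Y)))

  -- Gram systems of triples with equal pairings

  2F 3F : Fin q
  2F = ι (+ 2)
  3F = ι (+ 3)

  -- After suitable sign changes any three members of a clique take this form, with g = 1 or g = -1;
  -- the diagonal 2 is twice the determinant.
  record Triple (g : Fin q) (A B C : Mat q) : Set where
    field
      AA : ⟨ A , A ⟩ ≡ 2F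
      BB : ⟨ B , B ⟩ ≡ 2F
      CC : ⟨ C , C ⟩ ≡ 2F
      AB : ⟨ A , B ⟩ ≡ g
      AC : ⟨ A , C ⟩ ≡ g
      BC : ⟨ B , C ⟩ ≡ g

    BA : ⟨ B , A ⟩ ≡ g
    BA = trans (⟨⟩-sym B A) AB
    CA : ⟨ C , A ⟩ ≡ g
    CA = trans (⟨⟩-sym C A) AC
    CB : ⟨ C , B ⟩ ≡ g
    CB = trans (⟨⟩-sym C B) BC

  flip : ∀ {A B g} → ⟨ A , B ⟩ ≡ g → ⟨ B , A ⟩ ≡ g
  flip {A} {B} e = trans (⟨⟩-sym B A) e

  numeral-* : ∀ m n → ι (+ m) ≢ 0F → ι (+ n) ≢ 0F → ι (+ m ℤ.* + n) ≢ 0F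
  numeral-* m n m≢0 n≢0 e = *-≢0 m≢0 n≢0 (trans (sym (ι-* (+ m) (+ n))) e)

  module _ (2≢0 : 2F ≢ 0F) where

    4≢0 : ι (+ 4) ≢ 0F
    4≢0 = numeral-* 2 2 2≢0 2≢0

    module PlusTriple {A B C X Y : Mat q} (T : Triple 1F A B C) where
      open Triple T

      -- The Gram matrix I + J of the triple has determinant 4, and the right-hand sides are
      -- constant vectors, so the first three coefficients agree.
      coefficients : ∀ {c₁ c₂ c₃ c₄ c₅ x y} →
        c₁ ⊛ 2F ⊕ c₂ ⊛ 1F ⊕ c₃ ⊛ 1F ⊕ c₄ ⊛ x ⊕ c₅ ⊛ y ≡ 0F →
        c₁ ⊛ 1F ⊕ c₂ ⊛ 2F ⊕ c₃ ⊛ 1F ⊕ c₄ ⊛ x ⊕ c₅ ⊛ y ≡ 0F →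
        c₁ ⊛ 1F ⊕ c₂ ⊛ 1F ⊕ c₃ ⊛ 2F ⊕ c₄ ⊛ x ⊕ c₅ ⊛ y ≡ 0F →
        ι (+ 4) ⊛ c₁ ≡ -F (c₄ ⊛ x ⊕ c₅ ⊛ y) × c₂ ≡ c₁ × c₃ ≡ c₁
      coefficients {c₁} {c₂} {c₃} {c₄} {c₅} {x} {y} e₁ e₂ e₃ =
          comb₃ 3F -1F -1F (solve 7 (λ c₁ c₂ c₃ c₄ c₅ x y → :4 :* c₁ :- (:- (c₄ :* x :+ c₅ :* y)) :=
            :3 :* (c₁ :* :2 :+ c₂ :* :1 :+ c₃ :* :1 :+ c₄ :* x :+ c₅ :* y :- :0)
            :+ :-1 :* (c₁ :* :1 :+ c₂ :* :2 :+ c₃ :* :1 :+ c₄ :* x :+ c₅ :* y :- :0)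
            :+ :-1 :* (c₁ :* :1 :+ c₂ :* :1 :+ c₃ :* :2 :+ c₄ :* x :+ c₅ :* y :- :0))
            refl c₁ c₂ c₃ c₄ c₅ x y) e₁ e₂ e₃
        , comb₂ 1F -1F (solve 7 (λ c₁ c₂ c₃ c₄ c₅ x y → c₂ :- c₁ :=
            :1 :* (c₁ :* :1 :+ c₂ :* :2 :+ c₃ :* :1 :+ c₄ :* x :+ c₅ :* y :- :0)
            :+ :-1 :* (c₁ :* :2 :+ c₂ :* :1 :+ c₃ :* :1 :+ c₄ :* x :+ c₅ :* y :- :0))
            refl c₁ c₂ c₃ c₄ c₅ x y) e₂ e₁
        , comb₂ 1F -1F (solve 7 (λ c₁ c₂ c₃ c₄ c₅ x y → c₃ :- c₁ :=
            :1 :* (c₁ :* :1 :+ c₂ :* :1 :+ c₃ :* :2 :+ c₄ :* x :+ c₅ :* y :- :0)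
            :+ :-1 :* (c₁ :* :2 :+ c₂ :* :1 :+ c₃ :* :1 :+ c₄ :* x :+ c₅ :* y :- :0))
            refl c₁ c₂ c₃ c₄ c₅ x y) e₃ e₁

      relations : (D : Dependent A B C X Y) → let open Dependent D in ∀ {x y} →
        ⟨ X , A ⟩ ≡ x → ⟨ X , B ⟩ ≡ x → ⟨ X , C ⟩ ≡ x → ⟨ Y , A ⟩ ≡ y → ⟨ Y , B ⟩ ≡ y → ⟨ Y , C ⟩ ≡ y →
        ι (+ 4) ⊛ c₁ ≡ -F (c₄ ⊛ x ⊕ c₅ ⊛ y) × c₂ ≡ c₁ × c₃ ≡ c₁
      relations D XA XB XC YA YB YC = coefficients (pair A AA BA CA XA YA) (pair B AB BB CB XB YB) (pair C AC BC CC XC YC)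
        where open Dependent D

      vanishing : ∀ {c₁ c₂ c₃ c₄ c₅ x y : Fin q} → ι (+ 4) ⊛ c₁ ≡ -F (c₄ ⊛ x ⊕ c₅ ⊛ y) × c₂ ≡ c₁ × c₃ ≡ c₁ →
        c₄ ≡ 0F → c₅ ≡ 0F → c₁ ≡ 0F × c₂ ≡ 0F × c₃ ≡ 0F × c₄ ≡ 0F × c₅ ≡ 0F
      vanishing {c₁} {x = x} {y} (e , refl , refl) refl refl = z , z , z , refl , refl
        where
        z : c₁ ≡ 0F
        z = cancel-* 4≢0 (trans e (solve 2 (λ x y → :- (:0 :* x :+ :0 :* y) := :0) refl x y))

      -- The complement of the triple is a line, while X and Y have Gram determinant 4δ² - δ² = 3δ².
      no-orthogonal-pair : 3F ≢ 0F → ∀ {δ ε} → δ ≢ 0F → ε ⊛ ε ≡ 1F →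
        ⟨ X , A ⟩ ≡ 0F → ⟨ X , B ⟩ ≡ 0F → ⟨ X , C ⟩ ≡ 0F → ⟨ Y , A ⟩ ≡ 0F → ⟨ Y , B ⟩ ≡ 0F → ⟨ Y , C ⟩ ≡ 0F →
        ⟨ X , X ⟩ ≡ 2F ⊛ δ → ⟨ Y , Y ⟩ ≡ 2F ⊛ δ → ⟨ X , Y ⟩ ≡ ε ⊛ δ → ⊥
      no-orthogonal-pair 3≢0 {δ} {ε} δ≢0 ε² XA XB XC YA YB YC XX YY XY = nontrivial
          (vanishing (relations D XA XB XC YA YB YC)
            (cancel-* (*-≢0 3≢0 δ≢0) (comb₃ 2F (-F ε) (δ ⊛ c₄)
              (solve 7 (λ c₁ c₂ c₃ c₄ c₅ δ ε → (:3 :* δ) :* c₄ :- :0 :=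
                :2 :* (c₁ :* :0 :+ c₂ :* :0 :+ c₃ :* :0 :+ c₄ :* (:2 :* δ) :+ c₅ :* (ε :* δ) :- :0)
                :+ (:- ε) :* (c₁ :* :0 :+ c₂ :* :0 :+ c₃ :* :0 :+ c₄ :* (ε :* δ) :+ c₅ :* (:2 :* δ) :- :0)
                :+ (δ :* c₄) :* (ε :* ε :- :1)) refl c₁ c₂ c₃ c₄ c₅ δ ε) eX eY ε²))
            (cancel-* (*-≢0 3≢0 δ≢0) (comb₃ 2F (-F ε) (δ ⊛ c₅)
              (solve 7 (λ c₁ c₂ c₃ c₄ c₅ δ ε → (:3 :* δ) :* c₅ :- :0 :=
                :2 :* (c₁ :* :0 :+ c₂ :* :0 :+ c₃ :* :0 :+ c₄ :* (ε :* δ) :+ c₅ :* (:2 :* δ) :- :0)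
                :+ (:- ε) :* (c₁ :* :0 :+ c₂ :* :0 :+ c₃ :* :0 :+ c₄ :* (:2 :* δ) :+ c₅ :* (ε :* δ) :- :0)
                :+ (δ :* c₅) :* (ε :* ε :- :1)) refl c₁ c₂ c₃ c₄ c₅ δ ε) eY eX ε²)))
        where
        D = dependent A B C X Y
        open Dependent D
        eX = pair X (flip {X} {A} XA) (flip {X} {B} XB) (flip {X} {C} XC) XX (flip {X} {Y} XY)
        eY = pair Y (flip {Y} {A} YA) (flip {Y} {B} YB) (flip {Y} {C} YC) XY YY

      -- The Gram matrix I + J of size five has determinant 6, so the five matrices would be
      -- independent.
      no-five : 3F ≢ 0F → ⟨ X , A ⟩ ≡ 1F → ⟨ X , B ⟩ ≡ 1F → ⟨ X , C ⟩ ≡ 1F → ⟨ Y , A ⟩ ≡ 1F → ⟨ Y , B ⟩ ≡ 1F → ⟨ Y , C ⟩ ≡ 1F →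
        ⟨ X , X ⟩ ≡ 2F → ⟨ Y , Y ⟩ ≡ 2F → ⟨ X , Y ⟩ ≡ 1F → ⊥
      no-five 3≢0 XA XB XC YA YB YC XX YY XY = nontrivial (vanishing r
          (cancel-* (numeral-* 2 3 2≢0 3≢0) (combine c₂≡ c₃≡ r₁ eX eY))
          (cancel-* (numeral-* 2 3 2≢0 3≢0) (combine′ c₂≡ c₃≡ r₁ eX eY)))
        where
        D = dependent A B C X Y
        open Dependent D
        eX = pair X (flip {X} {A} XA) (flip {X} {B} XB) (flip {X} {C} XC) XX (flip {X} {Y} XY)
        eY = pair Y (flip {Y} {A} YA) (flip {Y} {B} YB) (flip {Y} {C} YC) XY YY
        r = relations D XA XB XC YA YB YC
        r₁ = proj₁ r
        c₂≡ = proj₁ (proj₂ r)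
        c₃≡ = proj₂ (proj₂ r)
        combine : c₂ ≡ c₁ → c₃ ≡ c₁ → ι (+ 4) ⊛ c₁ ≡ -F (c₄ ⊛ 1F ⊕ c₅ ⊛ 1F) →
          c₁ ⊛ 1F ⊕ c₂ ⊛ 1F ⊕ c₃ ⊛ 1F ⊕ c₄ ⊛ 2F ⊕ c₅ ⊛ 1F ≡ 0F → c₁ ⊛ 1F ⊕ c₂ ⊛ 1F ⊕ c₃ ⊛ 1F ⊕ c₄ ⊛ 1F ⊕ c₅ ⊛ 2F ≡ 0F →
          ι (+ 6) ⊛ c₄ ≡ 0F
        combine e₂ e₃ r e f = comb₅ (ι -[1+ 3 ]) (ι -[1+ 3 ]) (ι -[1+ 2 ]) (ι (+ 5)) -1F (solve 5 (λ c₁ c₂ c₃ c₄ c₅ → :6 :* c₄ :- :0 :=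
            :-4 :* (c₂ :- c₁) :+ :-4 :* (c₃ :- c₁) :+ :-3 :* (:4 :* c₁ :- (:- (c₄ :* :1 :+ c₅ :* :1)))
            :+ :5 :* (c₁ :* :1 :+ c₂ :* :1 :+ c₃ :* :1 :+ c₄ :* :2 :+ c₅ :* :1 :- :0)
            :+ :-1 :* (c₁ :* :1 :+ c₂ :* :1 :+ c₃ :* :1 :+ c₄ :* :1 :+ c₅ :* :2 :- :0))
            refl c₁ c₂ c₃ c₄ c₅) e₂ e₃ r e f
        combine′ : c₂ ≡ c₁ → c₃ ≡ c₁ → ι (+ 4) ⊛ c₁ ≡ -F (c₄ ⊛ 1F ⊕ c₅ ⊛ 1F) →
          c₁ ⊛ 1F ⊕ c₂ ⊛ 1F ⊕ c₃ ⊛ 1F ⊕ c₄ ⊛ 2F ⊕ c₅ ⊛ 1F ≡ 0F → c₁ ⊛ 1F ⊕ c₂ ⊛ 1F ⊕ c₃ ⊛ 1F ⊕ c₄ ⊛ 1F ⊕ c₅ ⊛ 2F ≡ 0F →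
          ι (+ 6) ⊛ c₅ ≡ 0F
        combine′ e₂ e₃ r e f = comb₅ (ι -[1+ 3 ]) (ι -[1+ 3 ]) (ι -[1+ 2 ]) -1F (ι (+ 5)) (solve 5 (λ c₁ c₂ c₃ c₄ c₅ → :6 :* c₅ :- :0 :=
            :-4 :* (c₂ :- c₁) :+ :-4 :* (c₃ :- c₁) :+ :-3 :* (:4 :* c₁ :- (:- (c₄ :* :1 :+ c₅ :* :1)))
            :+ :-1 :* (c₁ :* :1 :+ c₂ :* :1 :+ c₃ :* :1 :+ c₄ :* :2 :+ c₅ :* :1 :- :0)
            :+ :5 :* (c₁ :* :1 :+ c₂ :* :1 :+ c₃ :* :1 :+ c₄ :* :1 :+ c₅ :* :2 :- :0))
            refl c₁ c₂ c₃ c₄ c₅) e₂ e₃ r e f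

    module MinusTriple (3≢0 : 3F ≢ 0F) {A B C X Y : Mat q} (T : Triple -1F A B C) where
      open Triple T

      -- With all three entries off the diagonal equal to -1 the Gram matrix of A, B, C is singular, with kernel (1, 1, 1).
      module Coefficients {x₁ x₂ x₃ y₁ y₂ y₃ : Fin q}
        (XA : ⟨ X , A ⟩ ≡ x₁) (XB : ⟨ X , B ⟩ ≡ x₂) (XC : ⟨ X , C ⟩ ≡ x₃)
        (YA : ⟨ Y , A ⟩ ≡ y₁) (YB : ⟨ Y , B ⟩ ≡ y₂) (YC : ⟨ Y , C ⟩ ≡ y₃) where

        D : Dependent A B C X Y
        D = dependent A B C X Y
        open Dependent D public

        eA : c₁ ⊛ 2F ⊕ c₂ ⊛ -1F ⊕ c₃ ⊛ -1F ⊕ c₄ ⊛ x₁ ⊕ c₅ ⊛ y₁ ≡ 0F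
        eA = pair A AA BA CA XA YA
        eB : c₁ ⊛ -1F ⊕ c₂ ⊛ 2F ⊕ c₃ ⊛ -1F ⊕ c₄ ⊛ x₂ ⊕ c₅ ⊛ y₂ ≡ 0F
        eB = pair B AB BB CB XB YB
        eC : c₁ ⊛ -1F ⊕ c₂ ⊛ -1F ⊕ c₃ ⊛ 2F ⊕ c₄ ⊛ x₃ ⊕ c₅ ⊛ y₃ ≡ 0F
        eC = pair C AC BC CC XC YC

        -- Pairing with A + B + C, the kernel vector of the Gram matrix, eliminates the first three
        -- coefficients.
        sum-relation : c₄ ⊛ (x₁ ⊕ x₂ ⊕ x₃) ⊕ c₅ ⊛ (y₁ ⊕ y₂ ⊕ y₃) ≡ 0F
        sum-relation = comb₃ 1F 1F 1F (solve 11 (λ c₁ c₂ c₃ c₄ c₅ x₁ x₂ x₃ y₁ y₂ y₃ → c₄ :* (x₁ :+ x₂ :+ x₃) :+ c₅ :* (y₁ :+ y₂ :+ y₃) :- :0 :=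
          :1 :* (c₁ :* :2 :+ c₂ :* :-1 :+ c₃ :* :-1 :+ c₄ :* x₁ :+ c₅ :* y₁ :- :0)
          :+ :1 :* (c₁ :* :-1 :+ c₂ :* :2 :+ c₃ :* :-1 :+ c₄ :* x₂ :+ c₅ :* y₂ :- :0)
          :+ :1 :* (c₁ :* :-1 :+ c₂ :* :-1 :+ c₃ :* :2 :+ c₄ :* x₃ :+ c₅ :* y₃ :- :0))
          refl c₁ c₂ c₃ c₄ c₅ x₁ x₂ x₃ y₁ y₂ y₃) eA eB eC

        A-value : 3F ⊛ c₁ ≡ c₁ ⊕ c₂ ⊕ c₃ ⊖ (c₄ ⊛ x₁ ⊕ c₅ ⊛ y₁)
        A-value = comb₁ 1F (solve 7 (λ c₁ c₂ c₃ c₄ c₅ x y → :3 :* c₁ :- (c₁ :+ c₂ :+ c₃ :- (c₄ :* x :+ c₅ :* y)) :=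
          :1 :* (c₁ :* :2 :+ c₂ :* :-1 :+ c₃ :* :-1 :+ c₄ :* x :+ c₅ :* y :- :0)) refl c₁ c₂ c₃ c₄ c₅ x₁ y₁) eA
        B-value : 3F ⊛ c₂ ≡ c₁ ⊕ c₂ ⊕ c₃ ⊖ (c₄ ⊛ x₂ ⊕ c₅ ⊛ y₂)
        B-value = comb₁ 1F (solve 7 (λ c₁ c₂ c₃ c₄ c₅ x y → :3 :* c₂ :- (c₁ :+ c₂ :+ c₃ :- (c₄ :* x :+ c₅ :* y)) :=
          :1 :* (c₁ :* :-1 :+ c₂ :* :2 :+ c₃ :* :-1 :+ c₄ :* x :+ c₅ :* y :- :0)) refl c₁ c₂ c₃ c₄ c₅ x₂ y₂) eB
        C-value : 3F ⊛ c₃ ≡ c₁ ⊕ c₂ ⊕ c₃ ⊖ (c₄ ⊛ x₃ ⊕ c₅ ⊛ y₃)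
        C-value = comb₁ 1F (solve 7 (λ c₁ c₂ c₃ c₄ c₅ x y → :3 :* c₃ :- (c₁ :+ c₂ :+ c₃ :- (c₄ :* x :+ c₅ :* y)) :=
          :1 :* (c₁ :* :-1 :+ c₂ :* :-1 :+ c₃ :* :2 :+ c₄ :* x :+ c₅ :* y :- :0)) refl c₁ c₂ c₃ c₄ c₅ x₃ y₃) eC

        -- Without X and Y the relation lies in the kernel, so its coefficients are equal; pairing
        -- with X multiplies their common value by a nonzero sum.
        vanishing : x₁ ⊕ x₂ ⊕ x₃ ≢ 0F → c₄ ≡ 0F → c₅ ≡ 0F → ⟨ X , X ⟩ ≡ 2F →
          c₁ ≡ 0F × c₂ ≡ 0F × c₃ ≡ 0F × c₄ ≡ 0F × c₅ ≡ 0F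
        vanishing σ≢0 z₄ z₅ XX = z₁ , trans (c-equal B-value A-value) z₁ , trans (c-equal C-value A-value) z₁ , z₄ , z₅
          where
          c-equal : ∀ {c c′ s x y x′ y′} → 3F ⊛ c ≡ s ⊖ (c₄ ⊛ x ⊕ c₅ ⊛ y) → 3F ⊛ c′ ≡ s ⊖ (c₄ ⊛ x′ ⊕ c₅ ⊛ y′) → c ≡ c′
          c-equal {c} {c′} {s} {x} {y} {x′} {y′} e e′ = *-cancelˡ 3≢0 (comb₄ 1F -1F (x′ ⊖ x) (y′ ⊖ y)
            (solve 9 (λ c c′ s x y x′ y′ c₄ c₅ → :3 :* c :- :3 :* c′ :=
              :1 :* (:3 :* c :- (s :- (c₄ :* x :+ c₅ :* y))) :+ :-1 :* (:3 :* c′ :- (s :- (c₄ :* x′ :+ c₅ :* y′)))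
              :+ (x′ :- x) :* (c₄ :- :0) :+ (y′ :- y) :* (c₅ :- :0)) refl c c′ s x y x′ y′ c₄ c₅)
            e e′ z₄ z₅)
          eX : c₁ ⊛ x₁ ⊕ c₂ ⊛ x₂ ⊕ c₃ ⊛ x₃ ⊕ c₄ ⊛ 2F ⊕ c₅ ⊛ ⟨ Y , X ⟩ ≡ 0F
          eX = pair X (flip {X} {A} XA) (flip {X} {B} XB) (flip {X} {C} XC) XX refl
          z₁ : c₁ ≡ 0F
          z₁ = cancel-* σ≢0 (comb₅ 1F (-F x₂) (-F x₃) (ι -[1+ 1 ]) (-F ⟨ Y , X ⟩)
            (solve 9 (λ c₁ c₂ c₃ c₄ c₅ x₁ x₂ x₃ g → (x₁ :+ x₂ :+ x₃) :* c₁ :- :0 :=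
              :1 :* (c₁ :* x₁ :+ c₂ :* x₂ :+ c₃ :* x₃ :+ c₄ :* :2 :+ c₅ :* g :- :0)
              :+ (:- x₂) :* (c₂ :- c₁) :+ (:- x₃) :* (c₃ :- c₁) :+ :-2 :* (c₄ :- :0) :+ (:- g) :* (c₅ :- :0))
              refl c₁ c₂ c₃ c₄ c₅ x₁ x₂ x₃ ⟨ Y , X ⟩) eX (c-equal B-value A-value) (c-equal C-value A-value) z₄ z₅)

      -- A member that does not annihilate A + B + C completes the triple to a basis, and nothing of
      -- nonzero norm is orthogonal to a basis.
      no-orthogonal : ∀ {x₁ x₂ x₃} → ⟨ X , A ⟩ ≡ x₁ → ⟨ X , B ⟩ ≡ x₂ → ⟨ X , C ⟩ ≡ x₃ → x₁ ⊕ x₂ ⊕ x₃ ≢ 0F → ⟨ X , X ⟩ ≡ 2F →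
        ⟨ Y , A ⟩ ≡ 0F → ⟨ Y , B ⟩ ≡ 0F → ⟨ Y , C ⟩ ≡ 0F → ⟨ Y , X ⟩ ≡ 0F → ⟨ Y , Y ⟩ ≢ 0F → ⊥
      no-orthogonal {x₁} {x₂} {x₃} XA XB XC σ≢0 XX YA YB YC YX YY = nontrivial (vanishing σ≢0 z₄ z₅ XX)
        where
        open Coefficients XA XB XC YA YB YC
        z₄ : c₄ ≡ 0F
        z₄ = cancel-* σ≢0 (comb₁ 1F (solve 5 (λ c₄ c₅ x₁ x₂ x₃ → (x₁ :+ x₂ :+ x₃) :* c₄ :- :0 :=
          :1 :* (c₄ :* (x₁ :+ x₂ :+ x₃) :+ c₅ :* (:0 :+ :0 :+ :0) :- :0)) refl c₄ c₅ x₁ x₂ x₃) sum-relation)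
        z₅ : c₅ ≡ 0F
        z₅ = cancel-* YY (comb₁ 1F (solve 6 (λ c₁ c₂ c₃ c₄ c₅ g → g :* c₅ :- :0 :=
          :1 :* (c₁ :* :0 :+ c₂ :* :0 :+ c₃ :* :0 :+ c₄ :* :0 :+ c₅ :* g :- :0)) refl c₁ c₂ c₃ c₄ c₅ ⟨ Y , Y ⟩)
          (pair Y (flip {Y} {A} YA) (flip {Y} {B} YB) (flip {Y} {C} YC) (flip {Y} {X} YX) refl))

      private
        -- Three times the pairing with X, after substituting the values of 3c₁, 3c₂, 3c₃. Only
        -- their sum survives, since the squares of the xᵢ add up to 3.
        double-count : ∀ {c₁ c₂ c₃ c₄ c₅ x₁ x₂ x₃ y₁ y₂ y₃ g} →
          c₁ ⊛ x₁ ⊕ c₂ ⊛ x₂ ⊕ c₃ ⊛ x₃ ⊕ c₄ ⊛ 2F ⊕ c₅ ⊛ g ≡ 0F →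
          3F ⊛ c₁ ≡ c₁ ⊕ c₂ ⊕ c₃ ⊖ (c₄ ⊛ x₁ ⊕ c₅ ⊛ y₁) →
          3F ⊛ c₂ ≡ c₁ ⊕ c₂ ⊕ c₃ ⊖ (c₄ ⊛ x₂ ⊕ c₅ ⊛ y₂) →
          3F ⊛ c₃ ≡ c₁ ⊕ c₂ ⊕ c₃ ⊖ (c₄ ⊛ x₃ ⊕ c₅ ⊛ y₃) →
          x₁ ⊛ x₁ ⊕ x₂ ⊛ x₂ ⊕ x₃ ⊛ x₃ ≡ 3F →
          (c₁ ⊕ c₂ ⊕ c₃) ⊛ (x₁ ⊕ x₂ ⊕ x₃) ⊕ 3F ⊛ c₄ ⊕ (3F ⊛ g ⊖ (x₁ ⊛ y₁ ⊕ x₂ ⊛ y₂ ⊕ x₃ ⊛ y₃)) ⊛ c₅ ≡ 0F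
        double-count {c₁} {c₂} {c₃} {c₄} {c₅} {x₁} {x₂} {x₃} {y₁} {y₂} {y₃} {g} = comb₅ 3F (-F x₁) (-F x₂) (-F x₃) c₄
          (solve 12 (λ c₁ c₂ c₃ c₄ c₅ x₁ x₂ x₃ y₁ y₂ y₃ g →
            (c₁ :+ c₂ :+ c₃) :* (x₁ :+ x₂ :+ x₃) :+ :3 :* c₄ :+ (:3 :* g :- (x₁ :* y₁ :+ x₂ :* y₂ :+ x₃ :* y₃)) :* c₅ :- :0 :=
            :3 :* (c₁ :* x₁ :+ c₂ :* x₂ :+ c₃ :* x₃ :+ c₄ :* :2 :+ c₅ :* g :- :0)
            :+ (:- x₁) :* (:3 :* c₁ :- (c₁ :+ c₂ :+ c₃ :- (c₄ :* x₁ :+ c₅ :* y₁)))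
            :+ (:- x₂) :* (:3 :* c₂ :- (c₁ :+ c₂ :+ c₃ :- (c₄ :* x₂ :+ c₅ :* y₂)))
            :+ (:- x₃) :* (:3 :* c₃ :- (c₁ :+ c₂ :+ c₃ :- (c₄ :* x₃ :+ c₅ :* y₃)))
            :+ c₄ :* (x₁ :* x₁ :+ x₂ :* x₂ :+ x₃ :* x₃ :- :3)) refl c₁ c₂ c₃ c₄ c₅ x₁ x₂ x₃ y₁ y₂ y₃ g)

      -- The dependence relation between A, B, C, X, Y determines ⟨ X , Y ⟩ from the products with A, B, C.
      inner-product : ∀ {x₁ x₂ x₃ y₁ y₂ y₃} →
        ⟨ X , A ⟩ ≡ x₁ → ⟨ X , B ⟩ ≡ x₂ → ⟨ X , C ⟩ ≡ x₃ → ⟨ Y , A ⟩ ≡ y₁ → ⟨ Y , B ⟩ ≡ y₂ → ⟨ Y , C ⟩ ≡ y₃ →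
        ⟨ X , X ⟩ ≡ 2F → ⟨ Y , Y ⟩ ≡ 2F → x₁ ⊛ x₁ ⊕ x₂ ⊛ x₂ ⊕ x₃ ⊛ x₃ ≡ 3F → y₁ ⊛ y₁ ⊕ y₂ ⊛ y₂ ⊕ y₃ ⊛ y₃ ≡ 3F →
        let σ = x₁ ⊕ x₂ ⊕ x₃ ; τ = y₁ ⊕ y₂ ⊕ y₃ in σ ≢ 0F → τ ≢ 0F →
        2F ⊛ (σ ⊛ τ) ⊛ (3F ⊛ ⟨ X , Y ⟩ ⊖ (x₁ ⊛ y₁ ⊕ x₂ ⊛ y₂ ⊕ x₃ ⊛ y₃)) ≡ 3F ⊛ (σ ⊛ σ ⊕ τ ⊛ τ)
      inner-product {x₁} {x₂} {x₃} {y₁} {y₂} {y₃} XA XB XC YA YB YC XX YY Σx Σy σ≢0 τ≢0 = sym (0-diff (cancel-* c₄≢0 final))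
        where
        open Coefficients XA XB XC YA YB YC
        σ τ e g : Fin q
        σ = x₁ ⊕ x₂ ⊕ x₃
        τ = y₁ ⊕ y₂ ⊕ y₃
        e = x₁ ⊛ y₁ ⊕ x₂ ⊛ y₂ ⊕ x₃ ⊛ y₃
        g = ⟨ X , Y ⟩
        swap-sum : ∀ {s c x c′ y} → 3F ⊛ s ≡ c ⊖ (c₄ ⊛ x ⊕ c₅ ⊛ y) → c ≡ c′ → 3F ⊛ s ≡ c′ ⊖ (c₅ ⊛ y ⊕ c₄ ⊛ x)
        swap-sum p refl = trans p (cong (λ t → _ ⊖ t) (+-comm _ _))
        r₁ : (c₁ ⊕ c₂ ⊕ c₃) ⊛ σ ⊕ 3F ⊛ c₄ ⊕ (3F ⊛ g ⊖ e) ⊛ c₅ ≡ 0F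
        r₁ = double-count (pair X (flip {X} {A} XA) (flip {X} {B} XB) (flip {X} {C} XC) XX (flip {X} {Y} refl)) A-value B-value C-value Σx
        eY : c₁ ⊛ y₁ ⊕ c₂ ⊛ y₂ ⊕ c₃ ⊛ y₃ ⊕ c₅ ⊛ 2F ⊕ c₄ ⊛ g ≡ 0F
        eY = comb₁ 1F (solve 9 (λ c₁ c₂ c₃ c₄ c₅ y₁ y₂ y₃ g → c₁ :* y₁ :+ c₂ :* y₂ :+ c₃ :* y₃ :+ c₅ :* :2 :+ c₄ :* g :- :0 :=
            :1 :* (c₁ :* y₁ :+ c₂ :* y₂ :+ c₃ :* y₃ :+ c₄ :* g :+ c₅ :* :2 :- :0)) refl c₁ c₂ c₃ c₄ c₅ y₁ y₂ y₃ g)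
          (pair Y (flip {Y} {A} YA) (flip {Y} {B} YB) (flip {Y} {C} YC) refl YY)
        r₂ : (c₁ ⊕ c₂ ⊕ c₃) ⊛ τ ⊕ 3F ⊛ c₅ ⊕ (3F ⊛ g ⊖ (y₁ ⊛ x₁ ⊕ y₂ ⊛ x₂ ⊕ y₃ ⊛ x₃)) ⊛ c₄ ≡ 0F
        r₂ = double-count eY (swap-sum A-value refl) (swap-sum B-value refl) (swap-sum C-value refl) Σy
        e′ : y₁ ⊛ x₁ ⊕ y₂ ⊛ x₂ ⊕ y₃ ⊛ x₃ ≡ e
        e′ = cong₂ _⊕_ (cong₂ _⊕_ (*-comm y₁ x₁) (*-comm y₂ x₂)) (*-comm y₃ x₃)
        -- The factors τ² and -στ eliminate s = c₁ + c₂ + c₃ between the two relations, and c₄σ +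
        -- c₅τ = 0 then removes c₅.
        combine : ∀ {s σ τ g e e′} → s ⊛ σ ⊕ 3F ⊛ c₄ ⊕ (3F ⊛ g ⊖ e) ⊛ c₅ ≡ 0F → s ⊛ τ ⊕ 3F ⊛ c₅ ⊕ (3F ⊛ g ⊖ e′) ⊛ c₄ ≡ 0F →
          c₄ ⊛ σ ⊕ c₅ ⊛ τ ≡ 0F → e′ ≡ e →
          c₄ ⊛ (3F ⊛ (σ ⊛ σ ⊕ τ ⊛ τ) ⊖ 2F ⊛ (σ ⊛ τ) ⊛ (3F ⊛ g ⊖ e)) ≡ 0F
        combine {s} {σ} {τ} {g} {e} p r t refl = comb₃ (τ ⊛ τ) (-F (σ ⊛ τ)) (3F ⊛ σ ⊖ τ ⊛ (3F ⊛ g ⊖ e))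
          (solve 7 (λ s σ τ g e c₄ c₅ → c₄ :* (:3 :* (σ :* σ :+ τ :* τ) :- :2 :* (σ :* τ) :* (:3 :* g :- e)) :- :0 :=
            (τ :* τ) :* (s :* σ :+ :3 :* c₄ :+ (:3 :* g :- e) :* c₅ :- :0)
            :+ (:- (σ :* τ)) :* (s :* τ :+ :3 :* c₅ :+ (:3 :* g :- e) :* c₄ :- :0)
            :+ (:3 :* σ :- τ :* (:3 :* g :- e)) :* (c₄ :* σ :+ c₅ :* τ :- :0)) refl s σ τ g e c₄ c₅) p r t
        final : c₄ ⊛ (3F ⊛ (σ ⊛ σ ⊕ τ ⊛ τ) ⊖ 2F ⊛ (σ ⊛ τ) ⊛ (3F ⊛ g ⊖ e)) ≡ 0F
        final = combine r₁ r₂ sum-relation e′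
        c₄≢0 : c₄ ≢ 0F
        c₄≢0 z = nontrivial (vanishing σ≢0 z (cancel-* τ≢0 (comb₂ 1F (-F σ)
          (solve 4 (λ c₄ c₅ σ τ → τ :* c₅ :- :0 := :1 :* (c₄ :* σ :+ c₅ :* τ :- :0) :+ (:- σ) :* (c₄ :- :0)) refl c₄ c₅ σ τ)
          sum-relation z)) XX)

    module Commutator {A B : Mat q} (T : Triple 1F I A B) where
      open Triple T using () renaming (AB to IA; AC to IB; BB to AA; CC to BB; BC to AB)

      -- The commutator serves as a cross product: it is orthogonal to I, A and B, and its norm is
      -- the Gram determinant of these three.
      N : Mat q
      N = A · B +M -1F • B · A

      private
        norm : ∀ A B → let g = ⟨ A , B ⟩ ; t = ⟨ I , A ⟩ ; s = ⟨ I , B ⟩ ; N = A · B +M -1F • B · A in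
          ⟨ N , N ⟩ ≡ 2F ⊛ (⟨ A , A ⟩ ⊛ ⟨ B , B ⟩ ⊖ g ⊛ g ⊕ g ⊛ t ⊛ s) ⊖ t ⊛ t ⊛ ⟨ B , B ⟩ ⊖ s ⊛ s ⊛ ⟨ A , A ⟩
        norm (mat a b c d) (mat a′ b′ c′ d′) = solve 8 (λ a b c d a′ b′ c′ d′ →
          let x = (a :* a′ :+ b :* c′) :+ :-1 :* (a′ :* a :+ b′ :* c)
              y = (a :* b′ :+ b :* d′) :+ :-1 :* (a′ :* b :+ b′ :* d)
              z = (c :* a′ :+ d :* c′) :+ :-1 :* (c′ :* a :+ d′ :* c)
              w = (c :* b′ :+ d :* d′) :+ :-1 :* (c′ :* b :+ d′ :* d)
              g = a :* d′ :+ d :* a′ :- b :* c′ :- c :* b′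
              t = :1 :* d :+ :1 :* a :- :0 :* c :- :0 :* b
              s = :1 :* d′ :+ :1 :* a′ :- :0 :* c′ :- :0 :* b′
              aa = a :* d :+ d :* a :- b :* c :- c :* b
              bb = a′ :* d′ :+ d′ :* a′ :- b′ :* c′ :- c′ :* b′
          in x :* w :+ w :* x :- y :* z :- z :* y := :2 :* (aa :* bb :- g :* g :+ g :* t :* s) :- t :* t :* bb :- s :* s :* aa)
          refl a b c d a′ b′ c′ d′

        orthogonal-I : ∀ A B → ⟨ A · B +M -1F • B · A , I ⟩ ≡ 0F
        orthogonal-I (mat a b c d) (mat a′ b′ c′ d′) = solve 8 (λ a b c d a′ b′ c′ d′ →
          let x = (a :* a′ :+ b :* c′) :+ :-1 :* (a′ :* a :+ b′ :* c)
              y = (a :* b′ :+ b :* d′) :+ :-1 :* (a′ :* b :+ b′ :* d)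
              z = (c :* a′ :+ d :* c′) :+ :-1 :* (c′ :* a :+ d′ :* c)
              w = (c :* b′ :+ d :* d′) :+ :-1 :* (c′ :* b :+ d′ :* d)
          in x :* :1 :+ w :* :1 :- y :* :0 :- z :* :0 := :0) refl a b c d a′ b′ c′ d′

        orthogonal-A : ∀ A B → ⟨ A · B +M -1F • B · A , A ⟩ ≡ 0F
        orthogonal-A (mat a b c d) (mat a′ b′ c′ d′) = solve 8 (λ a b c d a′ b′ c′ d′ →
          let x = (a :* a′ :+ b :* c′) :+ :-1 :* (a′ :* a :+ b′ :* c)
              y = (a :* b′ :+ b :* d′) :+ :-1 :* (a′ :* b :+ b′ :* d)
              z = (c :* a′ :+ d :* c′) :+ :-1 :* (c′ :* a :+ d′ :* c)
              w = (c :* b′ :+ d :* d′) :+ :-1 :* (c′ :* b :+ d′ :* d)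
          in x :* d :+ w :* a :- y :* c :- z :* b := :0) refl a b c d a′ b′ c′ d′

        orthogonal-B : ∀ A B → ⟨ A · B +M -1F • B · A , B ⟩ ≡ 0F
        orthogonal-B (mat a b c d) (mat a′ b′ c′ d′) = solve 8 (λ a b c d a′ b′ c′ d′ →
          let x = (a :* a′ :+ b :* c′) :+ :-1 :* (a′ :* a :+ b′ :* c)
              y = (a :* b′ :+ b :* d′) :+ :-1 :* (a′ :* b :+ b′ :* d)
              z = (c :* a′ :+ d :* c′) :+ :-1 :* (c′ :* a :+ d′ :* c)
              w = (c :* b′ :+ d :* d′) :+ :-1 :* (c′ :* b :+ d′ :* d)
          in x :* d′ :+ w :* a′ :- y :* c′ :- z :* b′ := :0) refl a b c d a′ b′ c′ d′

      NN : ⟨ N , N ⟩ ≡ ι (+ 4)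
      NN = trans (norm A B) (numbers AA BB AB IA IB)
        where
        numbers : ∀ {aa bb g t s} → aa ≡ 2F → bb ≡ 2F → g ≡ 1F → t ≡ 1F → s ≡ 1F →
          2F ⊛ (aa ⊛ bb ⊖ g ⊛ g ⊕ g ⊛ t ⊛ s) ⊖ t ⊛ t ⊛ bb ⊖ s ⊛ s ⊛ aa ≡ ι (+ 4)
        numbers refl refl refl refl refl = solve 0 (:2 :* (:2 :* :2 :- :1 :* :1 :+ :1 :* :1 :* :1)
          :- :1 :* :1 :* :2 :- :1 :* :1 :* :2 := :4) refl

      -- In the basis I, A, B, N one has 4C = I + A + B + mN with m = ⟨ C , N ⟩. Taking norms gives
      -- 32 = 12 + 4m².
      five-square : ∀ {C} → ⟨ C , I ⟩ ≡ 1F → ⟨ C , A ⟩ ≡ 1F → ⟨ C , B ⟩ ≡ 1F → ⟨ C , C ⟩ ≡ 2F → IsSquare (ι (+ 5))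
      five-square {C} CI CA CB CC = m , sym (0-diff (cancel-* c₄≢0 combined))
        where
        open PlusTriple {X = C} {Y = N} T
        D = dependent I A B C N
        open Dependent D
        m : Fin q
        m = ⟨ C , N ⟩
        r = relations D CI CA CB (orthogonal-I A B) (orthogonal-A A B) (orthogonal-B A B)
        eN : c₁ ⊛ 0F ⊕ c₂ ⊛ 0F ⊕ c₃ ⊛ 0F ⊕ c₄ ⊛ m ⊕ c₅ ⊛ ι (+ 4) ≡ 0F
        eN = pair N (flip {N} {I} (orthogonal-I A B)) (flip {N} {A} (orthogonal-A A B)) (flip {N} {B} (orthogonal-B A B)) refl NN
        eC : c₁ ⊛ 1F ⊕ c₂ ⊛ 1F ⊕ c₃ ⊛ 1F ⊕ c₄ ⊛ 2F ⊕ c₅ ⊛ m ≡ 0F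
        eC = pair C (flip {C} {I} CI) (flip {C} {A} CA) (flip {C} {B} CB) CC (flip {C} {N} refl)
        combined : c₄ ⊛ (ι (+ 5) ⊖ m ⊛ m) ≡ 0F
        combined = comb₅ (ι (+ 4)) (-F m) (ι -[1+ 2 ]) (ι -[1+ 3 ]) (ι -[1+ 3 ])
          (solve 6 (λ c₁ c₂ c₃ c₄ c₅ m → c₄ :* (:5 :- m :* m) :- :0 :=
            :4 :* (c₁ :* :1 :+ c₂ :* :1 :+ c₃ :* :1 :+ c₄ :* :2 :+ c₅ :* m :- :0)
            :+ (:- m) :* (c₁ :* :0 :+ c₂ :* :0 :+ c₃ :* :0 :+ c₄ :* m :+ c₅ :* :4 :- :0)
            :+ :-3 :* (:4 :* c₁ :- (:- (c₄ :* :1 :+ c₅ :* :0)))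
            :+ :-4 :* (c₂ :- c₁) :+ :-4 :* (c₃ :- c₁)) refl c₁ c₂ c₃ c₄ c₅ m)
          eC eN (proj₁ r) (proj₁ (proj₂ r)) (proj₂ (proj₂ r))
        c₄≢0 : c₄ ≢ 0F
        c₄≢0 z = nontrivial (vanishing r z (cancel-* 4≢0 (comb₂ 1F (-F m)
          (solve 6 (λ c₁ c₂ c₃ c₄ c₅ m → :4 :* c₅ :- :0 :=
            :1 :* (c₁ :* :0 :+ c₂ :* :0 :+ c₃ :* :0 :+ c₄ :* m :+ c₅ :* :4 :- :0) :+ (:- m) :* (c₄ :- :0))
            refl c₁ c₂ c₃ c₄ c₅ m) eN z)))

      -- The complement of the triple is the line of N, and N has norm 4; so the only isotropic
      -- vector in it is 0.
      isotropic-complement : ∀ {U} → ⟨ U , I ⟩ ≡ 0F → ⟨ U , A ⟩ ≡ 0F → ⟨ U , B ⟩ ≡ 0F → ⟨ U , U ⟩ ≡ 0F → ∀ Z → ⟨ U , Z ⟩ ≡ 0F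
      isotropic-complement {U} UI UA UB UU Z = cancel-* c₅≢0 (last (vanishing′ c₄≡0) c₄≡0)
        where
        open PlusTriple {X = N} {Y = U} T
        D = dependent I A B N U
        open Dependent D
        m : Fin q
        m = ⟨ N , U ⟩
        r = relations D (orthogonal-I A B) (orthogonal-A A B) (orthogonal-B A B) UI UA UB
        eN : c₁ ⊛ 0F ⊕ c₂ ⊛ 0F ⊕ c₃ ⊛ 0F ⊕ c₄ ⊛ ι (+ 4) ⊕ c₅ ⊛ m ≡ 0F
        eN = pair N (flip {N} {I} (orthogonal-I A B)) (flip {N} {A} (orthogonal-A A B)) (flip {N} {B} (orthogonal-B A B)) NN (flip {N} {U} refl)
        eU : c₁ ⊛ 0F ⊕ c₂ ⊛ 0F ⊕ c₃ ⊛ 0F ⊕ c₄ ⊛ m ⊕ c₅ ⊛ 0F ≡ 0F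
        eU = pair U (flip {U} {I} UI) (flip {U} {A} UA) (flip {U} {B} UB) refl UU
        c₄≡0 : c₄ ≡ 0F
        c₄≡0 = square-0 (cancel-* 4≢0 (comb₂ c₄ (-F c₅)
          (solve 6 (λ c₁ c₂ c₃ c₄ c₅ m → :4 :* (c₄ :* c₄) :- :0 :=
            c₄ :* (c₁ :* :0 :+ c₂ :* :0 :+ c₃ :* :0 :+ c₄ :* :4 :+ c₅ :* m :- :0)
            :+ (:- c₅) :* (c₁ :* :0 :+ c₂ :* :0 :+ c₃ :* :0 :+ c₄ :* m :+ c₅ :* :0 :- :0))
            refl c₁ c₂ c₃ c₄ c₅ m) eN eU))
        c₅≢0 : c₅ ≢ 0F
        c₅≢0 z = nontrivial (vanishing r c₄≡0 z)
        vanishing′ : c₄ ≡ 0F → c₁ ≡ 0F × c₂ ≡ 0F × c₃ ≡ 0F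
        vanishing′ z = z₁ , trans (proj₁ (proj₂ r)) z₁ , trans (proj₂ (proj₂ r)) z₁
          where
          z₁ : c₁ ≡ 0F
          z₁ = cancel-* 4≢0 (trans (proj₁ r) (trans (cong (λ t → -F (t ⊛ 0F ⊕ c₅ ⊛ 0F)) z)
            (solve 1 (λ c → :- (:0 :* :0 :+ c :* :0) := :0) refl c₅)))
        last : c₁ ≡ 0F × c₂ ≡ 0F × c₃ ≡ 0F → c₄ ≡ 0F → c₅ ⊛ ⟨ U , Z ⟩ ≡ 0F
        last (z₁ , z₂ , z₃) z₄ = comb₅ 1F (-F x₁) (-F x₂) (-F x₃) (-F x₄)
          (solve 10 (λ c₁ c₂ c₃ c₄ c₅ x₁ x₂ x₃ x₄ x₅ → c₅ :* x₅ :- :0 :=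
            :1 :* (c₁ :* x₁ :+ c₂ :* x₂ :+ c₃ :* x₃ :+ c₄ :* x₄ :+ c₅ :* x₅ :- :0)
            :+ (:- x₁) :* (c₁ :- :0) :+ (:- x₂) :* (c₂ :- :0) :+ (:- x₃) :* (c₃ :- :0) :+ (:- x₄) :* (c₄ :- :0))
            refl c₁ c₂ c₃ c₄ c₅ x₁ x₂ x₃ x₄ ⟨ U , Z ⟩)
          (pair Z refl refl refl refl refl) z₁ z₂ z₃ z₄
          where
          x₁ x₂ x₃ x₄ : Fin q
          x₁ = ⟨ I , Z ⟩
          x₂ = ⟨ A , Z ⟩
          x₃ = ⟨ B , Z ⟩
          x₄ = ⟨ N , Z ⟩

  -- Cliques of unimodular matrices and the signs of their triangles

  Sgn : Fin q → Set
  Sgn g = ∃[ s ] g ≡ ι (value s)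

  sgn-square : ∀ {g} → Sgn g → g ⊛ g ≡ 1F
  sgn-square (Sign.+ , refl) = *-identityˡ 1F
  sgn-square (Sign.- , refl) = solve 0 (:-1 :* :-1 := :1) refl

  sgn-* : ∀ {g h} → Sgn g → Sgn h → Sgn (g ⊛ h)
  sgn-* (Sign.+ , refl) (s , refl) = s , *-identityˡ _
  sgn-* (Sign.- , refl) (Sign.+ , refl) = Sign.- , *-identityʳ _
  sgn-* (Sign.- , refl) (Sign.- , refl) = Sign.+ , solve 0 (:-1 :* :-1 := :1) refl

  _~_ : Mat q → Mat q → Set
  X ~ Y = Sgn ⟨ X , Y ⟩

  ~-sym : ∀ {X Y} → X ~ Y → Y ~ X
  ~-sym {X} {Y} (s , e) = s , trans (⟨⟩-sym Y X) e

  Unimodular : Mat q → Set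
  Unimodular X = det X ≡ 1F

  norm-2 : ∀ {X} → Unimodular X → ⟨ X , X ⟩ ≡ 2F
  norm-2 {X} e = trans (⟨⟩-self X) (trans (cong (2F ⊛_) e) (*-identityʳ 2F))

  Clique : List (Mat q) → Set
  Clique xs = All Unimodular xs × AllPairs _~_ xs

  AllPairs-↭ : ∀ {R : Mat q → Mat q → Set} → (∀ {x y} → R x y → R y x) → ∀ {xs ys} → xs ↭ ys → AllPairs R xs → AllPairs R ys
  AllPairs-↭ {R} sy p = Setoid↭.AllPairs-resp-↭ sy ((λ { refl r → r }) , (λ { refl r → r })) (↭⇒↭ₛ p)
    where
    import Data.List.Relation.Binary.Permutation.Setoid.Properties as S
    module Setoid↭ = S (Relation.Binary.PropositionalEquality.setoid (Mat q))
    open import Data.List.Relation.Binary.Permutation.Propositional using (↭⇒↭ₛ)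

  Clique-↭ : ∀ {xs ys} → xs ↭ ys → Clique xs → Clique ys
  Clique-↭ p (u , a) = All-resp-↭ p u , AllPairs-↭ (λ {X} {Y} → ~-sym {X} {Y}) p a

  -- Each matrix occurs twice, so the value does not depend on the signs of the representatives; it
  -- makes the clique a two-graph.
  triangle : Mat q → Mat q → Mat q → Fin q
  triangle X Y Z = ⟨ X , Y ⟩ ⊛ ⟨ X , Z ⟩ ⊛ ⟨ Y , Z ⟩

  triangle-sgn : ∀ {X Y Z} → X ~ Y → X ~ Z → Y ~ Z → Sgn (triangle X Y Z)
  triangle-sgn a b c = sgn-* (sgn-* a b) c

  data Split (σ : Sign) (X : Mat q) (L : List (Mat q)) : Set where
    none : AllPairs (λ Y Z → triangle X Y Z ≡ ι (value (opposite σ))) L → Split σ X L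
    found : ∀ {Y Z L′} → L ↭ Y ∷ Z ∷ L′ → triangle X Y Z ≡ ι (value σ) → Split σ X L

  split : ∀ σ {X L} → All (X ~_) L → AllPairs _~_ L → Split σ X L
  split σ {X} {[]} _ _ = none []
  split σ {X} {Y ∷ L} (xy ∷ xs) (ys ∷ ps) = merge (scan xs ys) (split σ xs ps)
    where
    compare : ∀ {g} → Sgn g → g ≡ ι (value (opposite σ)) ⊎ g ≡ ι (value σ)
    compare = dichotomy σ
      where
      dichotomy : ∀ σ {g} → Sgn g → g ≡ ι (value (opposite σ)) ⊎ g ≡ ι (value σ)
      dichotomy Sign.+ (Sign.+ , e) = inj₂ e
      dichotomy Sign.+ (Sign.- , e) = inj₁ e
      dichotomy Sign.- (Sign.+ , e) = inj₁ e
      dichotomy Sign.- (Sign.- , e) = inj₂ e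
    scan : ∀ {L} → All (X ~_) L → All (Y ~_) L → All (λ Z → triangle X Y Z ≡ ι (value (opposite σ))) L ⊎ (∃[ Z ] ∃[ L′ ] (L ↭ Z ∷ L′ × triangle X Y Z ≡ ι (value σ)))
    scan [] [] = inj₁ []
    scan {Z ∷ L} (xz ∷ xs) (yz ∷ ys) with compare (triangle-sgn {X} {Y} {Z} xy xz yz) | scan xs ys
    ... | inj₂ e | _ = inj₂ (Z , L , ↭-refl , e)
    ... | inj₁ e | inj₁ es = inj₁ (e ∷ es)
    ... | inj₁ e | inj₂ (W , L′ , p , e′) = inj₂ (W , Z ∷ L′ , ↭-trans (prep Z p) (swap Z W ↭-refl) , e′)
    merge : All (λ Z → triangle X Y Z ≡ ι (value (opposite σ))) L ⊎ (∃[ Z ] ∃[ L′ ] (L ↭ Z ∷ L′ × triangle X Y Z ≡ ι (value σ))) →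
      Split σ X L → Split σ X (Y ∷ L)
    merge (inj₂ (Z , L′ , p , e)) _ = found (prep Y p) e
    merge (inj₁ es) (none r) = none (es ∷ r)
    merge (inj₁ es) (found {Z} {W} {L′} p e) = found (↭-trans (prep Y p) (↭-trans (swap Y Z ↭-refl) (prep Z (swap Y W ↭-refl)))) e

  module _ {X Y Z : Mat q} (s t : Fin q) where
    triple : Unimodular X → Unimodular Y → Unimodular Z → s ⊛ s ≡ 1F → t ⊛ t ≡ 1F →
      ∀ {g} → s ⊛ ⟨ X , Y ⟩ ≡ g → t ⊛ ⟨ X , Z ⟩ ≡ g → (s ⊛ t) ⊛ ⟨ Y , Z ⟩ ≡ g → Triple g X (s • Y) (t • Z)
    triple uX uY uZ ss tt eY eZ eYZ = record
      { AA = norm-2 uX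
      ; BB = norm-2 (unit ss uY)
      ; CC = norm-2 (unit tt uZ)
      ; AB = trans (⟨⟩-•ʳ s X Y) eY
      ; AC = trans (⟨⟩-•ʳ t X Z) eZ
      ; BC = trans (⟨⟩-•ˡ s Y (t • Z)) (trans (cong (s ⊛_) (⟨⟩-•ʳ t Y Z)) (trans (sym (*-assoc s t _)) eYZ)) }
      where
      unit : ∀ {r W} → r ⊛ r ≡ 1F → Unimodular W → Unimodular (r • W)
      unit {r} {W} rr u = trans (det-• r W) (trans (cong₂ _⊛_ rr u) (*-identityˡ 1F))

  -- Scaling Y and Z by their pairings with X turns both pairings into 1 and the third one into the
  -- triangle.
  plus-triple : ∀ {X Y Z} → Unimodular X → Unimodular Y → Unimodular Z → X ~ Y → X ~ Z → triangle X Y Z ≡ 1F →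
    Triple 1F X (⟨ X , Y ⟩ • Y) (⟨ X , Z ⟩ • Z)
  plus-triple uX uY uZ xy xz e = triple _ _ uX uY uZ (sgn-square xy) (sgn-square xz) (sgn-square xy) (sgn-square xz) e

  minus-triple : ∀ {X Y Z} → Unimodular X → Unimodular Y → Unimodular Z → X ~ Y → X ~ Z → triangle X Y Z ≡ -1F →
    Triple -1F X ((-F ⟨ X , Y ⟩) • Y) ((-F ⟨ X , Z ⟩) • Z)
  minus-triple {X} {Y} {Z} uX uY uZ xy xz e = triple _ _ uX uY uZ (neg-sq xy) (neg-sq xz) (neg xy) (neg xz)
      (trans (cong (_⊛ ⟨ Y , Z ⟩) (solve 2 (λ s t → (:- s) :* (:- t) := s :* t) refl ⟨ X , Y ⟩ ⟨ X , Z ⟩)) e)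
    where
    neg : ∀ {g} → Sgn g → (-F g) ⊛ g ≡ -1F
    neg {g} s = trans (solve 1 (λ g → (:- g) :* g := :-1 :* (g :* g)) refl g) (trans (cong (-1F ⊛_) (sgn-square s)) (*-identityʳ -1F))
    neg-sq : ∀ {g} → Sgn g → (-F g) ⊛ (-F g) ≡ 1F
    neg-sq {g} s = trans (solve 1 (λ g → (:- g) :* (:- g) := g :* g) refl g) (sgn-square s)

  sgn-neg : ∀ {g} → Sgn g → Sgn (-F g)
  sgn-neg (Sign.+ , refl) = Sign.- , refl
  sgn-neg (Sign.- , refl) = Sign.+ , -‿involutive _

  ~-• : ∀ {X Y s} → Sgn s → X ~ Y → X ~ (s • Y)
  ~-• {X} {Y} {s} r p = subst Sgn (sym (⟨⟩-•ʳ s X Y)) (sgn-* r p)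

  ⟂-• : ∀ {X Y} s → ⟨ X , Y ⟩ ≡ 0F → ⟨ X , s • Y ⟩ ≡ 0F
  ⟂-• {X} {Y} s e = trans (⟨⟩-•ʳ s X Y) (trans (cong (s ⊛_) e) (zeroʳ s))

  infixl 6 _+ʰ_ _-ʰ_
  infixl 7 _*ʰ_
  -- Keeps an integer beside the field element it represents, so that `discrepancy` is evaluated
  -- over ℤ and its vanishing is read in the field.
  record Denotes (i : ℤ) (x : Fin q) : Set where
    constructor denotes
    field equality : ι i ≡ x

  _+ʰ_ : ∀ {i j x y} → Denotes i x → Denotes j y → Denotes (i ℤ.+ j) (x ⊕ y)
  _+ʰ_ {i} {j} (denotes e) (denotes f) = denotes (trans (ι-+ i j) (cong₂ _⊕_ e f))
  _*ʰ_ : ∀ {i j x y} → Denotes i x → Denotes j y → Denotes (i ℤ.* j) (x ⊛ y)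
  _*ʰ_ {i} {j} (denotes e) (denotes f) = denotes (trans (ι-* i j) (cong₂ _⊛_ e f))
  _-ʰ_ : ∀ {i j x y} → Denotes i x → Denotes j y → Denotes (i ℤ.- j) (x ⊖ y)
  _-ʰ_ {i} {j} (denotes e) (denotes f) = denotes (trans (ι-+ i (ℤ.- j)) (cong₂ _⊕_ e (trans (ι-neg j) (cong -F_ f))))
  numeralʰ : ∀ i → Denotes i (ι i)
  numeralʰ i = denotes refl
  sgnʰ : ∀ {g} (s : Sgn g) → Denotes (value (proj₁ s)) g
  sgnʰ (s , e) = denotes (sym e)

  ι-∣∣ : ∀ i → ι i ≡ 0F → ι (+ ℤ.∣ i ∣) ≡ 0F
  ι-∣∣ (+ n) e = e
  ι-∣∣ -[1+ n ] e = trans (sym (-‿involutive _)) (trans (cong -F_ e) -0#≈0#)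

  ι-∣ : ∀ {m n} → m ℕ.∣ n → ι (+ m) ≡ 0F → ι (+ n) ≡ 0F
  ι-∣ {m} (ℕ.divides k refl) e = trans (cong ι (ℤ.pos-* k m)) (trans (ι-* (+ k) (+ m)) (trans (cong (ι (+ k) ⊛_) e) (zeroʳ _)))

  -- Members beside a triple with pairings -1

  module LargeCharacteristic (2≢0 : 2F ≢ 0F) (3≢0 : 3F ≢ 0F) where

    162≢0 : ι (+ 162) ≢ 0F
    162≢0 = numeral-* 2 81 2≢0 (numeral-* 9 9 9≢0 9≢0)
      where
      9≢0 : ι (+ 9) ≢ 0F
      9≢0 = numeral-* 3 3 3≢0 3≢0

    total-≢0 : ∀ x → ι (total x) ≢ 0F
    total-≢0 x e with total-values x
    ... | inj₁ r = 1≢0 (subst (λ n → ι (+ n) ≡ 0F) r (ι-∣∣ (total x) e))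
    ... | inj₂ r = 3≢0 (subst (λ n → ι (+ n) ≡ 0F) r (ι-∣∣ (total x) e))

    record Against (A B C X : Mat q) : Set where
      field
        unimodular : Unimodular X
        A~ : X ~ A
        B~ : X ~ B
        C~ : X ~ C
      signs : Signs
      signs = proj₁ A~ , proj₁ B~ , proj₁ C~

    module _ {A B C : Mat q} (T : Triple -1F A B C) where
      open Against

      totalʰ : ∀ {X} (x : Against A B C X) → Denotes (total (signs x)) (⟨ X , A ⟩ ⊕ ⟨ X , B ⟩ ⊕ ⟨ X , C ⟩)
      totalʰ x = sgnʰ (A~ x) +ʰ sgnʰ (B~ x) +ʰ sgnʰ (C~ x)

      dotʰ : ∀ {X Y} (x : Against A B C X) (y : Against A B C Y) → Denotes (dot (signs x) (signs y))
        (⟨ X , A ⟩ ⊛ ⟨ Y , A ⟩ ⊕ ⟨ X , B ⟩ ⊛ ⟨ Y , B ⟩ ⊕ ⟨ X , C ⟩ ⊛ ⟨ Y , C ⟩)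
      dotʰ x y = sgnʰ (A~ x) *ʰ sgnʰ (A~ y) +ʰ sgnʰ (B~ x) *ʰ sgnʰ (B~ y) +ʰ sgnʰ (C~ x) *ʰ sgnʰ (C~ y)

      sum-≢0 : ∀ {X} → Against A B C X → ⟨ X , A ⟩ ⊕ ⟨ X , B ⟩ ⊕ ⟨ X , C ⟩ ≢ 0F
      sum-≢0 x e = total-≢0 (signs x) (trans (Denotes.equality (totalʰ x)) e)

      squares : ∀ {X} → Against A B C X → ⟨ X , A ⟩ ⊛ ⟨ X , A ⟩ ⊕ ⟨ X , B ⟩ ⊛ ⟨ X , B ⟩ ⊕ ⟨ X , C ⟩ ⊛ ⟨ X , C ⟩ ≡ 3F
      squares x = trans (cong₂ _⊕_ (cong₂ _⊕_ (sgn-square (A~ x)) (sgn-square (B~ x))) (sgn-square (C~ x)))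
        (solve 0 (:1 :+ :1 :+ :1 := :3) refl)

      discrepancy-0 : ∀ {X Y} (x : Against A B C X) (y : Against A B C Y) (g : X ~ Y) →
        ι (discrepancy (signs x) (signs y) (proj₁ g)) ≡ 0F
      discrepancy-0 {X} {Y} x y g = trans
        (Denotes.equality (numeralʰ (+ 2) *ʰ (totalʰ x *ʰ totalʰ y) *ʰ (numeralʰ (+ 3) *ʰ sgnʰ g -ʰ dotʰ x y)
          -ʰ numeralʰ (+ 3) *ʰ (totalʰ x *ʰ totalʰ x +ʰ totalʰ y *ʰ totalʰ y)))
        (diff-0 (MinusTriple.inner-product 2≢0 3≢0 T refl refl refl refl refl refl
          (norm-2 (unimodular x)) (norm-2 (unimodular y)) (squares x) (squares y) (sum-≢0 x) (sum-≢0 y)))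

      -- By `inner-product` the discrepancy vanishes in the field. Among its possible values only
      -- ±10 can, which forces 5 = 0 and patterns from different nonconstant classes.
      adjacent-classes : ∀ {X Y} (x : Against A B C X) (y : Against A B C Y) → X ~ Y →
        ι (+ 5) ≡ 0F × class (signs x) ≢ class (signs y) × class (signs x) ≢ zero × class (signs y) ≢ zero
      adjacent-classes {X} {Y} x y g = conclude (admissible (signs x) (signs y) (proj₁ g))
        where
        zero-numeral : ι (+ ℤ.∣ discrepancy (signs x) (signs y) (proj₁ g) ∣) ≡ 0F
        zero-numeral = ι-∣∣ (discrepancy (signs x) (signs y) (proj₁ g)) (discrepancy-0 {X} {Y} x y g)
        conclude : Admissible (signs x) (signs y) (proj₁ g) →
          ι (+ 5) ≡ 0F × class (signs x) ≢ class (signs y) × class (signs x) ≢ zero × class (signs y) ≢ zero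
        conclude (inj₁ d) = ⊥-elim (162≢0 (ι-∣ d zero-numeral))
        conclude (inj₂ (e , r)) = cancel-* 2≢0 (trans (sym (ι-* (+ 2) (+ 5))) (trans (cong (λ n → ι (+ n)) (sym e)) zero-numeral)) , r

      -- Four members would need four different nonconstant classes, and there are three.
      no-four : ∀ {X Y Z W} → Against A B C X → Against A B C Y → Against A B C Z → Against A B C W →
        X ~ Y → X ~ Z → X ~ W → Y ~ Z → Y ~ W → Z ~ W → ⊥
      no-four {X} {Y} {Z} {W} x y z w xy xz xw yz yw zw = ℕ.<-irrefl refl (Unique-⊆-length unique (λ _ → ∈-allFin _))
        where
        cl : ∀ {X} → Against A B C X → Fin 4
        cl x = class (signs x)
        rel : ∀ {X Y} (x : Against A B C X) (y : Against A B C Y) → X ~ Y → cl x ≢ cl y × cl x ≢ zero × cl y ≢ zero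
        rel x y g = proj₂ (adjacent-classes x y g)
        unique : Unique (zero ∷ cl x ∷ cl y ∷ cl z ∷ cl w ∷ [])
        unique = ((proj₁ (proj₂ (rel x y xy)) ∘ sym) ∷ (proj₂ (proj₂ (rel x y xy)) ∘ sym) ∷ (proj₂ (proj₂ (rel x z xz)) ∘ sym) ∷ (proj₂ (proj₂ (rel x w xw)) ∘ sym) ∷ [])
          ∷ (proj₁ (rel x y xy) ∷ proj₁ (rel x z xz) ∷ proj₁ (rel x w xw) ∷ [])
          ∷ (proj₁ (rel y z yz) ∷ proj₁ (rel y w yw) ∷ []) ∷ (proj₁ (rel z w zw) ∷ []) ∷ [] ∷ []

  Zero : Mat q → Set
  Zero (mat a b c d) = a ≡ 0F × b ≡ 0F × c ≡ 0F × d ≡ 0F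

  Zero-⟂ : ∀ {N} → Zero N → ∀ W → ⟨ N , W ⟩ ≡ 0F
  Zero-⟂ (refl , refl , refl , refl) (mat a b c d) =
    solve 4 (λ a b c d → :0 :* d :+ :0 :* a :- :0 :* c :- :0 :* b := :0) refl a b c d

  disc : Mat q → Fin q
  disc A = tr A ⊛ tr A ⊖ ι (+ 4) ⊛ det A

  square-ratio : ∀ {y D s} → y ≢ 0F → (y ⊛ y) ⊛ D ≡ s ⊛ s → IsSquare D
  square-ratio {y} {D} {s} y≢0 e = s ⊛ inv y , comb₂ (-F (inv y ⊛ inv y)) ((y ⊛ inv y ⊕ 1F) ⊛ D)
    (solve 4 (λ y D s i → (s :* i) :* (s :* i) :- D := (:- (i :* i)) :* ((y :* y) :* D :- s :* s) :+ ((y :* i :+ :1) :* D) :* (y :* i :- :1)) refl y D s (inv y))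
    e (inv-* y≢0)

  -- A nilpotent N with tr (N · A) = 0 would make ker N an eigenspace of A defined over the field.
  nilpotent-⟂ : ∀ N A → tr N ≡ 0F → det N ≡ 0F → ⟨ N , A ⟩ ≡ 0F → ¬ IsSquare (disc A) → Zero N
  nilpotent-⟂ (mat x y z w) (mat a b c d) h₁ h₂ h₃ nonsquare = x≡0 , y≡0 , z≡0 , w≡0
    where
    y≡0 : y ≡ 0F
    y≡0 with y ≟ 0F
    ... | yes e = e
    -- Modulo the three hypotheses, y² · `disc` A is the square of y(a - d) - 2bx.
    ... | no n = ⊥-elim (nonsquare (square-ratio n (comb₃ (ι (+ 4) ⊛ (a ⊛ b ⊛ y) ⊖ ι (+ 4) ⊛ (b ⊛ b ⊛ x)) (ι (+ 4) ⊛ (b ⊛ b)) (ι -[1+ 3 ] ⊛ (b ⊛ y))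
        (solve 8 (λ x y z w a b c d → (y :* y) :* ((a :+ d) :* (a :+ d) :- :4 :* (a :* d :- b :* c)) :- (y :* (a :- d) :- :2 :* (b :* x)) :* (y :* (a :- d) :- :2 :* (b :* x)) :=
          (:4 :* (a :* b :* y) :- :4 :* (b :* b :* x)) :* (x :+ w :- :0) :+ (:4 :* (b :* b)) :* (x :* w :- y :* z :- :0)
          :+ (:-4 :* (b :* y)) :* (x :* d :+ w :* a :- y :* c :- z :* b :- :0)) refl x y z w a b c d) h₁ h₂ h₃)))
    z≡0 : z ≡ 0F
    z≡0 with z ≟ 0F
    ... | yes e = e
    ... | no n = ⊥-elim (nonsquare (square-ratio n (comb₃ (ι (+ 4) ⊛ (a ⊛ c ⊛ z) ⊖ ι (+ 4) ⊛ (c ⊛ c ⊛ x)) (ι (+ 4) ⊛ (c ⊛ c)) (ι -[1+ 3 ] ⊛ (c ⊛ z))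
        (solve 8 (λ x y z w a b c d → (z :* z) :* ((a :+ d) :* (a :+ d) :- :4 :* (a :* d :- b :* c)) :- (z :* (a :- d) :- :2 :* (c :* x)) :* (z :* (a :- d) :- :2 :* (c :* x)) :=
          (:4 :* (a :* c :* z) :- :4 :* (c :* c :* x)) :* (x :+ w :- :0) :+ (:4 :* (c :* c)) :* (x :* w :- y :* z :- :0)
          :+ (:-4 :* (c :* z)) :* (x :* d :+ w :* a :- y :* c :- z :* b :- :0)) refl x y z w a b c d) h₁ h₂ h₃)))
    x≡0 : x ≡ 0F
    x≡0 = square-0 (comb₃ x -1F (-F z) (solve 4 (λ x y z w → x :* x :- :0 := x :* (x :+ w :- :0) :+ :-1 :* (x :* w :- y :* z :- :0) :+ (:- z) :* (y :- :0)) refl x y z w) h₁ h₂ y≡0)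
    w≡0 : w ≡ 0F
    w≡0 = comb₂ 1F -1F (solve 2 (λ x w → w :- :0 := :1 :* (x :+ w :- :0) :+ :-1 :* (x :- :0)) refl x w) h₁ x≡0

  -- Bounds on cliques outside characteristic 3

  I-unimodular : Unimodular I
  I-unimodular = det-I

  translate : Mat q → List (Mat q) → List (Mat q)
  translate Z = map (Z ·_)

  ⟨⟩-translate : ∀ {Z} → Unimodular Z → ∀ A B → ⟨ Z · A , Z · B ⟩ ≡ ⟨ A , B ⟩
  ⟨⟩-translate {Z} u A B = trans (⟨⟩-·ˡ Z A B) (trans (cong (_⊛ ⟨ A , B ⟩) u) (*-identityˡ _))

  Clique-translate : ∀ {Z xs} → Unimodular Z → Clique xs → Clique (translate Z xs)
  Clique-translate {Z} u (us , ps) =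
    All.map⁺ (All.map (λ {X} e → trans (det-· Z X) (trans (cong₂ _⊛_ u e) (*-identityˡ 1F))) us) ,
    AllPairs.map⁺ (AllPairs.map (λ {X} {Y} → subst Sgn (sym (⟨⟩-translate u X Y))) ps)

  adj-inverse : ∀ {X} → Unimodular X → adj X · X ≡ I
  adj-inverse {X} u = trans (adj-·ˡ X) (trans (cong (_• I) u)
    (mat-cong (*-identityˡ 1F) (*-identityˡ 0F) (*-identityˡ 0F) (*-identityˡ 1F)))

  -- For unimodular X the adjugate is the inverse, so this translation is an isometry; with I as a
  -- member, pairings become traces.
  Clique-at-I : ∀ {X L} → Clique (X ∷ L) → Clique (I ∷ translate (adj X) L)
  Clique-at-I {X} {L} c@(u ∷ us , p ∷ ps) =
    subst (λ A → Clique (A ∷ translate (adj X) L)) (adj-inverse u) (Clique-translate {adj X} (trans (det-adj X) u) c)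

  module _ (2≢0 : 2F ≢ 0F) (3≢0 : 3F ≢ 0F) where
    open LargeCharacteristic 2≢0 3≢0

    record MinusConfiguration (X : Mat q) (L : List (Mat q)) : Set where
      field
        {B₀ C₀} : Mat q
        {rest} : List (Mat q)
        rearranged : L ↭ B₀ ∷ C₀ ∷ rest
        {β γ} : Fin q
        T : Triple -1F X (β • B₀) (γ • C₀)
        against : All (Against X (β • B₀) (γ • C₀)) rest
        rest-adjacent : AllPairs _~_ rest

      length-rest : length L ≡ 2 ℕ.+ length rest
      length-rest = ↭-length rearranged

    minus-configuration : ∀ {X Y Z L L′} → Clique (X ∷ L) → L ↭ Y ∷ Z ∷ L′ → triangle X Y Z ≡ -1F → MinusConfiguration X L
    minus-configuration {X} {Y} {Z} {L} {L′} c p e = build (Clique-↭ (prep X p) c)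
      where
      build : Clique (X ∷ Y ∷ Z ∷ L′) → MinusConfiguration X L
      build (uX ∷ uY ∷ uZ ∷ us , (xy ∷ xz ∷ xs) ∷ (yz ∷ ys) ∷ zs ∷ ps) = record
        { rearranged = p
        ; T = minus-triple uX uY uZ xy xz e
        ; against = zip us xs ys zs
        ; rest-adjacent = ps }
        where
        zip : ∀ {M} → All Unimodular M → All (X ~_) M → All (Y ~_) M → All (Z ~_) M →
          All (Against X ((-F ⟨ X , Y ⟩) • Y) ((-F ⟨ X , Z ⟩) • Z)) M
        zip [] [] [] [] = []
        zip {W ∷ _} (u ∷ us) (x ∷ xs) (y ∷ ys) (z ∷ zs) = record
          { unimodular = u ; A~ = ~-sym {X} {W} x
          ; B~ = ~-• {W} {Y} (sgn-neg xy) (~-sym {Y} {W} y)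
          ; C~ = ~-• {W} {Z} (sgn-neg xz) (~-sym {Z} {W} z) } ∷ zip us xs ys zs

    data Shape (X : Mat q) (L : List (Mat q)) : Set where
      plus : AllPairs (λ Y Z → triangle X Y Z ≡ 1F) L → Shape X L
      minus : MinusConfiguration X L → Shape X L

    shape : ∀ {X L} → Clique (X ∷ L) → Shape X L
    shape c@(u ∷ us , xs ∷ ps) with split Sign.- xs ps
    ... | none r = plus r
    ... | found p e = minus (minus-configuration c p e)

    -- With signs normalised at I all six pairings equal 1, which is the situation of
    -- `Commutator.five-square`.
    four-plus⇒five-square : ∀ {L} → Clique (I ∷ L) → 3 ℕ.≤ length L → AllPairs (λ Y Z → triangle I Y Z ≡ 1F) L → IsSquare (ι (+ 5))
    four-plus⇒five-square {Y ∷ Z ∷ W ∷ _} (uX ∷ uY ∷ uZ ∷ uW ∷ _ , (xy ∷ xz ∷ xw ∷ _) ∷ _) (s≤s (s≤s (s≤s _))) ((yz ∷ yw ∷ _) ∷ (zw ∷ _) ∷ _) =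
      Commutator.five-square 2≢0 (plus-triple uX uY uZ xy xz yz) (Triple.CA YW) (Triple.CB YW) (Triple.CB ZW) (Triple.CC YW)
      where
      YW = plus-triple uX uY uW xy xw yw
      ZW = plus-triple uX uZ uW xz xw zw

    five-plus-impossible : ∀ {X L} → Clique (X ∷ L) → 4 ℕ.≤ length L → AllPairs (λ Y Z → triangle X Y Z ≡ 1F) L → ⊥
    five-plus-impossible {X} {Y ∷ Z ∷ W ∷ V ∷ _} (uX ∷ uY ∷ uZ ∷ uW ∷ uV ∷ _ , (xy ∷ xz ∷ xw ∷ xv ∷ _) ∷ _) (s≤s (s≤s (s≤s (s≤s _))))
      ((yz ∷ yw ∷ yv ∷ _) ∷ (zw ∷ zv ∷ _) ∷ (wv ∷ _) ∷ _) =
      PlusTriple.no-five 2≢0 (plus-triple uX uY uZ xy xz yz) 3≢0 (Triple.CA YW) (Triple.CB YW) (Triple.CB ZW)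
        (Triple.CA YV) (Triple.CB YV) (Triple.CB ZV) (Triple.CC YW) (Triple.CC YV) (Triple.BC WV)
      where
      YW = plus-triple uX uY uW xy xw yw
      ZW = plus-triple uX uZ uW xz xw zw
      YV = plus-triple uX uY uV xy xv yv
      ZV = plus-triple uX uZ uV xz xv zv
      WV = plus-triple uX uW uV xw xv wv

    -- A triangle of sign -1 leaves room for a single further member when 5 is nonzero; without such
    -- a triangle all pairings can be made 1.
    no-five-clique : ι (+ 5) ≢ 0F → ∀ {xs} → Clique xs → ¬ 5 ℕ.≤ length xs
    no-five-clique 5≢0 {X ∷ L} c (s≤s l) with shape c
    ... | plus r = five-plus-impossible c l r
    ... | minus M = absurd (subst (4 ℕ.≤_) (MinusConfiguration.length-rest M) l) (MinusConfiguration.against M) (MinusConfiguration.rest-adjacent M)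
      where
      open MinusConfiguration M using (T; β; γ; B₀; C₀)
      absurd : ∀ {M} → 4 ℕ.≤ 2 ℕ.+ length M → All (Against X (β • B₀) (γ • C₀)) M → AllPairs _~_ M → ⊥
      absurd (s≤s (s≤s (s≤s (s≤s _)))) (x ∷ y ∷ _) ((xy ∷ _) ∷ _) = 5≢0 (proj₁ (adjacent-classes T x y xy))

    -- A triangle of sign -1 admits at most three further members, one for each nonconstant class.
    no-seven-clique : ∀ {xs} → Clique xs → ¬ 7 ℕ.≤ length xs
    no-seven-clique {X ∷ L} c (s≤s l) with shape c
    ... | plus r = five-plus-impossible c (ℕ.≤-trans (s≤s (s≤s (s≤s (s≤s z≤n)))) l) r
    ... | minus M = absurd (subst (6 ℕ.≤_) (MinusConfiguration.length-rest M) l) (MinusConfiguration.against M) (MinusConfiguration.rest-adjacent M)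
      where
      open MinusConfiguration M using (T; β; γ; B₀; C₀)
      absurd : ∀ {M} → 6 ℕ.≤ 2 ℕ.+ length M → All (Against X (β • B₀) (γ • C₀)) M → AllPairs _~_ M → ⊥
      absurd (s≤s (s≤s (s≤s (s≤s (s≤s (s≤s _)))))) (x ∷ y ∷ z ∷ w ∷ _) ((xy ∷ xz ∷ xw ∷ _) ∷ (yz ∷ yw ∷ _) ∷ (zw ∷ _) ∷ _) =
        no-four T x y z w xy xz xw yz yw zw

    minus-⟂ : ∀ {X L Y} (M : MinusConfiguration X L) → 3 ℕ.≤ length L → All (λ Z → ⟨ Z , Y ⟩ ≡ 0F) (X ∷ L) → ⟨ Y , Y ⟩ ≢ 0F → ⊥
    minus-⟂ {X} {L} {Y} M l (x ∷ os) YY = conclude (subst (3 ℕ.≤_) length-rest l) against (All-resp-↭ rearranged os)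
      where
      open MinusConfiguration M
      conclude : ∀ {N} → 3 ℕ.≤ 2 ℕ.+ length N → All (Against X (β • B₀) (γ • C₀)) N → All (λ Z → ⟨ Z , Y ⟩ ≡ 0F) (B₀ ∷ C₀ ∷ N) → ⊥
      conclude (s≤s (s≤s (s≤s _))) (_∷_ {x = W} w _) (oB ∷ oC ∷ oW ∷ _) =
        MinusTriple.no-orthogonal 2≢0 3≢0 T refl refl refl (sum-≢0 T w) (norm-2 (Against.unimodular w))
          (flip {X} x) (⟂-• β (flip {B₀} oB)) (⟂-• γ (flip {C₀} oC)) (flip {W} oW) YY

    -- Five members include a triangle of sign -1, and such a triangle together with any further
    -- member spans the space.
    five-clique-⟂ : ∀ {xs Y} → Clique xs → 5 ℕ.≤ length xs → All (λ Z → ⟨ Z , Y ⟩ ≡ 0F) xs → ⟨ Y , Y ⟩ ≡ 0F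
    five-clique-⟂ {X ∷ L} {Y} c (s≤s l) os with ⟨ Y , Y ⟩ ≟ 0F
    ... | yes e = e
    ... | no YY with shape c
    ...   | plus r = ⊥-elim (five-plus-impossible c l r)
    ...   | minus M = ⊥-elim (minus-⟂ M (ℕ.≤-trans (s≤s (s≤s (s≤s z≤n))) l) os YY)

    -- If there is a triangle of sign -1 the four members span the space. Otherwise the orthogonal
    -- complement is at most a line, too small for two vectors with Gram determinant 3δ².
    four-clique-⟂ : ∀ {xs Y Y′ δ} → Clique xs → 4 ℕ.≤ length xs → δ ≢ 0F →
      All (λ Z → ⟨ Z , Y ⟩ ≡ 0F) xs → All (λ Z → ⟨ Z , Y′ ⟩ ≡ 0F) xs →
      ⟨ Y , Y ⟩ ≡ 2F ⊛ δ → ⟨ Y′ , Y′ ⟩ ≡ 2F ⊛ δ → ∀ {ε} → Sgn ε → ⟨ Y , Y′ ⟩ ≡ ε ⊛ δ → ⊥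
    four-clique-⟂ {X ∷ L} {Y} {Y′} {δ} c (s≤s l) δ≢0 os os′ YY Y′Y′ {ε} sε YY′ with shape c
    ... | minus M = minus-⟂ M l os (λ e → *-≢0 2≢0 δ≢0 (trans (sym YY) e))
    ... | plus r = conclude c l r os os′
      where
      conclude : ∀ {L} → Clique (X ∷ L) → 3 ℕ.≤ length L → AllPairs (λ Y Z → triangle X Y Z ≡ 1F) L →
        All (λ Z → ⟨ Z , Y ⟩ ≡ 0F) (X ∷ L) → All (λ Z → ⟨ Z , Y′ ⟩ ≡ 0F) (X ∷ L) → ⊥
      conclude {A ∷ B ∷ _ ∷ _} (uX ∷ uA ∷ uB ∷ _ , (xa ∷ xb ∷ _) ∷ _) (s≤s (s≤s (s≤s _))) ((ab ∷ _) ∷ _) (oX ∷ oA ∷ oB ∷ _) (oX′ ∷ oA′ ∷ oB′ ∷ _) =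
        PlusTriple.no-orthogonal-pair 2≢0 (plus-triple uX uA uB xa xb ab) 3≢0 δ≢0 (sgn-square sε)
          (flip {X} oX) (⟂-• _ (flip {A} oA)) (⟂-• _ (flip {B} oB)) (flip {X} oX′) (⟂-• _ (flip {A} oA′)) (⟂-• _ (flip {B} oB′)) YY Y′Y′ YY′

    module NonresidueMinusThree (nonresidue : ¬ IsSquare (ι -[1+ 2 ])) where

      -- As the kernel vector, I + A + B is orthogonal to I and A and isotropic, hence nilpotent,
      -- while `disc` A = 1 - 4 = -3 is a nonsquare. So I, A, B form a group of order 3.
      minus-triple-sum : ∀ {A B} → Triple -1F I A B → Zero (I +M (A +M B))
      minus-triple-sum {A} {B} T = nilpotent-⟂ N A
          (trans (sym (⟨⟩-I N)) (trans (⟨⟩-sym I N) (expand I (Triple.AA T) (Triple.BA T) (Triple.CA T)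
            (solve 0 (:2 :+ (:-1 :+ :-1) := :0) refl))))
          (cancel-* 2≢0 (trans (sym (⟨⟩-self N)) (trans (⟨⟩-+ʳ N I (A +M B)) (trans (cong (⟨ N , I ⟩ ⊕_) (⟨⟩-+ʳ N A B))
            (NI ⊕₀ (NA ⊕₀ NB))))))
          NA (λ s → nonresidue (subst IsSquare disc-A s))
        where
        N : Mat q
        N = I +M (A +M B)
        expand : ∀ Z {x y z} → ⟨ I , Z ⟩ ≡ x → ⟨ A , Z ⟩ ≡ y → ⟨ B , Z ⟩ ≡ z → x ⊕ (y ⊕ z) ≡ 0F → ⟨ N , Z ⟩ ≡ 0F
        expand Z refl refl refl e = trans (⟨⟩-+ˡ I (A +M B) Z) (trans (cong (⟨ I , Z ⟩ ⊕_) (⟨⟩-+ˡ A B Z)) e)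
        NI : ⟨ N , I ⟩ ≡ 0F
        NI = expand I (Triple.AA T) (Triple.BA T) (Triple.CA T) (solve 0 (:2 :+ (:-1 :+ :-1) := :0) refl)
        NA : ⟨ N , A ⟩ ≡ 0F
        NA = expand A (Triple.AB T) (Triple.BB T) (Triple.CB T) (solve 0 (:-1 :+ (:2 :+ :-1) := :0) refl)
        NB : ⟨ N , B ⟩ ≡ 0F
        NB = expand B (Triple.AC T) (Triple.BC T) (Triple.CC T) (solve 0 (:-1 :+ (:-1 :+ :2) := :0) refl)
        det-A : det A ≡ 1F
        det-A = *-cancelˡ 2≢0 (trans (sym (⟨⟩-self A)) (trans (Triple.BB T) (sym (*-identityʳ 2F))))
        tr-A : tr A ≡ -1F
        tr-A = trans (sym (⟨⟩-I A)) (Triple.AB T)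
        disc-A : disc A ≡ ι -[1+ 2 ]
        disc-A = trans (cong₂ (λ t e → t ⊛ t ⊖ ι (+ 4) ⊛ e) tr-A det-A)
          (solve 0 (:-1 :* :-1 :- :4 :* :1 := :-3) refl)

      -- A further member would pair to 0 with I + A + B = 0, but a sum of three signs is ±1 or ±3.
      minus-impossible : ∀ {L} → MinusConfiguration I L → ¬ 3 ℕ.≤ length L
      minus-impossible {L} M l = conclude (subst (3 ℕ.≤_) length-rest l) against
        where
        open MinusConfiguration M
        conclude : ∀ {N} → 3 ℕ.≤ 2 ℕ.+ length N → All (Against I (β • B₀) (γ • C₀)) N → ⊥
        conclude (s≤s (s≤s (s≤s _))) (_∷_ {x = W} w _) = sum-≢0 T w (trans
          (trans (+-assoc _ _ _) (sym (trans (⟨⟩-+ʳ W I _) (cong (⟨ W , I ⟩ ⊕_) (⟨⟩-+ʳ W (β • B₀) (γ • C₀))))))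
          (trans (⟨⟩-sym W _) (Zero-⟂ (minus-triple-sum T) W)))

      four-clique⇒five-square : ∀ {xs} → Clique xs → 4 ℕ.≤ length xs → IsSquare (ι (+ 5))
      four-clique⇒five-square {X ∷ L} c (s≤s l) with shape (Clique-at-I c) | subst (3 ℕ.≤_) (sym (length-map (adj X ·_) L)) l
      ... | plus r | l′ = four-plus⇒five-square (Clique-at-I c) l′ r
      ... | minus M | l′ = ⊥-elim (minus-impossible M l′)

      no-five-clique′ : ∀ {xs} → Clique xs → ¬ 5 ℕ.≤ length xs
      no-five-clique′ {X ∷ L} c (s≤s l) with shape (Clique-at-I c) | subst (4 ℕ.≤_) (sym (length-map (adj X ·_) L)) l
      ... | plus r | l′ = five-plus-impossible (Clique-at-I c) l′ r
      ... | minus M | l′ = minus-impossible M (ℕ.≤-trans (s≤s (s≤s (s≤s z≤n))) l′)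

  -- Cliques in characteristic 3

  -- In characteristic 3 the norm 2 equals -1, so a matrix is adjacent to itself and `Clique` does
  -- not exclude repetitions.
  Distinct : Mat q → Mat q → Set
  Distinct X Y = ∀ {s} → Sgn s → X ≢ s • Y

  •-• : ∀ s t A → s • (t • A) ≡ (s ⊛ t) • A
  •-• s t (mat a b c d) = mat-cong (sym (*-assoc s t a)) (sym (*-assoc s t b)) (sym (*-assoc s t c)) (sym (*-assoc s t d))

  1-• : ∀ A → 1F • A ≡ A
  1-• (mat a b c d) = mat-cong (*-identityˡ a) (*-identityˡ b) (*-identityˡ c) (*-identityˡ d)

  sgn-•-cancel : ∀ {s A B} → Sgn s → A ≡ s • B → B ≡ s • A
  sgn-•-cancel {s} {A} {B} σ refl = sym (trans (•-• s s B) (trans (cong (_• B) (sgn-square σ)) (1-• B)))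

  Distinct-sym : ∀ {X Y} → Distinct X Y → Distinct Y X
  Distinct-sym d σ e = d σ (sgn-•-cancel σ e)

  Distinct-• : ∀ {X Y s t} → Distinct X Y → Sgn s → Sgn t → s • X ≢ t • Y
  Distinct-• {X} {Y} {s} {t} d σ τ e = d (sgn-* σ τ) (trans (sgn-•-cancel σ (sym e)) (•-• s t Y))

  ·-• : ∀ Z s A → Z · (s • A) ≡ s • (Z · A)
  ·-• (mat x y z w) s (mat a b c d) = mat-cong (e x y a c) (e x y b d) (e z w a c) (e z w b d)
    where
    e : ∀ x y a c → x ⊛ (s ⊛ a) ⊕ y ⊛ (s ⊛ c) ≡ s ⊛ (x ⊛ a ⊕ y ⊛ c)
    e x y a c = solve 5 (λ x y s a c → x :* (s :* a) :+ y :* (s :* c) := s :* (x :* a :+ y :* c)) refl x y s a c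

  unimodular-cancel : ∀ {Z A B} → Unimodular Z → Z · A ≡ Z · B → A ≡ B
  unimodular-cancel {Z} {A} {B} u e = trans (sym (undo A)) (trans (cong (adj Z ·_) e) (undo B))
    where
    undo : ∀ A → adj Z · (Z · A) ≡ A
    undo A = trans (sym (·-assoc (adj Z) Z A)) (trans (cong (_· A) (adj-·ˡ Z)) (trans (•I-· (det Z) A) (trans (cong (_• A) u) (1-• A))))

  Distinct-translate : ∀ {Z xs} → Unimodular Z → AllPairs Distinct xs → AllPairs Distinct (translate Z xs)
  Distinct-translate {Z} u = AllPairs.map⁺ ∘ AllPairs.map (λ {X} {Y} d {s} σ e → d σ (unimodular-cancel {Z} u (trans e (sym (·-• Z s Y)))))

  nondegenerate : ∀ {U} → (∀ Z → ⟨ U , Z ⟩ ≡ 0F) → Zero U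
  nondegenerate {mat a b c d} h =
      trans (sym (solve 4 (λ a b c d → a :* :1 :+ d :* :0 :- b :* :0 :- c :* :0 := a) refl a b c d)) (h (mat 0F 0F 0F 1F))
    , trans (sym (solve 4 (λ a b c d → a :* :0 :+ d :* :0 :- b :* :-1 :- c :* :0 := b) refl a b c d)) (h (mat 0F 0F -1F 0F))
    , trans (sym (solve 4 (λ a b c d → a :* :0 :+ d :* :0 :- b :* :0 :- c :* :-1 := c) refl a b c d)) (h (mat 0F -1F 0F 0F))
    , trans (sym (solve 4 (λ a b c d → a :* :0 :+ d :* :1 :- b :* :0 :- c :* :0 := d) refl a b c d)) (h (mat 1F 0F 0F 0F))

  difference-Zero : ∀ {A B} → Zero (A +M -1F • B) → A ≡ B
  difference-Zero {mat a b c d} {mat a′ b′ c′ d′} (p , r , s , t) = mat-cong (e p) (e r) (e s) (e t)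
    where
    e : ∀ {x y} → x ⊕ -1F ⊛ y ≡ 0F → x ≡ y
    e {x} {y} = comb₁ 1F (solve 2 (λ x y → x :- y := :1 :* (x :+ :-1 :* y :- :0)) refl x y)

  minus-one-is-two : 3F ≡ 0F → -1F ≡ 2F
  minus-one-is-two = comb₁ -1F (solve 0 (:-1 :- :2 := :-1 :* (:3 :- :0)) refl)

  module _ (2≢0 : 2F ≢ 0F) (3≡0 : 3F ≡ 0F) (nonsquare : ¬ IsSquare -1F) where

    -1≡2 : -1F ≡ 2F
    -1≡2 = minus-one-is-two 3≡0

    5≡-1 : ι (+ 5) ≡ -1F
    5≡-1 = comb₁ 2F (solve 0 (:5 :- :-1 := :2 :* (:3 :- :0)) refl) 3≡0

    -- W - E is isotropic and orthogonal to a triple whose complement is an anisotropic line.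
    coincide : ∀ {A B W E} → Triple 1F I A B → ⟨ W , W ⟩ ≡ 2F → ⟨ E , E ⟩ ≡ 2F → ⟨ W , E ⟩ ≡ 2F →
      ⟨ W , I ⟩ ≡ ⟨ E , I ⟩ → ⟨ W , A ⟩ ≡ ⟨ E , A ⟩ → ⟨ W , B ⟩ ≡ ⟨ E , B ⟩ → W ≡ E
    coincide {A} {B} {W} {E} T WW EE WE wI wA wB = difference-Zero (nondegenerate
        (Commutator.isotropic-complement 2≢0 T (cancelled wI) (cancelled wA) (cancelled wB) UU))
      where
      U : Mat q
      U = W +M -1F • E
      expand : ∀ Z → ⟨ U , Z ⟩ ≡ ⟨ W , Z ⟩ ⊕ -1F ⊛ ⟨ E , Z ⟩
      expand Z = trans (⟨⟩-+ˡ W (-1F • E) Z) (cong (⟨ W , Z ⟩ ⊕_) (⟨⟩-•ˡ -1F E Z))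
      same : ∀ {x y} → x ≡ y → x ⊕ -1F ⊛ y ≡ 0F
      same {x} refl = solve 1 (λ x → x :+ :-1 :* x := :0) refl x
      cancelled : ∀ {Z} → ⟨ W , Z ⟩ ≡ ⟨ E , Z ⟩ → ⟨ U , Z ⟩ ≡ 0F
      cancelled {Z} e = trans (expand Z) (same e)
      UU : ⟨ U , U ⟩ ≡ 0F
      UU = trans (⟨⟩-+ʳ U W (-1F • E)) (cancelled {W} (trans WW (sym (flip {W} WE))) ⊕₀ trans (⟨⟩-•ʳ -1F U E)
        (trans (cong (-1F ⊛_) (cancelled {E} (trans WE (sym EE)))) (zeroʳ _)))

    unimodular-• : ∀ {s X} → Sgn s → Unimodular X → Unimodular (s • X)
    unimodular-• {s} {X} σ u = trans (det-• s X) (trans (cong₂ _⊛_ (sgn-square σ) u) (*-identityˡ 1F))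

    -- Choose the sign of V with ⟨ V , I ⟩ = 1. If V also pairs to 1 with A and B, then 5 = -1 is a
    -- square. In the other three cases -1 = 2 gives V or -V the pairings of B, A or I, with which
    -- it then coincides.
    no-fourth : ∀ {Y Z W} → Clique (I ∷ Y ∷ Z ∷ W ∷ []) → AllPairs Distinct (I ∷ Y ∷ Z ∷ W ∷ []) → triangle I Y Z ≡ 1F → ⊥
    no-fourth {Y} {Z} {W} (_ ∷ uY ∷ uZ ∷ uW ∷ [] , (iy ∷ iz ∷ iw ∷ []) ∷ (yz ∷ yw ∷ []) ∷ (zw ∷ []) ∷ [] ∷ [])
      ((_ ∷ _ ∷ dI ∷ []) ∷ (_ ∷ dY ∷ []) ∷ (dZ ∷ []) ∷ [] ∷ []) e = cases sA sB
      where
      open Triple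
      s y z : Fin q
      s = ⟨ I , W ⟩
      y = ⟨ I , Y ⟩
      z = ⟨ I , Z ⟩
      A B V : Mat q
      A = y • Y
      B = z • Z
      V = s • W
      T : Triple 1F I A B
      T = plus-triple I-unimodular uY uZ iy iz e
      VV : ⟨ V , V ⟩ ≡ 2F
      VV = norm-2 (unimodular-• iw uW)
      VI : ⟨ V , I ⟩ ≡ 1F
      VI = trans (⟨⟩-•ˡ s W I) (trans (cong (s ⊛_) (⟨⟩-sym W I)) (sgn-square iw))
      adjacent : ∀ {Y t} → Sgn t → Y ~ W → V ~ (t • Y)
      adjacent {Y} {t} τ p = ~-• {V} {Y} τ (~-sym {Y} {V} (~-• {Y} {W} iw p))
      sA : V ~ A
      sA = adjacent {Y} iy yw
      sB : V ~ B
      sB = adjacent {Z} iz zw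
      V′ : Mat q
      V′ = -1F • V
      neg : ∀ {E g h} → ⟨ V , E ⟩ ≡ g → -1F ⊛ g ≡ h → ⟨ V′ , E ⟩ ≡ h
      neg {E} refl f = trans (⟨⟩-•ˡ -1F V E) f
      -1·-1 : -1F ⊛ -1F ≡ 1F
      -1·-1 = sgn-square (Sign.- , refl)
      cases : V ~ A → V ~ B → ⊥
      cases (Sign.+ , VA) (Sign.+ , VB) = nonsquare (subst IsSquare 5≡-1 (Commutator.five-square 2≢0 T VI VA VB VV))
      cases (Sign.+ , VA) (Sign.- , VB) = Distinct-• (Distinct-sym dZ) iw iz
        (coincide T VV (CC T) (trans VB -1≡2) (trans VI (sym (CA T))) (trans VA (sym (CB T))) (trans VB (trans -1≡2 (sym (CC T)))))
      cases (Sign.- , VA) (Sign.+ , VB) = Distinct-• (Distinct-sym dY) iw iy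
        (coincide T VV (BB T) (trans VA -1≡2) (trans VI (sym (BA T))) (trans VA (trans -1≡2 (sym (BB T)))) (trans VB (sym (BC T))))
      cases (Sign.- , VA) (Sign.- , VB) = dI (sgn-* (Sign.- , refl) iw) (sym (trans (sym (•-• -1F s W))
        (coincide T (norm-2 (unimodular-• (Sign.- , refl) (unimodular-• iw uW))) (AA T) (trans V′I -1≡2)
          (trans V′I (trans -1≡2 (sym (AA T)))) (trans (neg VA -1·-1) (sym (AB T))) (trans (neg VB -1·-1) (sym (AC T))))))
        where
        V′I : ⟨ V′ , I ⟩ ≡ -1F
        V′I = neg VI (*-identityʳ -1F)

    -- Unimodular matrices of trace 2 in the tangent space at A ≠ I form a line, parametrised by an off-diagonal entry.
    record Tangent (A W : Mat q) : Set where
      field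
        trace : ⟨ I , W ⟩ ≡ 2F
        norm : ⟨ W , W ⟩ ≡ 2F
        tangent : ⟨ A , W ⟩ ≡ 2F

    private
      raw-trace : ∀ {a b c d} → ⟨ I , mat a b c d ⟩ ≡ 2F → a ⊕ d ≡ 2F
      raw-trace {a} {b} {c} {d} e = trans (sym (⟨⟩-I (mat a b c d))) e

      raw-det : ∀ {W} → ⟨ W , W ⟩ ≡ 2F → det W ≡ 1F
      raw-det {W} e = *-cancelˡ 2≢0 (trans (sym (⟨⟩-self W)) (trans e (sym (*-identityʳ 2F))))

      nilpotent : ∀ {a b c d} → a ⊕ d ≡ 2F → a ⊛ d ⊖ b ⊛ c ≡ 1F → (a ⊖ 1F) ⊛ (a ⊖ 1F) ⊕ b ⊛ c ≡ 0F
      nilpotent {a} {b} {c} {d} = comb₂ a -1F (solve 4 (λ a b c d → (a :- :1) :* (a :- :1) :+ b :* c :- :0 :=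
        a :* (a :+ d :- :2) :+ :-1 :* (a :* d :- b :* c :- :1)) refl a b c d)

      orthogonal : ∀ {a b c d a′ b′ c′ d′} → a ⊕ d ≡ 2F → a′ ⊕ d′ ≡ 2F → a ⊛ d′ ⊕ d ⊛ a′ ⊖ b ⊛ c′ ⊖ c ⊛ b′ ≡ 2F →
        2F ⊛ ((a ⊖ 1F) ⊛ (a′ ⊖ 1F)) ⊕ b ⊛ c′ ⊕ c ⊛ b′ ≡ 0F
      orthogonal {a} {b} {c} {d} {a′} {b′} {c′} {d′} = comb₃ a′ a -1F (solve 8 (λ a b c d a′ b′ c′ d′ →
        :2 :* ((a :- :1) :* (a′ :- :1)) :+ b :* c′ :+ c :* b′ :- :0 :=
        a′ :* (a :+ d :- :2) :+ a :* (a′ :+ d′ :- :2) :+ :-1 :* (a :* d′ :+ d :* a′ :- b :* c′ :- c :* b′ :- :2))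
        refl a b c d a′ b′ c′ d′)

      -- The ternary form x² + yz has no totally isotropic plane; concretely, the squares of two
      -- minors are combinations of the three hypotheses.
      proportional : ∀ {x y z x′ y′ z′} → x ⊛ x ⊕ y ⊛ z ≡ 0F → x′ ⊛ x′ ⊕ y′ ⊛ z′ ≡ 0F → 2F ⊛ (x ⊛ x′) ⊕ y ⊛ z′ ⊕ z ⊛ y′ ≡ 0F →
        y ⊛ x′ ≡ x ⊛ y′ × z ⊛ x′ ≡ x ⊛ z′
      proportional {x} {y} {z} {x′} {y′} {z′} p p′ o =
        0-diff (square-0 (comb₃ (y′ ⊛ y′) (y ⊛ y) (-F (y ⊛ y′)) (solve 6 (λ x y z x′ y′ z′ → (y :* x′ :- x :* y′) :* (y :* x′ :- x :* y′) :- :0 :=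
          (y′ :* y′) :* (x :* x :+ y :* z :- :0) :+ (y :* y) :* (x′ :* x′ :+ y′ :* z′ :- :0) :+ (:- (y :* y′)) :* (:2 :* (x :* x′) :+ y :* z′ :+ z :* y′ :- :0))
          refl x y z x′ y′ z′) p p′ o)) ,
        0-diff (square-0 (comb₃ (z′ ⊛ z′) (z ⊛ z) (-F (z ⊛ z′)) (solve 6 (λ x y z x′ y′ z′ → (z :* x′ :- x :* z′) :* (z :* x′ :- x :* z′) :- :0 :=
          (z′ :* z′) :* (x :* x :+ y :* z :- :0) :+ (z :* z) :* (x′ :* x′ :+ y′ :* z′ :- :0) :+ (:- (z :* z′)) :* (:2 :* (x :* x′) :+ y :* z′ :+ z :* y′ :- :0))
          refl x y z x′ y′ z′) p p′ o))

    module _ {A W : Mat q} (AI : Tangent A A) (w : Tangent A W) where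
      open Mat
      tangent-proportional : Mat.b A ⊛ (Mat.a W ⊖ 1F) ≡ (Mat.a A ⊖ 1F) ⊛ Mat.b W × Mat.c A ⊛ (Mat.a W ⊖ 1F) ≡ (Mat.a A ⊖ 1F) ⊛ Mat.c W
      tangent-proportional = proportional
        (nilpotent (raw-trace (Tangent.trace AI)) (raw-det (Tangent.norm AI)))
        (nilpotent (raw-trace (Tangent.trace w)) (raw-det (Tangent.norm w)))
        (orthogonal (raw-trace (Tangent.trace AI)) (raw-trace (Tangent.trace w)) (Tangent.tangent w))

    -- The entry to read depends on A: the nilpotent A - I has a nonzero off-diagonal entry unless
    -- it is 0.
    parameter : Mat q → Mat q → Fin q
    parameter A W with Mat.b A ≟ 0F
    ... | yes _ = Mat.c W
    ... | no _ = Mat.b W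

    parameter-injective : ∀ {A W V} → A ≢ I → Tangent A A → Tangent A W → Tangent A V → parameter A W ≡ parameter A V → W ≡ V
    parameter-injective {A@(mat a b c d)} {W@(mat a₁ b₁ c₁ d₁)} {V@(mat a₂ b₂ c₂ d₂)} A≢I tA tW tV e with b ≟ 0F
    ... | no b≢0 = finish b≢0 e
      where
      finish : b ≢ 0F → b₁ ≡ b₂ → W ≡ V
      finish b≢0 refl = mat-cong a≡ refl c≡ d≡
        where
        a≡ : a₁ ≡ a₂
        a≡ = *-cancelˡ b≢0 (comb₂ 1F -1F (solve 5 (λ a b a₁ a₂ b₁ → b :* a₁ :- b :* a₂ := :1 :* (b :* (a₁ :- :1) :- (a :- :1) :* b₁) :+ :-1 :* (b :* (a₂ :- :1) :- (a :- :1) :* b₁)) refl a b a₁ a₂ b₁)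
          (proj₁ (tangent-proportional tA tW)) (proj₁ (tangent-proportional tA tV)))
        d≡ : d₁ ≡ d₂
        d≡ = comb₃ 1F -1F -1F (solve 4 (λ a₁ a₂ d₁ d₂ → d₁ :- d₂ := :1 :* (a₁ :+ d₁ :- :2) :+ :-1 :* (a₂ :+ d₂ :- :2) :+ :-1 :* (a₁ :- a₂)) refl a₁ a₂ d₁ d₂)
          (raw-trace (Tangent.trace tW)) (raw-trace (Tangent.trace tV)) a≡
        c≡ : c₁ ≡ c₂
        c≡ = *-cancelˡ b≢0 (comb₄ -1F 1F d a (solve 11 (λ a b c d a₁ b₁ c₁ d₁ a₂ c₂ d₂ → b :* c₁ :- b :* c₂ :=
          :-1 :* (a :* d₁ :+ d :* a₁ :- b :* c₁ :- c :* b₁ :- :2) :+ :1 :* (a :* d₂ :+ d :* a₂ :- b :* c₂ :- c :* b₁ :- :2)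
          :+ d :* (a₁ :- a₂) :+ a :* (d₁ :- d₂)) refl a b c d a₁ b₁ c₁ d₁ a₂ c₂ d₂) (Tangent.tangent tW) (Tangent.tangent tV) a≡ d≡)
    ... | yes b≡0 = finish c≢0 e
      where
      x≡0 : a ⊖ 1F ≡ 0F
      x≡0 = square-0 (comb₂ 1F (-F c) (solve 3 (λ a b c → (a :- :1) :* (a :- :1) :- :0 := :1 :* ((a :- :1) :* (a :- :1) :+ b :* c :- :0) :+ (:- c) :* (b :- :0)) refl a b c)
        (nilpotent (raw-trace (Tangent.trace tA)) (raw-det (Tangent.norm tA))) b≡0)
      c≢0 : c ≢ 0F
      c≢0 z = A≢I (mat-cong (0-diff x≡0) b≡0 z (comb₂ 1F -1F (solve 2 (λ a d → d :- :1 := :1 :* (a :+ d :- :2) :+ :-1 :* (a :- :1 :- :0)) refl a d)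
        (raw-trace (Tangent.trace tA)) x≡0))
      finish : c ≢ 0F → c₁ ≡ c₂ → W ≡ V
      finish c≢0 refl = mat-cong a≡ b≡ refl d≡
        where
        a≡ : a₁ ≡ a₂
        a≡ = *-cancelˡ c≢0 (comb₂ 1F -1F (solve 5 (λ a b a₁ a₂ b₁ → b :* a₁ :- b :* a₂ := :1 :* (b :* (a₁ :- :1) :- (a :- :1) :* b₁) :+ :-1 :* (b :* (a₂ :- :1) :- (a :- :1) :* b₁)) refl a c a₁ a₂ c₁)
          (proj₂ (tangent-proportional tA tW)) (proj₂ (tangent-proportional tA tV)))
        d≡ : d₁ ≡ d₂
        d≡ = comb₃ 1F -1F -1F (solve 4 (λ a₁ a₂ d₁ d₂ → d₁ :- d₂ := :1 :* (a₁ :+ d₁ :- :2) :+ :-1 :* (a₂ :+ d₂ :- :2) :+ :-1 :* (a₁ :- a₂)) refl a₁ a₂ d₁ d₂)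
          (raw-trace (Tangent.trace tW)) (raw-trace (Tangent.trace tV)) a≡
        b≡ : b₁ ≡ b₂
        b≡ = *-cancelˡ c≢0 (comb₄ -1F 1F d a (solve 11 (λ a b c d a₁ b₁ c₁ d₁ a₂ b₂ d₂ → c :* b₁ :- c :* b₂ :=
          :-1 :* (a :* d₁ :+ d :* a₁ :- b :* c₁ :- c :* b₁ :- :2) :+ :1 :* (a :* d₂ :+ d :* a₂ :- b :* c₁ :- c :* b₂ :- :2)
          :+ d :* (a₁ :- a₂) :+ a :* (d₁ :- d₂)) refl a b c d a₁ b₁ c₁ d₁ a₂ b₂ d₂) (Tangent.tangent tW) (Tangent.tangent tV) a≡ d≡)

    normalised : Mat q → Mat q
    normalised W = (-F ⟨ I , W ⟩) • W

    normalised-I : normalised I ≡ I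
    normalised-I = trans (cong (λ t → (-F t) • I) (trans (norm-2 I-unimodular) (sym -1≡2))) (trans (cong (_• I) (-‿involutive 1F)) (1-• I))

    -- A triangle of sign +1 at I stops the clique at three members, and 3 ≤ q. Otherwise, once all
    -- traces are normalised to 2, the members are tangent to one of them, and their parameters are
    -- different field elements.
    clique-bound-at-I : 3 ℕ.≤ q → ∀ {L} → Clique (I ∷ L) → AllPairs Distinct (I ∷ L) → suc (length L) ℕ.≤ q
    clique-bound-at-I 3≤q {L} c@(uI ∷ us , is ∷ ps) ds with split Sign.+ is ps
    ... | found {Y} {Z} {L′} p e = ℕ.≤-trans (s≤s (subst (ℕ._≤ 2) (sym (↭-length p)) (s≤s (s≤s (short L′ (Clique-↭ (prep I p) c)
            (AllPairs-↭ (λ {X} {Y} → Distinct-sym {X} {Y}) (prep I p) ds)))))) 3≤q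
      where
      short : ∀ L′ → Clique (I ∷ Y ∷ Z ∷ L′) → AllPairs Distinct (I ∷ Y ∷ Z ∷ L′) → length L′ ℕ.≤ 0
      short [] _ _ = z≤n
      short (W ∷ _) (_ ∷ uY ∷ uZ ∷ uW ∷ _ , (iy ∷ iz ∷ iw ∷ _) ∷ (yz ∷ yw ∷ _) ∷ (zw ∷ _) ∷ _)
        ((iy′ ∷ iz′ ∷ iw′ ∷ _) ∷ (yz′ ∷ yw′ ∷ _) ∷ (zw′ ∷ _) ∷ _) = ⊥-elim (no-fourth
          (uI ∷ uY ∷ uZ ∷ uW ∷ [] , (iy ∷ iz ∷ iw ∷ []) ∷ (yz ∷ yw ∷ []) ∷ (zw ∷ []) ∷ [] ∷ [])
          ((iy′ ∷ iz′ ∷ iw′ ∷ []) ∷ (yz′ ∷ yw′ ∷ []) ∷ (zw′ ∷ []) ∷ [] ∷ []) e)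
    clique-bound-at-I 3≤q {[]} c ds | none r = ℕ.≤-trans (s≤s z≤n) 3≤q
    clique-bound-at-I 3≤q {Y ∷ L} (uI ∷ uY ∷ us , (iy ∷ is) ∷ ys ∷ ps) (dIs@(dIY ∷ _) ∷ ds) | none (r ∷ _) =
      subst (ℕ._≤ q) (length-map key (I ∷ Y ∷ L)) (subst (length (map key (I ∷ Y ∷ L)) ℕ.≤_) (length-tabulate (λ x → x))
        (Unique-⊆-length (AllPairs.map⁺ (keys (tI ∷ tY ∷ tangents us is r) (iI ∷ iy ∷ is) (dIs ∷ ds))) (λ _ → ∈-allFin _)))
      where
      A : Mat q
      A = normalised Y
      key : Mat q → Fin q
      key W = parameter A (normalised W)
      signed : ∀ {W} → I ~ W → Sgn (-F ⟨ I , W ⟩)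
      signed = sgn-neg
      A≢I : A ≢ I
      A≢I e = dIY (signed iy) (sym e)
      trace′ : ∀ {W} → I ~ W → ⟨ I , normalised W ⟩ ≡ 2F
      trace′ {W} w = trans (⟨⟩-•ʳ _ I W) (trans (solve 1 (λ g → (:- g) :* g := :-1 :* (g :* g)) refl ⟨ I , W ⟩)
        (trans (cong (-1F ⊛_) (sgn-square w)) (trans (*-identityʳ -1F) -1≡2)))
      tY : Tangent A A
      tY = record { trace = trace′ iy ; norm = norm-2 (unimodular-• (signed iy) uY) ; tangent = norm-2 (unimodular-• (signed iy) uY) }
      NearY : Mat q → Set
      NearY W = Tangent A (normalised W)
      tI : NearY I
      tI = subst (Tangent A) (sym normalised-I) (record { trace = norm-2 uI ; norm = norm-2 uI ; tangent = flip {I} (trace′ iy) })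
      tangents : ∀ {M} → All Unimodular M → All (I ~_) M → All (λ Z → triangle I Y Z ≡ -1F) M → All NearY M
      tangents [] [] [] = []
      tangents {W ∷ _} (u ∷ us) (i ∷ is) (e ∷ es) = record { trace = trace′ i ; norm = norm-2 (unimodular-• (signed i) u)
        ; tangent = trans (Triple.BC (minus-triple uI uY u iy i e)) -1≡2 } ∷ tangents us is es
      -- Self-adjacency from 2 = -1; it allows I to be counted among the parametrised members.
      iI : I ~ I
      iI = Sign.- , trans (norm-2 uI) (sym -1≡2)
      keys : ∀ {M} → All NearY M → All (I ~_) M → AllPairs Distinct M → AllPairs (λ W V → key W ≢ key V) M
      keys [] [] [] = []
      keys {W ∷ _} (t ∷ ts) (i ∷ is) (d ∷ ds) = row ts is d ∷ keys ts is ds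
        where
        row : ∀ {M} → All NearY M → All (I ~_) M → All (Distinct W) M → All (λ V → key W ≢ key V) M
        row [] [] [] = []
        row {V ∷ _} (t′ ∷ ts) (i′ ∷ is) (d ∷ ds) = (λ e → Distinct-• {W} {V} d (signed i) (signed i′) (parameter-injective A≢I tY t t′ e)) ∷ row ts is ds

    clique-bound : 3 ℕ.≤ q → ∀ {xs} → Clique xs → AllPairs Distinct xs → length xs ℕ.≤ q
    clique-bound 3≤q {[]} _ _ = z≤n
    clique-bound 3≤q {X ∷ L} c@(u ∷ _ , _) d = subst (λ n → suc n ℕ.≤ q) (length-map (adj X ·_) L)
      (clique-bound-at-I 3≤q (Clique-at-I c) (subst (λ A → AllPairs Distinct (A ∷ translate (adj X) L)) (adj-inverse u)
        (Distinct-translate {adj X} (trans (det-adj X) u) d)))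

  -- Cliques attaining the bounds

  module ExplicitCliques where
    module SixthRootOfUnity (r : Fin q) (r² : r ⊛ r ≡ r ⊖ 1F) {N : ℕ} (N≡0 : ι (+ N) ≡ 0F) where

      ⟦_⟧ᴱ : Eisenstein → Fin q
      ⟦ m , n ⟧ᴱ = ι m ⊕ ι n ⊛ r

      ⟦_⟧ᴹ : EisensteinMatrix → Mat q
      ⟦ a , b , c , d ⟧ᴹ = mat ⟦ a ⟧ᴱ ⟦ b ⟧ᴱ ⟦ c ⟧ᴱ ⟦ d ⟧ᴱ

      ⊞-hom : ∀ x y → ⟦ x ⊞ y ⟧ᴱ ≡ ⟦ x ⟧ᴱ ⊕ ⟦ y ⟧ᴱ
      ⊞-hom (m , n) (m′ , n′) = trans (cong₂ (λ s t → s ⊕ t ⊛ r) (ι-+ m m′) (ι-+ n n′))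
        (solve 5 (λ m n m′ n′ r → (m :+ m′) :+ (n :+ n′) :* r := (m :+ n :* r) :+ (m′ :+ n′ :* r)) refl (ι m) (ι n) (ι m′) (ι n′) r)

      ⊟-hom : ∀ x → ⟦ ⊟ x ⟧ᴱ ≡ -F ⟦ x ⟧ᴱ
      ⊟-hom (m , n) = trans (cong₂ (λ s t → s ⊕ t ⊛ r) (ι-neg m) (ι-neg n))
        (solve 3 (λ m n r → :- m :+ (:- n) :* r := :- (m :+ n :* r)) refl (ι m) (ι n) r)

      ⊠-hom : ∀ x y → ⟦ x ⊠ y ⟧ᴱ ≡ ⟦ x ⟧ᴱ ⊛ ⟦ y ⟧ᴱ
      ⊠-hom (m , n) (m′ , n′) = trans (cong₂ (λ s t → s ⊕ t ⊛ r) first second)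
          (comb₁ (-F (ι n ⊛ ι n′)) (solve 5 (λ m n m′ n′ r → (m :* m′ :+ :- (n :* n′)) :+ (m :* n′ :+ n :* m′ :+ n :* n′) :* r :- (m :+ n :* r) :* (m′ :+ n′ :* r)
            := (:- (n :* n′)) :* (r :* r :- (r :- :1))) refl (ι m) (ι n) (ι m′) (ι n′) r) r²)
        where
        first : ι (m ℤ.* m′ ℤ.+ ℤ.- (n ℤ.* n′)) ≡ ι m ⊛ ι m′ ⊕ (-F (ι n ⊛ ι n′))
        first = trans (ι-+ (m ℤ.* m′) _) (cong₂ _⊕_ (ι-* m m′) (trans (ι-neg (n ℤ.* n′)) (cong -F_ (ι-* n n′))))
        second : ι (m ℤ.* n′ ℤ.+ n ℤ.* m′ ℤ.+ n ℤ.* n′) ≡ ι m ⊛ ι n′ ⊕ ι n ⊛ ι m′ ⊕ ι n ⊛ ι n′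
        second = trans (ι-+ (m ℤ.* n′ ℤ.+ n ℤ.* m′) _) (cong₂ _⊕_ (trans (ι-+ (m ℤ.* n′) _) (cong₂ _⊕_ (ι-* m n′) (ι-* n m′))) (ι-* n n′))

      difference : ∀ x y → ⟦ x ⊞ (⊟ y) ⟧ᴱ ≡ ⟦ x ⟧ᴱ ⊖ ⟦ y ⟧ᴱ
      difference x y = trans (⊞-hom x (⊟ y)) (cong (⟦ x ⟧ᴱ ⊕_) (⊟-hom y))

      determinant-hom : ∀ A → det ⟦ A ⟧ᴹ ≡ ⟦ determinantᴱ A ⟧ᴱ
      determinant-hom (a , b , c , d) = sym (trans (difference (a ⊠ d) (b ⊠ c)) (cong₂ _⊖_ (⊠-hom a d) (⊠-hom b c)))

      form-hom : ∀ A B → ⟨ ⟦ A ⟧ᴹ , ⟦ B ⟧ᴹ ⟩ ≡ ⟦ formᴱ A B ⟧ᴱ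
      form-hom (a , b , c , d) (a′ , b′ , c′ , d′) = sym (trans (difference (((a ⊠ d′) ⊞ (d ⊠ a′)) ⊞ (⊟ (b ⊠ c′))) (c ⊠ b′)) (cong₂ _⊖_
        (trans (difference ((a ⊠ d′) ⊞ (d ⊠ a′)) (b ⊠ c′)) (cong₂ _⊖_ (trans (⊞-hom (a ⊠ d′) (d ⊠ a′)) (cong₂ _⊕_ (⊠-hom a d′) (⊠-hom d a′))) (⊠-hom b c′))) (⊠-hom c b′)))

      multiple-0 : ∀ i → N ℕ.∣ ℤ.∣ i ∣ → ι i ≡ 0F
      multiple-0 (+ n) d = ι-∣ d N≡0
      multiple-0 -[1+ n ] d = trans (cong -F_ (ι-∣ d N≡0)) -0#≈0#

      congruent : ∀ i x → CongruentTo N i x → ⟦ x ⟧ᴱ ≡ ι i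
      congruent i (m , n) (d , e) = comb₂ 1F r (solve 4 (λ m n i r → m :+ n :* r :- i := :1 :* (m :- i :- :0) :+ r :* (n :- :0)) refl (ι m) (ι n) (ι i) r)
        (trans (sym (trans (ι-+ m (ℤ.- i)) (cong (ι m ⊕_) (ι-neg i)))) (multiple-0 (m ℤ.- i) d)) (multiple-0 n e)

      clique : ∀ {xs} → CliqueModulo N xs → Clique (map ⟦_⟧ᴹ xs)
      clique (us , ps) = All.map⁺ (All.map (λ {A} c → trans (determinant-hom A) (congruent (+ 1) (determinantᴱ A) c)) us) ,
          AllPairs.map⁺ (AllPairs.map (λ {A} {B} → sign {A} {B}) ps)
        where
        sign : ∀ {A B} → CongruentTo N (+ 1) (formᴱ A B) ⊎ CongruentTo N -[1+ 0 ] (formᴱ A B) → ⟦ A ⟧ᴹ ~ ⟦ B ⟧ᴹ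
        sign {A} {B} (inj₁ c) = Sign.+ , trans (form-hom A B) (congruent (+ 1) (formᴱ A B) c)
        sign {A} {B} (inj₂ c) = Sign.- , trans (form-hom A B) (congruent -[1+ 0 ] (formᴱ A B) c)

    -- Four icosians with pairwise inner products 1/2, in the quaternion algebra split by u² + v² = -1.
    module Icosians (2≢0 : 2F ≢ 0F) {t u v : Fin q} (golden : t ⊛ t ≡ 1F ⊕ t) (uv : u ⊛ u ⊕ v ⊛ v ≡ ι -[1+ 0 ]) where

      quaternion : Fin q → Fin q → Fin q → Fin q → Mat q
      quaternion w x y z = mat (w ⊕ (y ⊛ u ⊖ z ⊛ v)) ((y ⊛ v ⊕ z ⊛ u) ⊖ x) (x ⊕ (y ⊛ v ⊕ z ⊛ u)) (w ⊖ (y ⊛ u ⊖ z ⊛ v))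

      quaternion-form : ∀ w x y z w′ x′ y′ z′ → ⟨ quaternion w x y z , quaternion w′ x′ y′ z′ ⟩ ≡ 2F ⊛ (w ⊛ w′ ⊕ x ⊛ x′ ⊕ y ⊛ y′ ⊕ z ⊛ z′)
      quaternion-form w x y z w′ x′ y′ z′ = comb₁ (ι -[1+ 1 ] ⊛ (y ⊛ y′ ⊕ z ⊛ z′)) (solve 10 (λ w x y z w′ x′ y′ z′ u v →
          let a = y :* u :- z :* v
              b = y :* v :+ z :* u
              a′ = y′ :* u :- z′ :* v
              b′ = y′ :* v :+ z′ :* u
          in (w :+ a) :* (w′ :- a′) :+ (w :- a) :* (w′ :+ a′) :- (b :- x) :* (x′ :+ b′) :- (x :+ b) :* (b′ :- x′)
               :- :2 :* (w :* w′ :+ x :* x′ :+ y :* y′ :+ z :* z′)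
             := (:-2 :* (y :* y′ :+ z :* z′)) :* (u :* u :+ v :* v :- :-1)) refl w x y z w′ x′ y′ z′ u v) uv

      h : Fin q
      h = inv 2F
      2h : 2F ⊛ h ≡ 1F
      2h = inv-* 2≢0

      unimodular : ∀ {w x y z} → w ⊛ w ⊕ x ⊛ x ⊕ y ⊛ y ⊕ z ⊛ z ≡ 1F → Unimodular (quaternion w x y z)
      unimodular {w} {x} {y} {z} e = *-cancelˡ 2≢0 (trans (sym (⟨⟩-self (quaternion w x y z))) (trans (quaternion-form w x y z w x y z) (cong (2F ⊛_) e)))

      adjacent : ∀ {w x y z w′ x′ y′ z′} → 2F ⊛ (w ⊛ w′ ⊕ x ⊛ x′ ⊕ y ⊛ y′ ⊕ z ⊛ z′) ≡ 1F → quaternion w x y z ~ quaternion w′ x′ y′ z′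
      adjacent {w} {x} {y} {z} {w′} {x′} {y′} {z′} e = Sign.+ , trans (quaternion-form w x y z w′ x′ y′ z′) e

      -- In quaternion notation 1, (1 + i + j + k)/2, (1 + i + j - k)/2 and (1 + (1 - t)i + tj)/2.
      -- The last has norm 1 because t² = t + 1, and its pairings are right because (1 - t) + t = 1.
      icosians : List (Mat q)
      icosians = quaternion 1F 0F 0F 0F ∷ quaternion h h h h ∷ quaternion h h h (-F h) ∷ quaternion h (h ⊛ (1F ⊖ t)) (h ⊛ t) 0F ∷ []

      icosians-clique : Clique icosians
      icosians-clique =
          unimodular (solve 0 (:1 :* :1 :+ :0 :* :0 :+ :0 :* :0 :+ :0 :* :0 := :1) refl)
        ∷ unimodular (comb₁ (2F ⊛ h ⊕ 1F) (solve 1 (λ h → h :* h :+ h :* h :+ h :* h :+ h :* h :- :1 := (:2 :* h :+ :1) :* (:2 :* h :- :1)) refl h) 2h)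
        ∷ unimodular (comb₁ (2F ⊛ h ⊕ 1F) (solve 1 (λ h → h :* h :+ h :* h :+ h :* h :+ (:- h) :* (:- h) :- :1 := (:2 :* h :+ :1) :* (:2 :* h :- :1)) refl h) 2h)
        ∷ unimodular (comb₂ (2F ⊛ h ⊕ 1F) (2F ⊛ (h ⊛ h)) (solve 2 (λ h t → h :* h :+ (h :* (:1 :- t)) :* (h :* (:1 :- t)) :+ (h :* t) :* (h :* t) :+ :0 :* :0 :- :1
            := (:2 :* h :+ :1) :* (:2 :* h :- :1) :+ (:2 :* (h :* h)) :* (t :* t :- (:1 :+ t))) refl h t) 2h golden)
        ∷ [] ,
          ( adjacent (unit h h h) ∷ adjacent (unit h h (-F h)) ∷ adjacent (unit (h ⊛ (1F ⊖ t)) (h ⊛ t) 0F) ∷ [])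
        ∷ ( adjacent (comb₁ (2F ⊛ h ⊕ 1F) (solve 1 (λ h → :2 :* (h :* h :+ h :* h :+ h :* h :+ h :* (:- h)) :- :1 := (:2 :* h :+ :1) :* (:2 :* h :- :1)) refl h) 2h)
          ∷ adjacent (comb₁ (2F ⊛ h ⊕ 1F) (solve 2 (λ h t → :2 :* (h :* h :+ h :* (h :* (:1 :- t)) :+ h :* (h :* t) :+ h :* :0) :- :1 := (:2 :* h :+ :1) :* (:2 :* h :- :1)) refl h t) 2h) ∷ [])
        ∷ ( adjacent (comb₁ (2F ⊛ h ⊕ 1F) (solve 2 (λ h t → :2 :* (h :* h :+ h :* (h :* (:1 :- t)) :+ h :* (h :* t) :+ (:- h) :* :0) :- :1 := (:2 :* h :+ :1) :* (:2 :* h :- :1)) refl h t) 2h) ∷ [])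
        ∷ [] ∷ []
        where
        unit : ∀ x y z → 2F ⊛ (1F ⊛ h ⊕ 0F ⊛ x ⊕ 0F ⊛ y ⊕ 0F ⊛ z) ≡ 1F
        unit x y z = trans (solve 4 (λ h x y z → :2 :* (:1 :* h :+ :0 :* x :+ :0 :* y :+ :0 :* z) := :2 :* h) refl h x y z) 2h

  -- Fixed vertices in terms of trace and determinant

  module ProjectiveAction {n : ℕ} (X : Graph n) (cubic : Cubic X) (regular : AutTwoArcRegular X)
    (φ : Mat q → Perm n) (pgl : AutIsPGL F X φ) (psl : PSLArcRegular F X φ) where

    open CubicGraph X cubic public
    open TwoArcRegular regular public

    private
      1P : Perm n
      1P = idPerm n

    φ-· : ∀ A B → Invertible A → Invertible B → φ (A · B) ≡ φ A ∘P φ B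
    φ-· = proj₁ pgl

    φ-aut : ∀ A → Invertible A → IsAut X (φ A)
    φ-aut = proj₁ (proj₂ pgl)

    φ-surjective : ∀ t → IsAut X t → ∃[ A ] (Invertible A × φ A ≡ t)
    φ-surjective = proj₁ (proj₂ (proj₂ pgl))

    φ-kernel : ∀ A → Invertible A → φ A ≡ 1P → Scalar A
    φ-kernel A i = proj₁ (proj₂ (proj₂ (proj₂ pgl)) A i)

    φ-scalar : ∀ A → Invertible A → Scalar A → φ A ≡ 1P
    φ-scalar A i = proj₂ (proj₂ (proj₂ (proj₂ pgl)) A i)

    special-invertible : ∀ {A} → Unimodular A → Invertible A
    special-invertible u e = 1≢0 (trans (sym u) e)

    invertible-· : ∀ {A B} → Invertible A → Invertible B → Invertible (A · B)
    invertible-· {A} {B} i j e = *-≢0 i j (trans (sym (det-· A B)) e)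

    invertible-adj : ∀ {A} → Invertible A → Invertible (adj A)
    invertible-adj {A} i e = i (trans (sym (det-adj A)) e)

    unimodular-· : ∀ {A B} → Unimodular A → Unimodular B → Unimodular (A · B)
    unimodular-· {A} {B} u v = trans (det-· A B) (trans (cong₂ _⊛_ u v) (*-identityˡ 1F))

    unimodular-adj : ∀ {A} → Unimodular A → Unimodular (adj A)
    unimodular-adj {A} u = trans (det-adj A) u

    scalar-•I : ∀ s → Scalar (s • I)
    scalar-•I s = zeroʳ s , zeroʳ s , refl

    det-•I : ∀ s → det (s • I) ≡ s ⊛ s
    det-•I s = trans (det-• s I) (trans (cong ((s ⊛ s) ⊛_) det-I) (*-identityʳ _))

    invertible-•I : ∀ {s} → s ≢ 0F → Invertible (s • I)
    invertible-•I {s} n e = *-≢0 n n (trans (sym (det-•I s)) e)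

    φ-•I : ∀ {s} → s ≢ 0F → φ (s • I) ≡ 1P
    φ-•I {s} n = φ-scalar (s • I) (invertible-•I n) (scalar-•I s)

    φ-• : ∀ {s A} → s ≢ 0F → Invertible A → φ (s • A) ≡ φ A
    φ-• {s} {A} n i = trans (cong φ (sym (•I-· s A))) (trans (φ-· (s • I) A (invertible-•I n) i)
      (trans (cong (_∘P φ A) (φ-•I n)) (∘P-idˡ (φ A))))

    φ-adjˡ : ∀ {A} → Invertible A → φ (adj A) ∘P φ A ≡ 1P
    φ-adjˡ {A} i = trans (sym (φ-· (adj A) A (invertible-adj i) i)) (trans (cong φ (adj-·ˡ A)) (φ-•I i))

    φ-adjʳ : ∀ {A} → Invertible A → φ A ∘P φ (adj A) ≡ 1P
    φ-adjʳ {A} i = trans (sym (φ-· A (adj A) i (invertible-adj i))) (trans (cong φ (adj-·ʳ A)) (φ-•I i))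

    φ-undo : ∀ {A} → Invertible A → ∀ t → φ A ∘P (φ (adj A) ∘P t) ≡ t
    φ-undo {A} i t = trans (sym (∘P-assoc (φ A) (φ (adj A)) t)) (trans (cong (_∘P t) (φ-adjʳ i)) (∘P-idˡ t))

    φ-equal⇒scalar : ∀ {A B} → Invertible A → Invertible B → φ A ≡ φ B → Scalar (adj A · B)
    φ-equal⇒scalar {A} {B} i j e = φ-kernel (adj A · B) (invertible-· (invertible-adj i) j)
      (trans (φ-· (adj A) B (invertible-adj i) j) (trans (cong (φ (adj A) ∘P_) (sym e)) (φ-adjˡ i)))

    PSL : Perm n → Set
    PSL t = ∃[ A ] (Unimodular A × φ A ≡ t)

    PSL-aut : ∀ {t} → PSL t → IsAut X t
    PSL-aut (A , u , e) = subst (IsAut X) e (φ-aut A (special-invertible u))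

    PSL-∘ : ∀ {s t} → PSL s → PSL t → PSL (s ∘P t)
    PSL-∘ (A , u , refl) (B , v , refl) = A · B , unimodular-· u v , φ-· A B (special-invertible u) (special-invertible v)

    I-invertible : Invertible I
    I-invertible = special-invertible det-I

    φ-I : φ I ≡ 1P
    φ-I = φ-scalar I I-invertible (refl , refl , refl)

    PSL-inverse : ∀ {t} → PSL t → ∃[ s ] (PSL s × s ∘P t ≡ 1P × t ∘P s ≡ 1P)
    PSL-inverse (A , u , refl) = φ (adj A) , (adj A , unimodular-adj u , refl) , φ-adjˡ (special-invertible u) , φ-adjʳ (special-invertible u)

    abstract
      PSL-arc-transitive : ∀ {u v u′ v′} → Arc X u v → Arc X u′ v′ → ∃[ s ] (PSL s × app s u ≡ u′ × app s v ≡ v′)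
      PSL-arc-transitive a b = let A , s , e , f = proj₁ psl _ _ _ _ a b in φ A , (A , s , refl) , e , f

    PSL-fixes-arc : ∀ {t} {u v} → PSL t → Arc X u v → app t u ≡ u → app t v ≡ v → t ≡ 1P
    PSL-fixes-arc {u = u} {v} (A , s , refl) a eu ev = trans (proj₂ psl u v A I a s det-I (at-I eu) (at-I ev)) φ-I
      where
      at-I : ∀ {i} → app (φ A) i ≡ i → app (φ A) i ≡ app (φ I) i
      at-I {i} e = trans e (sym (trans (cong (λ t → app t i) φ-I) (app-id i)))

    scalar-square : ∀ {A} → Scalar A → IsSquare (det A)
    scalar-square {mat a b c d} (refl , refl , refl) = a , solve 1 (λ a → a :* a := a :* a :- :0 :* :0) refl a

    -- Matrices with the same image differ by a scalar, whose determinant is a square; so the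
    -- determinant modulo squares detects PSL(2,q).
    PSL⇒square : ∀ {A} → Invertible A → PSL (φ A) → IsSquare (det A)
    PSL⇒square {A} i (B , u , e) = subst IsSquare (trans (det-· (adj B) A) (trans (cong (_⊛ det A) (unimodular-adj u)) (*-identityˡ _)))
      (scalar-square (φ-equal⇒scalar (special-invertible u) i e))

    square⇒PSL : ∀ {A} → Invertible A → IsSquare (det A) → PSL (φ A)
    square⇒PSL {A} i (s , e) = inv s • A , trans (det-• (inv s) A) (trans (cong (inv s ⊛ inv s ⊛_) (sym e))
        (trans (solve 2 (λ s i → i :* i :* (s :* s) := (s :* i) :* (s :* i)) refl s (inv s)) (trans (cong₂ _⊛_ (inv-* s≢0) (inv-* s≢0)) (*-identityˡ 1F))))
        , φ-• (inv-≢0 s≢0) i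
      where
      s≢0 : s ≢ 0F
      s≢0 z = i (trans (sym e) (trans (cong₂ _⊛_ z z) (zeroˡ 0F)))

    -- b, c and a - d are the coordinates of A modulo scalars, so one of them can be cancelled.
    nonscalar-witness : ∀ {A k} → ¬ Scalar A → (Mat.b A ⊛ k ≡ 0F) → (Mat.c A ⊛ k ≡ 0F) → ((Mat.a A ⊖ Mat.d A) ⊛ k ≡ 0F) → k ≡ 0F
    nonscalar-witness {mat a b c d} {k} n eb ec ea with k ≟ 0F
    ... | yes z = z
    ... | no k≢0 = ⊥-elim (n (cancel eb , cancel ec , 0-diff (cancel ea)))
      where
      cancel : ∀ {x} → x ⊛ k ≡ 0F → x ≡ 0F
      cancel {x} e = cancel-* k≢0 (trans (*-comm k x) e)

    -- By Cayley–Hamilton A² = tr A · A - det A.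
    square-scalar : ∀ {A} → ¬ Scalar A → Scalar (A · A) → tr A ≡ 0F
    square-scalar {A@(mat a b c d)} n (eb , ec , ea) = nonscalar-witness {A} n
      (trans (solve 4 (λ a b c d → b :* (a :+ d) := a :* b :+ b :* d) refl a b c d) eb)
      (trans (solve 4 (λ a b c d → c :* (a :+ d) := c :* a :+ d :* c) refl a b c d) ec)
      (trans (solve 4 (λ a b c d → (a :- d) :* (a :+ d) := (a :* a :+ b :* c) :- (c :* b :+ d :* d)) refl a b c d) (diff-0 ea))

    -- Cayley-Hamilton gives A³ = (tr² - det) A - tr · det · I, so the coefficient of A has to
    -- vanish.
    cube-scalar : ∀ {A} → ¬ Scalar A → Scalar (A · (A · A)) → tr A ⊛ tr A ≡ det A
    cube-scalar {A@(mat a b c d)} n (eb , ec , ea) = 0-diff (nonscalar-witness {A} n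
      (trans (solve 4 (λ a b c d → b :* ((a :+ d) :* (a :+ d) :- (a :* d :- b :* c)) := a :* (a :* b :+ b :* d) :+ b :* (c :* b :+ d :* d)) refl a b c d) eb)
      (trans (solve 4 (λ a b c d → c :* ((a :+ d) :* (a :+ d) :- (a :* d :- b :* c)) := c :* (a :* a :+ b :* c) :+ d :* (c :* a :+ d :* c)) refl a b c d) ec)
      (trans (solve 4 (λ a b c d → (a :- d) :* ((a :+ d) :* (a :+ d) :- (a :* d :- b :* c))
        := (a :* (a :* a :+ b :* c) :+ b :* (c :* a :+ d :* c)) :- (c :* (a :* b :+ b :* d) :+ d :* (c :* b :+ d :* d))) refl a b c d) (diff-0 ea)))

    φ-square-scalar : ∀ {A} → Invertible A → φ A ∘P φ A ≡ 1P → Scalar (A · A)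
    φ-square-scalar {A} i e = φ-kernel (A · A) (invertible-· i i) (trans (φ-· A A i i) e)

    φ-cube-scalar : ∀ {A} → Invertible A → φ A ∘P (φ A ∘P φ A) ≡ 1P → Scalar (A · (A · A))
    φ-cube-scalar {A} i e = φ-kernel (A · (A · A)) (invertible-· i (invertible-· i i))
      (trans (φ-· A (A · A) i (invertible-· i i)) (trans (cong (φ A ∘P_) (φ-· A A i i)) e))

    -- Order 3 means tr² = det = 1. The involutions fixing a vertex also fix an arc, which
    -- arc-regularity forbids in PSL(2,q).
    special-stabiliser : ∀ {A v} → Unimodular A → app (φ A) v ≡ v → φ A ≢ 1P → Sgn (tr A)
    special-stabiliser {A} {v} u e n = [ cycle , reflection ]′ (AtVertex.stabiliser-structure v (φ A) (φ-aut A i) e)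
      where
      i : Invertible A
      i = special-invertible u
      sign : tr A ≡ 1F ⊎ tr A ≡ -1F → Sgn (tr A)
      sign (inj₁ p) = Sign.+ , p
      sign (inj₂ p) = Sign.- , p
      cycle : φ A ∘P (φ A ∘P φ A) ≡ 1P → Sgn (tr A)
      cycle c = sign (same-square (trans (cube-scalar (n ∘ φ-scalar A i) (φ-cube-scalar i c)) (trans u (sym (*-identityˡ 1F)))))
      reflection : (∃[ j ] app (φ A) (AtVertex.nbr v j) ≡ AtVertex.nbr v j) × φ A ∘P φ A ≡ 1P → Sgn (tr A)
      reflection ((j , f) , _) = ⊥-elim (n (PSL-fixes-arc (A , u , refl) (AtVertex.nbr-arc v j) e f))

    -- Order 3 would make det = tr² a square; an involution has trace 0.
    nonspecial-stabiliser : ∀ {A v} → Invertible A → ¬ IsSquare (det A) → app (φ A) v ≡ v → tr A ≡ 0F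
    nonspecial-stabiliser {A} {v} i n e = [ rotation , reflection ]′ (AtVertex.stabiliser-structure v (φ A) (φ-aut A i) e)
      where
      rotation : φ A ∘P (φ A ∘P φ A) ≡ 1P → tr A ≡ 0F
      rotation c = ⊥-elim (n (tr A , cube-scalar (n ∘ scalar-square) (φ-cube-scalar i c)))
      reflection : (∃[ j ] app (φ A) (AtVertex.nbr v j) ≡ AtVertex.nbr v j) × φ A ∘P φ A ≡ 1P → tr A ≡ 0F
      reflection (_ , c) = square-scalar (n ∘ scalar-square) (φ-square-scalar i c)

    -- Nonscalar matrices with the same characteristic polynomial are conjugate to the same companion matrix.
    companion : Fin q → Fin q → Mat q
    companion t e = mat 0F (-F e) 1F t

    abstract
      cyclic : ∀ A → ¬ Scalar A → ∃[ Q ] (Invertible Q × A · Q ≡ Q · companion (tr A) (det A))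
      cyclic A@(mat a b c d) n with c ≟ 0F | b ≟ 0F
      -- The columns of Q are a cyclic vector and its image: e₁ if c is nonzero, e₂ if b is nonzero,
      -- and e₁ + e₂ for a nonscalar diagonal matrix.
      ... | no c≢0 | _ = mat 1F a 0F c , (λ e → c≢0 (trans (solve 2 (λ a c → c := :1 :* c :- a :* :0) refl a c) e)) , mat-cong
        (solve 4 (λ a b c d → a :* :1 :+ b :* :0 := :1 :* :0 :+ a :* :1) refl a b c d)
        (solve 4 (λ a b c d → a :* a :+ b :* c := :1 :* (:- (a :* d :- b :* c)) :+ a :* (a :+ d)) refl a b c d)
        (solve 4 (λ a b c d → c :* :1 :+ d :* :0 := :0 :* :0 :+ c :* :1) refl a b c d)
        (solve 4 (λ a b c d → c :* a :+ d :* c := :0 :* (:- (a :* d :- b :* c)) :+ c :* (a :+ d)) refl a b c d)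
      ... | yes _ | no b≢0 = mat 0F b 1F d , (λ e → b≢0 (comb₁ -1F (solve 2 (λ b d → b :- :0 := :-1 :* ((:0 :* d :- b :* :1) :- :0)) refl b d) e)) , mat-cong
        (solve 4 (λ a b c d → a :* :0 :+ b :* :1 := :0 :* :0 :+ b :* :1) refl a b c d)
        (solve 4 (λ a b c d → a :* b :+ b :* d := :0 :* (:- (a :* d :- b :* c)) :+ b :* (a :+ d)) refl a b c d)
        (solve 4 (λ a b c d → c :* :0 :+ d :* :1 := :1 :* :0 :+ d :* :1) refl a b c d)
        (solve 4 (λ a b c d → c :* b :+ d :* d := :1 :* (:- (a :* d :- b :* c)) :+ d :* (a :+ d)) refl a b c d)
      cyclic (mat a b c d) n | yes refl | yes refl = mat 1F a 1F d , (λ e → n (refl , refl , comb₁ -1F (solve 2 (λ a d → a :- d := :-1 :* ((:1 :* d :- a :* :1) :- :0)) refl a d) e)) , mat-cong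
        (solve 2 (λ a d → a :* :1 :+ :0 :* :1 := :1 :* :0 :+ a :* :1) refl a d)
        (solve 2 (λ a d → a :* a :+ :0 :* d := :1 :* (:- (a :* d :- :0 :* :0)) :+ a :* (a :+ d)) refl a d)
        (solve 2 (λ a d → :0 :* :1 :+ d :* :1 := :1 :* :0 :+ d :* :1) refl a d)
        (solve 2 (λ a d → :0 :* a :+ d :* d := :1 :* (:- (a :* d :- :0 :* :0)) :+ d :* (a :+ d)) refl a d)

    fixes-vertex-of-conjugate : ∀ {A B Q R C v} → Invertible A → Invertible B → Invertible Q → Invertible R → Invertible C →
      A · Q ≡ Q · C → B · R ≡ R · C → app (φ B) v ≡ v → ∃[ w ] app (φ A) w ≡ w
    fixes-vertex-of-conjugate {A} {B} {Q} {R} {C} {v} iA iB iQ iR iC AQ BR e = app (φ Q) u , (begin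
      app (φ A) (app (φ Q) u) ≡⟨ sym (app-∘ (φ A) (φ Q) u) ⟩
      app (φ A ∘P φ Q) u ≡⟨ cong (λ t → app t u) (trans (sym (φ-· A Q iA iQ)) (trans (cong φ AQ) (φ-· Q C iQ iC))) ⟩
      app (φ Q ∘P φ C) u ≡⟨ app-∘ (φ Q) (φ C) u ⟩
      app (φ Q) (app (φ C) u) ≡⟨ cong (app (φ Q)) Cu ⟩
      app (φ Q) u ∎)
      where
      open ≡-Reasoning
      u : Fin n
      u = app (φ (adj R)) v
      Ru : app (φ R) u ≡ v
      Ru = trans (sym (app-∘ (φ R) (φ (adj R)) v)) (trans (cong (λ t → app t v) (φ-adjʳ iR)) (app-id v))
      Cu : app (φ C) u ≡ u
      Cu = proj₁ (φ-aut R iR) _ _ (begin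
        app (φ R) (app (φ C) u) ≡⟨ sym (app-∘ (φ R) (φ C) u) ⟩
        app (φ R ∘P φ C) u ≡⟨ cong (λ t → app t u) (trans (sym (φ-· R C iR iC)) (trans (cong φ (sym BR)) (φ-· B R iB iR))) ⟩
        app (φ B ∘P φ R) u ≡⟨ app-∘ (φ B) (φ R) u ⟩
        app (φ B) (app (φ R) u) ≡⟨ cong (app (φ B)) Ru ⟩
        app (φ B) v ≡⟨ e ⟩
        v ≡⟨ sym Ru ⟩
        app (φ R) u ∎)

    companion-invertible : ∀ t {e} → e ≢ 0F → Invertible (companion t e)
    companion-invertible t {e} n z = n (trans (solve 2 (λ t e → e := :0 :* t :- (:- e) :* :1) refl t e) z)

    abstract
      -- Fixing some vertex is invariant under conjugation. Hence one stabiliser element of each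
      -- kind yields the converses of the two stabiliser lemmas.
      same-characteristic-polynomial : ∀ {A B v} → Invertible A → ¬ Scalar A → ¬ Scalar B → tr A ≡ tr B → det A ≡ det B →
        app (φ B) v ≡ v → ∃[ w ] app (φ A) w ≡ w
      same-characteristic-polynomial {A} {B} iA nA nB et ed e =
        let Q , iQ , AQ = cyclic A nA ; R , iR , BR = cyclic B nB in
        fixes-vertex-of-conjugate iA (λ z → iA (trans ed z)) iQ iR (companion-invertible (tr A) iA)
          AQ (trans BR (cong (R ·_) (cong₂ companion (sym et) (sym ed)))) e

    -- The reflection at an arc and the index of PSL(2,q)

    module BasePoint (v₀ : Fin n) where
      open AtVertex v₀ using (nbr; nbr-arc; nbr-injective; index; nbr-≢)

      w₀ w₁ w₂ : Fin n
      w₀ = nbr zero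
      w₁ = nbr (suc zero)
      w₂ = nbr (suc (suc zero))

      arc₀ : Arc X v₀ w₀
      arc₀ = nbr-arc zero

      other : ∀ t → IsAut X t → app t v₀ ≡ v₀ → app t w₀ ≡ w₀ → app t w₁ ≡ w₁ ⊎ app t w₁ ≡ w₂
      other t a ev e₀ with index (subst (λ u → Arc X u (app t w₁)) ev (aut-arc t a (nbr-arc (suc zero))))
      ... | suc zero , e = inj₁ (sym e)
      ... | suc (suc zero) , e = inj₂ (sym e)
      ... | zero , e = ⊥-elim (nbr-≢ {zero} {suc zero} (λ ()) (proj₁ a _ _ (trans e₀ e)))

      reflection : ∃[ t ] (IsAut X t × app t w₀ ≡ w₀ × app t v₀ ≡ v₀ × app t w₁ ≡ w₂)
      reflection = proj₁ regular w₀ v₀ w₁ w₀ v₀ w₂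
        (Arc-sym arc₀ , nbr-arc (suc zero) , nbr-≢ λ ()) (Arc-sym arc₀ , nbr-arc (suc (suc zero)) , nbr-≢ λ ())

      τ : Perm n
      τ = proj₁ reflection
      τ-aut : IsAut X τ
      τ-aut = proj₁ (proj₂ reflection)
      τ-w₀ : app τ w₀ ≡ w₀
      τ-w₀ = proj₁ (proj₂ (proj₂ reflection))
      τ-v₀ : app τ v₀ ≡ v₀
      τ-v₀ = proj₁ (proj₂ (proj₂ (proj₂ reflection)))
      τ-w₁ : app τ w₁ ≡ w₂
      τ-w₁ = proj₂ (proj₂ (proj₂ (proj₂ reflection)))

      abstract
        -- An arc stabiliser acts faithfully on the other two neighbours of the vertex.
        id-or-τ : ∀ t → IsAut X t → app t v₀ ≡ v₀ → app t w₀ ≡ w₀ → t ≡ 1P ⊎ t ≡ τ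
        id-or-τ t a ev e₀ with other t a ev e₀
        ... | inj₁ e₁ = inj₁ (fixes-two-arc t a arc₀ (nbr-arc (suc zero)) (nbr-≢ λ ()) ev e₀ e₁)
        ... | inj₂ e₁ = inj₂ (proj₂ regular w₀ v₀ w₁ t τ (Arc-sym arc₀ , nbr-arc (suc zero) , nbr-≢ λ ()) a τ-aut
                (trans e₀ (sym τ-w₀)) (trans ev (sym τ-v₀)) (trans e₁ (sym τ-w₁)))

      τ≢id : τ ≢ 1P
      τ≢id e = nbr-≢ {suc zero} {suc (suc zero)} (λ ()) (trans (sym (app-id w₁)) (trans (cong (λ t → app t w₁) (sym e)) τ-w₁))

      τ∉PSL : ¬ PSL τ
      τ∉PSL p = τ≢id (PSL-fixes-arc p arc₀ τ-v₀ τ-w₀)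

      τ² : τ ∘P τ ≡ 1P
      τ² with id-or-τ (τ ∘P τ) (aut-∘ τ τ τ-aut τ-aut) (trans (app-∘ τ τ v₀) (trans (cong (app τ) τ-v₀) τ-v₀)) (trans (app-∘ τ τ w₀) (trans (cong (app τ) τ-w₀) τ-w₀))
      ... | inj₁ e = e
      ... | inj₂ e = ⊥-elim (nbr-≢ {suc zero} {suc (suc zero)} (λ ()) (proj₁ τ-aut w₁ w₂
              (trans τ-w₁ (trans (sym τ-w₁) (trans (cong (λ t → app t w₁) (sym e)) (trans (app-∘ τ τ w₁) (cong (app τ) τ-w₁)))))))

      τ-undo : ∀ t → (t ∘P τ) ∘P τ ≡ t
      τ-undo t = trans (∘P-assoc t τ τ) (trans (cong (t ∘P_) τ²) (∘P-idʳ t))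

      abstract
        agree : ∀ s s′ t → IsAut X s′ → IsAut X t → s′ ∘P s ≡ 1P → s ∘P s′ ≡ 1P → app s v₀ ≡ app t v₀ → app s w₀ ≡ app t w₀ → t ≡ s ⊎ t ≡ s ∘P τ
        agree s s′ t a b l r ev e₀ with id-or-τ (s′ ∘P t) (aut-∘ s′ t a b) (fix ev) (fix e₀)
          where
          fix : ∀ {i} → app s i ≡ app t i → app (s′ ∘P t) i ≡ i
          fix {i} e = trans (app-∘ s′ t i) (trans (cong (app s′) (sym e)) (trans (sym (app-∘ s′ s i)) (trans (cong (λ t → app t i) l) (app-id i))))
        ... | inj₁ e = inj₁ (trans (sym (∘P-idˡ t)) (trans (cong (_∘P t) (sym r)) (trans (∘P-assoc s s′ t) (trans (cong (s ∘P_) e) (∘P-idʳ s)))))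
        ... | inj₂ e = inj₂ (trans (sym (∘P-idˡ t)) (trans (cong (_∘P t) (sym r)) (trans (∘P-assoc s s′ t) (cong (s ∘P_) e))))

      abstract
        -- Some element of PSL(2,q) moves the base arc exactly as t does, and the two differ by an
        -- element of the arc stabiliser.
        PSL-or-reflected : ∀ t → IsAut X t → PSL t ⊎ ∃[ s ] (PSL s × t ≡ s ∘P τ)
        PSL-or-reflected t a with PSL-arc-transitive arc₀ (aut-arc t a arc₀)
        ... | s , p , ev , e₀ with PSL-inverse p
        ...   | s′ , p′ , l , r with agree s s′ t (PSL-aut p′) a l r ev e₀
        ...     | inj₁ refl = inj₁ p
        ...     | inj₂ e = inj₂ (s , p , e)

      abstract
        reflectionMatrix : ∃[ A ] (Invertible A × φ A ≡ τ)
        reflectionMatrix = φ-surjective τ τ-aut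

      T : Mat q
      T = proj₁ reflectionMatrix
      T-invertible : Invertible T
      T-invertible = proj₁ (proj₂ reflectionMatrix)
      φT : φ T ≡ τ
      φT = proj₂ (proj₂ reflectionMatrix)

      δ : Fin q
      δ = det T

      δ-nonsquare : ¬ IsSquare δ
      δ-nonsquare s = τ∉PSL (subst PSL φT (square⇒PSL T-invertible s))

      diagonal : Fin q → Mat q
      diagonal x = mat x 0F 0F 1F

      det-diagonal : ∀ x → det (diagonal x) ≡ x
      det-diagonal x = solve 1 (λ x → x :* :1 :- :0 :* :0 := x) refl x

      module _ {x : Fin q} (x≢0 : x ≢ 0F) where
        private
          D : Mat q
          D = diagonal x
          D-invertible : Invertible D
          D-invertible e = x≢0 (trans (sym (det-diagonal x)) e)

        abstract
          -- That the squares have index two in the multiplicative group is read off the index of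
          -- PSL(2,q), through the matrices diag(x, 1).
          square-or-δ-square : IsSquare x ⊎ IsSquare (x ⊛ δ)
          square-or-δ-square = [ special , reflected ]′ (PSL-or-reflected (φ D) (φ-aut D D-invertible))
            where
            special : PSL (φ D) → IsSquare x ⊎ IsSquare (x ⊛ δ)
            special p = inj₁ (subst IsSquare (det-diagonal x) (PSL⇒square D-invertible p))
            reflected : (∃[ s ] (PSL s × φ D ≡ s ∘P τ)) → IsSquare x ⊎ IsSquare (x ⊛ δ)
            reflected (s , p , e) = inj₂ (subst IsSquare (trans (det-· D T) (cong (_⊛ δ) (det-diagonal x)))
              (PSL⇒square (invertible-· D-invertible T-invertible) (subst PSL (sym
                (trans (φ-· D T D-invertible T-invertible) (trans (cong₂ _∘P_ e φT) (τ-undo s)))) p)))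

      nonsquare-≢0 : ∀ {x} → ¬ IsSquare x → x ≢ 0F
      nonsquare-≢0 n refl = n (0F , zeroˡ 0F)

      abstract
        nonsquare⇒δ-square : ∀ {x} → ¬ IsSquare x → IsSquare (x ⊛ δ)
        nonsquare⇒δ-square {x} n = [ (λ s → ⊥-elim (n s)) , (λ s → s) ]′ (square-or-δ-square {x} (nonsquare-≢0 n))

      δ≢0 : δ ≢ 0F
      δ≢0 = nonsquare-≢0 δ-nonsquare

      nonsquare-* : ∀ {x y} → ¬ IsSquare x → ¬ IsSquare y → IsSquare (x ⊛ y)
      nonsquare-* {x} {y} n m = let s , e = nonsquare⇒δ-square n ; t , f = nonsquare⇒δ-square m in
        square-ratio {δ} {x ⊛ y} {s ⊛ t} δ≢0 (trans (solve 3 (λ x y d → (d :* d) :* (x :* y) := (x :* d) :* (y :* d)) refl x y δ)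
          (trans (cong₂ _⊛_ (sym e) (sym f)) (solve 2 (λ s t → (s :* s) :* (t :* t) := (s :* t) :* (s :* t)) refl s t)))

      rotation : ∃[ S ] (Unimodular S × app (φ S) v₀ ≡ v₀ × φ S ≢ 1P)
      rotation with PSL-arc-transitive arc₀ (nbr-arc (suc zero))
      ... | _ , (S , u , refl) , ev , e₀ = S , u , ev , λ e → nbr-≢ {zero} {suc zero} (λ ())
              (trans (sym (app-id w₀)) (trans (cong (λ t → app t w₀) (sym e)) e₀))

      -- A is compared with a rotation about `v₀`, whose trace is also ±1. Where the traces have
      -- opposite signs, A is replaced by -A, which has the same image.
      special-fixes-vertex : ∀ {A} → Unimodular A → ¬ Scalar A → Sgn (tr A) → ∃[ w ] app (φ A) w ≡ w
      special-fixes-vertex {A} u n σ with rotation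
      ... | S , uS , ev , S≢1 = rescaled (special-stabiliser uS ev S≢1) σ
        where
        nS : ¬ Scalar S
        nS s = S≢1 (φ-scalar S (special-invertible uS) s)
        same : tr A ≡ tr S → ∃[ w ] app (φ A) w ≡ w
        same e = same-characteristic-polynomial (special-invertible u) n nS e (trans u (sym uS)) ev
        A′ : Mat q
        A′ = -1F • A
        -1≢0 : -1F ≢ 0F
        -1≢0 = neg-≢0 1≢0
        tr-A′ : tr A′ ≡ -F tr A
        tr-A′ = solve 2 (λ a d → :-1 :* a :+ :-1 :* d := :- (a :+ d)) refl (Mat.a A) (Mat.d A)
        negated : -F tr A ≡ tr S → ∃[ w ] app (φ A) w ≡ w
        negated e = let w , f = same-characteristic-polynomial {A′} {S} (special-invertible uA′) nA′ nS (trans tr-A′ e) (trans uA′ (sym uS)) ev in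
            w , trans (cong (λ t → app t w) (sym (φ-• -1≢0 (special-invertible u)))) f
          where
          uA′ : Unimodular A′
          uA′ = trans (det-• -1F A) (trans (cong₂ _⊛_ (sgn-square (Sign.- , refl)) u) (*-identityˡ 1F))
          nA′ : ¬ Scalar A′
          nA′ (p , r , t) = n (cancel-* -1≢0 p , cancel-* -1≢0 r , *-cancelˡ -1≢0 t)
        rescaled : Sgn (tr S) → Sgn (tr A) → ∃[ w ] app (φ A) w ≡ w
        rescaled (Sign.+ , e) (Sign.+ , f) = same (trans f (sym e))
        rescaled (Sign.- , e) (Sign.- , f) = same (trans f (sym e))
        rescaled (Sign.+ , e) (Sign.- , f) = negated (trans (cong -F_ f) (trans (-‿involutive 1F) (sym e)))
        rescaled (Sign.- , e) (Sign.+ , f) = negated (trans (cong -F_ f) (sym e))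

      tr-T : tr T ≡ 0F
      tr-T = nonspecial-stabiliser T-invertible δ-nonsquare (trans (cong (λ t → app t v₀) φT) τ-v₀)

      -- From det A · δ = s² it follows that (s/δ)T has determinant det A, and both traces are 0.
      nonspecial-fixes-vertex : ∀ {A} → ¬ IsSquare (det A) → tr A ≡ 0F → ∃[ w ] app (φ A) w ≡ w
      nonspecial-fixes-vertex {A} n e with nonsquare⇒δ-square n
      ... | s , f = same-characteristic-polynomial {A} {r • T} (nonsquare-≢0 n) (n ∘ scalar-square) nT (trans e (sym tr-rT)) (sym det-rT)
            (trans (cong (λ t → app t v₀) (trans (φ-• r≢0 T-invertible) φT)) τ-v₀)
        where
        r : Fin q
        r = s ⊛ inv δ
        det-rT : det (r • T) ≡ det A
        det-rT = trans (det-• r T) (comb₂ (inv δ ⊛ inv δ ⊛ δ) (det A ⊛ (δ ⊛ inv δ ⊕ 1F))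
          (solve 4 (λ s i d a → (s :* i) :* (s :* i) :* d :- a := (i :* i :* d) :* (s :* s :- a :* d) :+ (a :* (d :* i :+ :1)) :* (d :* i :- :1)) refl s (inv δ) δ (det A))
          f (inv-* δ≢0))
        r≢0 : r ≢ 0F
        r≢0 z = nonsquare-≢0 n (trans (sym det-rT) (trans (det-• r T) (trans (cong (_⊛ δ) (trans (cong (_⊛ r) z) (zeroˡ r))) (zeroˡ δ))))
        tr-rT : tr (r • T) ≡ 0F
        tr-rT = trans (sym (distribˡ r (Mat.a T) (Mat.d T))) (trans (cong (r ⊛_) tr-T) (zeroʳ r))
        nT : ¬ Scalar (r • T)
        nT s = n (subst IsSquare det-rT (scalar-square s))

      _≟P_ : (s t : Perm n) → Dec (s ≡ t)
      _≟P_ = ≡-dec _≟_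

      _Lists_ : List (Perm n) → (Perm n → Set) → Set
      hs Lists P = (∀ t → t ∈ hs → P t) × (∀ t → P t → t ∈ hs)

      upper lower : Fin q → Mat q
      upper x = mat 1F x 0F 1F
      lower x = mat 1F 0F x 1F

      upper-unimodular : ∀ x → Unimodular (upper x)
      upper-unimodular x = solve 1 (λ x → :1 :* :1 :- x :* :0 := :1) refl x

      lower-unimodular : ∀ x → Unimodular (lower x)
      lower-unimodular x = solve 1 (λ x → :1 :* :1 :- :0 :* x := :1) refl x

      upper-· : ∀ x y → upper x · upper y ≡ upper (x ⊕ y)
      upper-· x y = mat-cong
        (solve 2 (λ x y → :1 :* :1 :+ x :* :0 := :1) refl x y)
        (solve 2 (λ x y → :1 :* y :+ x :* :1 := x :+ y) refl x y)
        (solve 2 (λ x y → :0 :* :1 :+ :1 :* :0 := :0) refl x y)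
        (solve 2 (λ x y → :0 :* y :+ :1 :* :1 := :1) refl x y)

      lower-· : ∀ x y → lower x · lower y ≡ lower (x ⊕ y)
      lower-· x y = mat-cong
        (solve 2 (λ x y → :1 :* :1 :+ :0 :* y := :1) refl x y)
        (solve 2 (λ x y → :1 :* :0 :+ :0 :* :1 := :0) refl x y)
        (solve 2 (λ x y → x :* :1 :+ :1 :* y := x :+ y) refl x y)
        (solve 2 (λ x y → x :* :0 :+ :1 :* :1 := :1) refl x y)

      -- The two outer parameters are solved from the diagonal entries, where c is inverted; the
      -- determinant then forces the entry b.
      transvection-product : ∀ {a b c d} → c ≢ 0F → Unimodular (mat a b c d) →
        mat a b c d ≡ upper ((a ⊖ 1F) ⊛ inv c) · (lower c · upper ((d ⊖ 1F) ⊛ inv c))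
      transvection-product {a} {b} {c} {d} c≢0 u = sym (mat-cong
        (comb₁ 1F (solve 4 (λ a c x y → :1 :* (:1 :* :1 :+ :0 :* :0) :+ x :* (c :* :1 :+ :1 :* :0) :- a
          := :1 :* (c :* x :- (a :- :1))) refl a c x y) cx)
        (*-cancelˡ c≢0 (comb₃ (c ⊛ y ⊕ 1F) a 1F (solve 6 (λ a b c d x y → c :* (:1 :* (:1 :* y :+ :0 :* :1) :+ x :* (c :* y :+ :1 :* :1)) :- c :* b
          := (c :* y :+ :1) :* (c :* x :- (a :- :1)) :+ a :* (c :* y :- (d :- :1)) :+ :1 :* (a :* d :- b :* c :- :1)) refl a b c d x y) cx cy u))
        (solve 2 (λ c y → :0 :* (:1 :* :1 :+ :0 :* :0) :+ :1 :* (c :* :1 :+ :1 :* :0) := c) refl c y)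
        (comb₁ 1F (solve 3 (λ c d y → :0 :* (:1 :* y :+ :0 :* :1) :+ :1 :* (c :* y :+ :1 :* :1) :- d
          := :1 :* (c :* y :- (d :- :1))) refl c d y) cy))
        where
        x y : Fin q
        x = (a ⊖ 1F) ⊛ inv c
        y = (d ⊖ 1F) ⊛ inv c
        cx : c ⊛ x ≡ a ⊖ 1F
        cx = divide-* (a ⊖ 1F) c≢0
        cy : c ⊛ y ≡ d ⊖ 1F
        cy = divide-* (d ⊖ 1F) c≢0

      -- Arc-transitive subgroups

      module Subgroup (hs : List (Perm n)) (subgroup : IsAutSubgroup X hs) (transitive : ArcTransitive X hs) where

        auts : All (IsAut X) hs
        auts = proj₁ (proj₂ subgroup)
        compose : ∀ {s t} → s ∈ hs → t ∈ hs → (s ∘P t) ∈ hs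
        compose = proj₁ (proj₂ (proj₂ (proj₂ subgroup)))

        aut : ∀ {t} → t ∈ hs → IsAut X t
        aut = All.lookup auts

        abstract
          inverse-of : ∀ {t} → t ∈ hs → ∃[ s ] (s ∈ hs × s ∘P t ≡ 1P × t ∘P s ≡ 1P)
          inverse-of {t} t∈ = let s , s∈ , l = inverses t∈ ; s′ , _ , l′ = inverses s∈ in
            s , s∈ , l , subst (λ r → r ∘P s ≡ 1P) (sym (same {s} {s′} l l′)) l′
            where
            inverses : ∀ {t} → t ∈ hs → ∃[ s ] (s ∈ hs × s ∘P t ≡ 1P)
            inverses = proj₂ (proj₂ (proj₂ (proj₂ subgroup)))
            same : ∀ {s s′} → s ∘P t ≡ 1P → s′ ∘P s ≡ 1P → t ≡ s′
            same {s} {s′} l l′ = trans (sym (∘P-idˡ t)) (trans (cong (_∘P t) (sym l′)) (trans (∘P-assoc s′ s t) (trans (cong (s′ ∘P_) l) (∘P-idʳ s′))))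

          member-or-reflected : ∀ t → IsAut X t → t ∈ hs ⊎ ∃[ h ] (h ∈ hs × t ≡ h ∘P τ)
          member-or-reflected t a =
            let h , h∈ , ev , e₀ = transitive _ _ _ _ arc₀ (aut-arc t a arc₀)
                h′ , h′∈ , l , r = inverse-of h∈
            in [ (λ e → inj₁ (subst (_∈ hs) (sym e) h∈)) , (λ e → inj₂ (h , h∈ , e)) ]′ (agree h h′ t (aut h′∈) a l r ev e₀)

          -- Let t = hτ. Either τh lies in the subgroup, and then so do τ and t, or τh = kτ with k
          -- in the subgroup and t² = hτhτ = hk.
          square-member : ∀ t → IsAut X t → (t ∘P t) ∈ hs
          square-member t a = [ (λ t∈ → compose t∈ t∈) , reflected ]′ (member-or-reflected t a)
            where
            reflected : ∃[ h ] (h ∈ hs × t ≡ h ∘P τ) → (t ∘P t) ∈ hs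
            reflected (h , h∈ , e) = [ τ-member , τ-nonmember ]′ (member-or-reflected (τ ∘P h) (aut-∘ τ h τ-aut (aut h∈)))
              where
              τ-member : (τ ∘P h) ∈ hs → (t ∘P t) ∈ hs
              τ-member τh∈ = let h′ , h′∈ , _ , r = inverse-of h∈
                                 τ∈ = subst (_∈ hs) (trans (∘P-assoc τ h h′) (trans (cong (τ ∘P_) r) (∘P-idʳ τ))) (compose τh∈ h′∈)
                                 t∈ = subst (_∈ hs) (sym e) (compose h∈ τ∈)
                             in compose t∈ t∈
              τ-nonmember : ∃[ k ] (k ∈ hs × τ ∘P h ≡ k ∘P τ) → (t ∘P t) ∈ hs
              τ-nonmember (k , k∈ , f) = subst (_∈ hs) (sym t²) (compose h∈ k∈)
                where
                open ≡-Reasoning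
                t² : t ∘P t ≡ h ∘P k
                t² = begin
                  t ∘P t ≡⟨ cong₂ _∘P_ e e ⟩
                  (h ∘P τ) ∘P (h ∘P τ) ≡⟨ ∘P-assoc h τ (h ∘P τ) ⟩
                  h ∘P (τ ∘P (h ∘P τ)) ≡⟨ cong (h ∘P_) (sym (∘P-assoc τ h τ)) ⟩
                  h ∘P ((τ ∘P h) ∘P τ) ≡⟨ cong (λ s → h ∘P (s ∘P τ)) f ⟩
                  h ∘P ((k ∘P τ) ∘P τ) ≡⟨ cong (h ∘P_) (τ-undo k) ⟩
                  h ∘P k ∎

        -- Every transvection is a square in odd characteristic, and the squares lie in a subgroup of index at most two.
        module _ (2≢0 : 2F ≢ 0F) where
          half : Fin q → Fin q
          half x = x ⊛ inv 2F

          half+half : ∀ x → half x ⊕ half x ≡ x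
          half+half x = trans (solve 2 (λ x i → x :* i :+ x :* i := :2 :* (x :* i)) refl x (inv 2F)) (divide-* x 2≢0)

          abstract
            upper-member : ∀ x → φ (upper x) ∈ hs
            upper-member x = subst (_∈ hs) (trans (sym (φ-· u u i i)) (cong φ (trans (upper-· (half x) (half x)) (cong upper (half+half x)))))
                (square-member (φ u) (φ-aut u i))
              where
              u : Mat q
              u = upper (half x)
              i : Invertible u
              i = special-invertible (upper-unimodular (half x))

            lower-member : ∀ x → φ (lower x) ∈ hs
            lower-member x = subst (_∈ hs) (trans (sym (φ-· u u i i)) (cong φ (trans (lower-· (half x) (half x)) (cong lower (half+half x)))))
                (square-member (φ u) (φ-aut u i))
              where
              u : Mat q
              u = lower (half x)
              i : Invertible u
              i = special-invertible (lower-unimodular (half x))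

            generic-member : ∀ {a b c d} → c ≢ 0F → Unimodular (mat a b c d) → φ (mat a b c d) ∈ hs
            generic-member {a} {b} {c} {d} c≢0 u = subst (λ A → φ A ∈ hs) (sym (transvection-product c≢0 u))
                (subst (_∈ hs) (sym (trans (φ-· U₁ (L · U₂) (inv-u x) (invertible-· {L} {U₂} iL (inv-u y))) (cong (φ U₁ ∘P_) (φ-· L U₂ iL (inv-u y)))))
                  (compose (upper-member x) (compose (lower-member c) (upper-member y))))
              where
              x y : Fin q
              x = (a ⊖ 1F) ⊛ inv c
              y = (d ⊖ 1F) ⊛ inv c
              U₁ U₂ L : Mat q
              U₁ = upper x
              U₂ = upper y
              L = lower c
              inv-u : ∀ x → Invertible (upper x)
              inv-u x = special-invertible (upper-unimodular x)
              iL : Invertible L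
              iL = special-invertible (lower-unimodular c)

            -- If the corner c is 0, right multiplication by `lower 1F` replaces it by d, which is
            -- nonzero because ad = 1.
            special-member : ∀ A → Unimodular A → φ A ∈ hs
            special-member A u = decide (Mat.c A ≟ 0F)
              where
              L : Mat q
              L = lower 1F
              uL : Unimodular L
              uL = lower-unimodular 1F
              L⁻ : Mat q
              L⁻ = lower -1F
              LL⁻ : L · L⁻ ≡ I
              LL⁻ = trans (lower-· 1F _) (cong lower (-‿inverseʳ 1F))
              corner : Mat.c A ≡ 0F → Mat.c (A · L) ≢ 0F
              corner c≡0 z = 1≢0 (comb₃ -1F (Mat.a A) (-F (Mat.a A ⊕ Mat.b A))
                (solve 4 (λ a b c d → :1 :- :0 := :-1 :* (a :* d :- b :* c :- :1) :+ a :* (c :* :1 :+ d :* :1 :- :0) :+ (:- (a :+ b)) :* (c :- :0))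
                  refl (Mat.a A) (Mat.b A) (Mat.c A) (Mat.d A)) u z c≡0)
              decide : Dec (Mat.c A ≡ 0F) → φ A ∈ hs
              decide (no c≢0) = generic-member c≢0 u
              decide (yes c≡0) = subst (_∈ hs) eq (compose (generic-member (corner c≡0) (unimodular-· {A} {L} u uL)) (lower-member -1F))
                where
                A·I : ∀ A → A · I ≡ A
                A·I (mat a b c d) = mat-cong (e₁ a b) (e₂ a b) (e₁ c d) (e₂ c d)
                  where
                  e₁ : ∀ a b → a ⊛ 1F ⊕ b ⊛ 0F ≡ a
                  e₁ = solve 2 (λ a b → a :* :1 :+ b :* :0 := a) refl
                  e₂ : ∀ a b → a ⊛ 0F ⊕ b ⊛ 1F ≡ b
                  e₂ = solve 2 (λ a b → a :* :0 :+ b :* :1 := b) refl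
                eq : φ (A · L) ∘P φ L⁻ ≡ φ A
                eq = trans (sym (φ-· (A · L) L⁻ (invertible-· {A} {L} (special-invertible u) (special-invertible uL)) (special-invertible (lower-unimodular -1F))))
                  (cong φ (trans (·-assoc A L L⁻) (trans (cong (A ·_) LL⁻) (A·I A))))

          PSL-member : ∀ {t} → PSL t → t ∈ hs
          PSL-member (A , u , e) = subst (_∈ hs) e (special-member A u)

          -- A single element outside PSL(2,q) brings τ into the subgroup, and τ brings everything
          -- else.
          all-or-special : (∀ t → t ∈ hs → PSL t) ⊎ (∃[ t ] (t ∈ hs × ¬ PSL t)) → (∀ t → t ∈ hs → PSL t) ⊎ (∀ t → IsAut X t → t ∈ hs)
          all-or-special (inj₁ p) = inj₁ p
          all-or-special (inj₂ (t , t∈ , n)) = inj₂ λ s a → [ (λ s∈ → s∈) , (λ (h , h∈ , e) → subst (_∈ hs) (sym e) (compose h∈ τ∈)) ]′ (member-or-reflected s a)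
            where
            τ∈ : τ ∈ hs
            τ∈ = [ (λ p → ⊥-elim (n p)) , from-reflected ]′ (PSL-or-reflected t (aut t∈))
              where
              from-reflected : (∃[ s ] (PSL s × t ≡ s ∘P τ)) → τ ∈ hs
              from-reflected (s , p , e) = let s′ , p′ , l , _ = PSL-inverse p in
                subst (_∈ hs) (trans (cong (s′ ∘P_) e) (trans (sym (∘P-assoc s′ s τ)) (trans (cong (_∘P τ) l) (∘P-idˡ τ)))) (compose (PSL-member p′) t∈)

      -- Lists for the two groups, and intersecting families as matrices

      module FullGroups (2≢0 : 2F ≢ 0F) (arc-regular : HasArcRegularSubgroup X) where

        -- Starts as the list of some arc-regular subgroup. Being arc-transitive it contains
        -- PSL(2,q), and regularity leaves no room for more.
        pslList : List (Perm n)
        pslList = proj₁ arc-regular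
        psl-subgroup : IsAutSubgroup X pslList
        psl-subgroup = proj₁ (proj₂ arc-regular)
        psl-transitive : ArcTransitive X pslList
        psl-transitive = proj₁ (proj₂ (proj₂ arc-regular))

        open import Data.List.Membership.DecPropositional _≟P_ using (_∈?_)

        psl-Unique : Unique pslList
        psl-Unique = proj₁ psl-subgroup

        arc-determines : ∀ s t → s ∈ pslList → t ∈ pslList → app s v₀ ≡ app t v₀ → app s w₀ ≡ app t w₀ → s ≡ t
        arc-determines s t s∈ t∈ = proj₂ (proj₂ (proj₂ arc-regular)) v₀ w₀ s t arc₀ s∈ t∈

        abstract
          PSL⇒∈ : ∀ {t} → PSL t → t ∈ pslList
          PSL⇒∈ = Subgroup.PSL-member pslList psl-subgroup psl-transitive 2≢0

          ∈⇒PSL : ∀ {t} → t ∈ pslList → PSL t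
          ∈⇒PSL {t} t∈ = let s , p , ev , e₀ = PSL-arc-transitive arc₀ (aut-arc t (All.lookup (proj₁ (proj₂ psl-subgroup)) t∈) arc₀) in
            subst PSL (arc-determines s t (PSL⇒∈ p) t∈ ev e₀) p

        autList : List (Perm n)
        autList = pslList ++ map (_∘P τ) pslList

        abstract
          ∈⇒aut : ∀ {t} → t ∈ autList → IsAut X t
          ∈⇒aut {t} t∈ = [ PSL-aut ∘ ∈⇒PSL , reflected ]′ (∈-++⁻ pslList t∈)
            where
            reflected : t ∈ map (_∘P τ) pslList → IsAut X t
            reflected p = let s , s∈ , e = ∈-map⁻ (_∘P τ) p in subst (IsAut X) (sym e) (aut-∘ s τ (PSL-aut (∈⇒PSL s∈)) τ-aut)

          aut⇒∈ : ∀ {t} → IsAut X t → t ∈ autList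
          aut⇒∈ {t} a = [ ∈-++⁺ˡ ∘ PSL⇒∈ , (λ (s , p , e) → ∈-++⁺ʳ pslList (subst (_∈ map (_∘P τ) pslList) (sym e) (∈-map⁺ (_∘P τ) (PSL⇒∈ p)))) ]′ (PSL-or-reflected t a)

          autList-Unique : Unique autList
          autList-Unique = Unique.++⁺ psl-Unique (Unique.map⁺ {f = _∘P τ} (λ {s} {t} e → trans (sym (τ-undo s)) (trans (cong (_∘P τ) e) (τ-undo t))) psl-Unique) disjoint
            where
            disjoint : ∀ {t} → ¬ (t ∈ pslList × t ∈ map (_∘P τ) pslList)
            disjoint {t} (p , r) =
              let s , s∈ , e = ∈-map⁻ (_∘P τ) r
                  s′ , p′ , l , _ = PSL-inverse (∈⇒PSL s∈)
              in τ∉PSL (subst PSL (trans (cong (s′ ∘P_) e) (trans (sym (∘P-assoc s′ s τ)) (trans (cong (_∘P τ) l) (∘P-idˡ τ)))) (PSL-∘ p′ (∈⇒PSL p)))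

          aut-subgroup : IsAutSubgroup X autList
          aut-subgroup = autList-Unique , All.tabulate ∈⇒aut , aut⇒∈ aut-id ,
            (λ {s} {t} s∈ t∈ → aut⇒∈ (aut-∘ s t (∈⇒aut s∈) (∈⇒aut t∈))) ,
            (λ {t} t∈ → let A , i , e = φ-surjective t (∈⇒aut t∈) in
              φ (adj A) , aut⇒∈ (φ-aut (adj A) (invertible-adj i)) , trans (cong (φ (adj A) ∘P_) (sym e)) (φ-adjˡ i))

          aut-transitive : ArcTransitive X autList
          aut-transitive u v u′ v′ a b = let h , h∈ , e , f = psl-transitive u v u′ v′ a b in h , ∈-++⁺ˡ h∈ , e , f

          classification : ∀ hs → IsAutSubgroup X hs → ArcTransitive X hs → hs Lists PSL ⊎ hs Lists IsAut X
          classification hs sg at = [ (λ p → inj₁ (p , λ _ → S.PSL-member 2≢0)) , (λ p → inj₂ ((λ _ → S.aut) , p)) ]′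
              (S.all-or-special 2≢0 (decide (All.all? (_∈? pslList) hs)))
            where
            module S = Subgroup hs sg at
            decide : Dec (All (_∈ pslList) hs) → (∀ t → t ∈ hs → PSL t) ⊎ (∃[ t ] (t ∈ hs × ¬ PSL t))
            decide (yes a) = inj₁ (λ _ t∈ → ∈⇒PSL (All.lookup a t∈))
            decide (no na) = let t , t∈ , n = find (All.¬All⇒Any¬ (_∈? pslList) hs na) in inj₂ (t , t∈ , n ∘ PSL⇒∈)

        arcs : List (Fin n × Fin n)
        arcs = dependentPairs (allFin n) neighbourList

        map-Unique : ∀ {A B : Set} (f : A → B) {xs} → (∀ {x y} → x ∈ xs → y ∈ xs → f x ≡ f y → x ≡ y) → Unique xs → Unique (map f xs)
        map-Unique f inj [] = []
        map-Unique f {x ∷ xs} inj (x∉ ∷ u) = All.map⁺ (All.tabulate (λ y∈ e → All.lookup x∉ y∈ (inj (here refl) (there y∈) e)))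
          ∷ map-Unique f (λ p r → inj (there p) (there r)) u

        abstract
          -- By regularity the elements correspond to the images of the base arc, and each of the n
          -- vertices starts three arcs.
          length-pslList : length pslList ≡ n ℕ.* 3
          length-pslList = trans (sym (length-map image pslList)) (trans
              (Unique-≈-length (map-Unique image (λ {s} {t} s∈ t∈ e → arc-determines s t s∈ t∈ (cong proj₁ e) (cong proj₂ e)) psl-Unique)
                (dependentPairs-Unique (Unique.allFin⁺ n) neighbourList-Unique) to from)
              (trans (length-dependentPairs 3 (allFin n) (λ {v} _ → cubic v)) (cong (ℕ._* 3) (length-tabulate {n = n} (λ x → x)))))
            where
            image : Perm n → Fin n × Fin n
            image h = app h v₀ , app h w₀
            to : ∀ {p} → p ∈ map image pslList → p ∈ arcs
            to p∈ = let h , h∈ , e = ∈-map⁻ image p∈ in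
              subst (_∈ arcs) (sym e) (∈-dependentPairs⁺ (∈-allFin _) (∈-neighbourList⁺ (aut-arc h (PSL-aut (∈⇒PSL h∈)) arc₀)))
            from : ∀ {p} → p ∈ arcs → p ∈ map image pslList
            from {u , v} p∈ = let h , h∈ , e , f = psl-transitive v₀ w₀ u v arc₀ (∈-neighbourList⁻ (proj₂ (∈-dependentPairs⁻ (allFin n) p∈))) in
              subst (_∈ map image pslList) (cong₂ _,_ e f) (∈-map⁺ image h∈)

          length-autList : length autList ≡ n ℕ.* 3 ℕ.+ n ℕ.* 3
          length-autList = trans (length-++ pslList) (cong₂ ℕ._+_ length-pslList (trans (length-map (_∘P τ) pslList) length-pslList))

        rotationOnto : Fin 3 → Perm n
        rotationOnto i = proj₁ (PSL-arc-transitive arc₀ (AtVertex.nbr-arc v₀ i))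

        abstract
          rotation-PSL : ∀ i → PSL (rotationOnto i)
          rotation-PSL i = proj₁ (proj₂ (PSL-arc-transitive arc₀ (AtVertex.nbr-arc v₀ i)))
          rotation-v₀ : ∀ i → app (rotationOnto i) v₀ ≡ v₀
          rotation-v₀ i = proj₁ (proj₂ (proj₂ (PSL-arc-transitive arc₀ (AtVertex.nbr-arc v₀ i))))
          rotation-w₀ : ∀ i → app (rotationOnto i) w₀ ≡ AtVertex.nbr v₀ i
          rotation-w₀ i = proj₂ (proj₂ (proj₂ (PSL-arc-transitive arc₀ (AtVertex.nbr-arc v₀ i))))

        rotations reflections stabiliser : List (Perm n)
        rotations = map rotationOnto (allFin 3)
        reflections = map (_∘P τ) rotations
        stabiliser = rotations ++ reflections

        abstract
          rotations-PSL : All PSL rotations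
          rotations-PSL = All.map⁺ {f = rotationOnto} (All.tabulate {xs = allFin 3} (λ {i} _ → rotation-PSL i))

          rotations-Unique : Unique rotations
          rotations-Unique = Unique.map⁺ {f = rotationOnto} (λ {i} {j} e → AtVertex.nbr-injective v₀ (trans (sym (rotation-w₀ i)) (trans (cong (λ t → app t w₀) e) (rotation-w₀ j)))) (Unique.allFin⁺ 3)

          rotations-v₀ : All (λ t → app t v₀ ≡ v₀) rotations
          rotations-v₀ = All.map⁺ {f = rotationOnto} (All.tabulate {xs = allFin 3} (λ {i} _ → rotation-v₀ i))

          stabiliser-aut : All (IsAut X) stabiliser
          stabiliser-aut = All.++⁺ (All.map PSL-aut rotations-PSL) (All.map⁺ {f = _∘P τ} (All.map (λ {t} p → aut-∘ t τ (PSL-aut p) τ-aut) rotations-PSL))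

          stabiliser-v₀ : All (λ t → app t v₀ ≡ v₀) stabiliser
          stabiliser-v₀ = All.++⁺ rotations-v₀ (All.map⁺ {f = _∘P τ} (All.map (λ {t} e → trans (app-∘ t τ v₀) (trans (cong (app t) τ-v₀) e)) rotations-v₀))

          stabiliser-Unique : Unique stabiliser
          stabiliser-Unique = Unique.++⁺ rotations-Unique (Unique.map⁺ {f = _∘P τ} (λ {s} {t} e → trans (sym (τ-undo s)) (trans (cong (_∘P τ) e) (τ-undo t))) rotations-Unique) disjoint
            where
            disjoint : ∀ {t} → ¬ (t ∈ rotations × t ∈ reflections)
            disjoint {t} (p , r) =
              let s , s∈ , e = ∈-map⁻ (_∘P τ) r
                  s′ , p′ , l , _ = PSL-inverse (All.lookup rotations-PSL s∈)
              in τ∉PSL (subst PSL (trans (cong (s′ ∘P_) e) (trans (sym (∘P-assoc s′ s τ)) (trans (cong (_∘P τ) l) (∘P-idˡ τ)))) (PSL-∘ p′ (All.lookup rotations-PSL p)))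

        Meet : Perm n → Perm n → Set
        Meet f g = ∃[ v ] app f v ≡ app g v

        sgn-≢0 : ∀ {s} → Sgn s → s ≢ 0F
        sgn-≢0 σ z = 1≢0 (trans (sym (sgn-square σ)) (trans (cong₂ _⊛_ z z) (zeroˡ 0F)))

        quotient-fixes : ∀ {A B v} → Invertible A → Invertible B → app (φ A) v ≡ app (φ B) v → app (φ (adj A · B)) v ≡ v
        quotient-fixes {A} {B} {v} i j e = begin
          app (φ (adj A · B)) v ≡⟨ cong (λ t → app t v) (φ-· (adj A) B (invertible-adj i) j) ⟩
          app (φ (adj A) ∘P φ B) v ≡⟨ app-∘ (φ (adj A)) (φ B) v ⟩
          app (φ (adj A)) (app (φ B) v) ≡⟨ cong (app (φ (adj A))) (sym e) ⟩
          app (φ (adj A)) (app (φ A) v) ≡⟨ sym (app-∘ (φ (adj A)) (φ A) v) ⟩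
          app (φ (adj A) ∘P φ A) v ≡⟨ cong (λ t → app t v) (φ-adjˡ i) ⟩
          app 1P v ≡⟨ app-id v ⟩
          v ∎
          where open ≡-Reasoning

        fixed⇒meet : ∀ {A B v} → Invertible A → Invertible B → app (φ (adj A · B)) v ≡ v → app (φ A) v ≡ app (φ B) v
        fixed⇒meet {A} {B} {v} i j e = begin
          app (φ A) v ≡⟨ cong (app (φ A)) (sym e) ⟩
          app (φ A) (app (φ (adj A · B)) v) ≡⟨ sym (app-∘ (φ A) (φ (adj A · B)) v) ⟩
          app (φ A ∘P φ (adj A · B)) v ≡⟨ cong (λ t → app t v) (trans (cong (φ A ∘P_) (φ-· (adj A) B (invertible-adj i) j)) (φ-undo i (φ B))) ⟩
          app (φ B) v ∎
          where open ≡-Reasoning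

        trivial-quotient : ∀ {A B} → Invertible A → Invertible B → φ (adj A · B) ≡ 1P → φ A ≡ φ B
        trivial-quotient {A} {B} i j e = trans (sym (∘P-idʳ (φ A))) (trans (cong (φ A ∘P_) (trans (sym e) (φ-· (adj A) B (invertible-adj i) j))) (φ-undo i (φ B)))

        meet⇒adjacent : ∀ {A B v} → Unimodular A → Unimodular B → φ A ≢ φ B → app (φ A) v ≡ app (φ B) v → A ~ B
        meet⇒adjacent {A} {B} {v} u w n e = subst Sgn (sym (⟨⟩-tr A B))
          (special-stabiliser {adj A · B} {v} (unimodular-· (unimodular-adj u) w) (quotient-fixes (special-invertible u) (special-invertible w) e)
            (n ∘ trivial-quotient (special-invertible u) (special-invertible w)))

        φ-≢⇒distinct : ∀ {A B} → Unimodular B → φ A ≢ φ B → Distinct A B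
        φ-≢⇒distinct {A} {B} u n {s} σ e = n (trans (cong φ e) (φ-• (sgn-≢0 σ) (special-invertible u)))

        record SpecialFamily (xs : List (Mat q)) : Set where
          field
            clique : Clique xs
            distinct : AllPairs Distinct xs

        build-family : ∀ xs → All Unimodular xs → AllPairs (λ A B → φ A ≢ φ B × Meet (φ A) (φ B)) xs → SpecialFamily xs
        build-family xs us ps = record { clique = us , proj₁ both ; distinct = proj₂ both }
          where
          convert : ∀ {xs} → All Unimodular xs → AllPairs (λ A B → φ A ≢ φ B × Meet (φ A) (φ B)) xs → AllPairs _~_ xs × AllPairs Distinct xs
          convert [] [] = [] , []
          convert {A ∷ _} (u ∷ us) (p ∷ ps) = let a , d = convert us ps ; a′ , d′ = row us p in (a′ ∷ a) , (d′ ∷ d)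
            where
            row : ∀ {xs} → All Unimodular xs → All (λ B → φ A ≢ φ B × Meet (φ A) (φ B)) xs → All (A ~_) xs × All (Distinct A) xs
            row [] [] = [] , []
            row {B ∷ _} (w ∷ us) ((n , v , e) ∷ ps) = let a , d = row us ps in
              (meet⇒adjacent {A} {B} {v} u w n e ∷ a) , (φ-≢⇒distinct {A} {B} w n ∷ d)
          both : AllPairs _~_ xs × AllPairs Distinct xs
          both = convert us ps

        represent : ∀ fs → All PSL fs → ∃[ xs ] (All Unimodular xs × map φ xs ≡ fs)
        represent [] [] = [] , [] , refl
        represent (f ∷ fs) ((A , u , e) ∷ ps) = let xs , us , es = represent fs ps in A ∷ xs , u ∷ us , cong₂ _∷_ e es

        PSL-family : ∀ fs → All PSL fs → Unique fs → Intersecting fs → ∃[ xs ] (SpecialFamily xs × length xs ≡ length fs)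
        PSL-family fs ps u int = let xs , us , es = represent fs ps in
          xs , build-family xs us (AllPairs.zip (AllPairs.map⁻ (subst Unique (sym es) u) ,
            pairs⁺ xs (λ p r → int (subst (φ _ ∈_) es (∈-map⁺ φ p)) (subst (φ _ ∈_) es (∈-map⁺ φ r)))))
          , trans (sym (length-map φ xs)) (cong length es)

        -- Members outside PSL(2,q) are stored by their factor in PSL(2,q), so both parts are
        -- subject to the same clique bounds.
        record AutSplit (fs : List (Perm n)) : Set where
          field
            xs ys : List (Mat q)
            xs-unimodular : All Unimodular xs
            ys-unimodular : All Unimodular ys
            xs-∈ : All (λ A → φ A ∈ fs) xs
            ys-∈ : All (λ B → (φ B ∘P τ) ∈ fs) ys
            xs-unique : AllPairs (λ A B → φ A ≢ φ B) xs
            ys-unique : AllPairs (λ A B → φ A ≢ φ B) ys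
            lengths : length fs ≡ length xs ℕ.+ length ys

        aut-split : ∀ fs → All (IsAut X) fs → Unique fs → AutSplit fs
        aut-split [] [] [] = record { xs = [] ; ys = [] ; xs-unimodular = [] ; ys-unimodular = [] ; xs-∈ = [] ; ys-∈ = [] ; xs-unique = [] ; ys-unique = [] ; lengths = refl }
        aut-split (f ∷ fs) (a ∷ as) (f∉ ∷ u) = [ special , reflected ]′ (PSL-or-reflected f a)
          where
          rest : AutSplit fs
          rest = aut-split fs as u
          open AutSplit rest
          special : PSL f → AutSplit (f ∷ fs)
          special (A , w , e) = record
            { xs = A ∷ xs ; ys = ys ; xs-unimodular = w ∷ xs-unimodular ; ys-unimodular = ys-unimodular
            ; xs-∈ = here e ∷ All.map there xs-∈ ; ys-∈ = All.map there ys-∈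
            ; xs-unique = All.map (λ p e′ → All.lookup f∉ p (trans (sym e) e′)) xs-∈ ∷ xs-unique ; ys-unique = ys-unique
            ; lengths = cong suc lengths }
          reflected : (∃[ s ] (PSL s × f ≡ s ∘P τ)) → AutSplit (f ∷ fs)
          reflected (s , (B , w , e) , e′) = record
            { xs = xs ; ys = B ∷ ys ; xs-unimodular = xs-unimodular ; ys-unimodular = w ∷ ys-unimodular
            ; xs-∈ = All.map there xs-∈ ; ys-∈ = here (trans (cong (_∘P τ) e) (sym e′)) ∷ All.map there ys-∈
            ; xs-unique = xs-unique ; ys-unique = All.map (λ p e″ → All.lookup f∉ p (trans e′ (trans (cong (_∘P τ) (sym e)) (cong (_∘P τ) e″)))) ys-∈ ∷ ys-unique
            ; lengths = trans (cong suc lengths) (sym (ℕ.+-suc (length xs) (length ys))) }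

        record FullFamily (xs ys : List (Mat q)) : Set where
          field
            first : SpecialFamily xs
            second : SpecialFamily ys
            cross : All (λ A → All (λ B → ⟨ A , B · T ⟩ ≡ 0F) ys) xs

        -- The quotient A⁻¹BT has determinant δ, a nonsquare, so a fixed vertex makes its trace 0.
        meet⇒orthogonal : ∀ {A B} → Unimodular A → Unimodular B → Meet (φ A) (φ B ∘P τ) → ⟨ A , B · T ⟩ ≡ 0F
        meet⇒orthogonal {A} {B} u w (v , e) = trans (⟨⟩-tr A (B · T)) (nonspecial-stabiliser {adj A · (B · T)} {v}
            (invertible-· {adj A} (invertible-adj (special-invertible u)) iBT) nonsquare
            (quotient-fixes (special-invertible u) iBT (trans e (cong (λ t → app t v) (sym φBT)))))
          where
          iBT : Invertible (B · T)
          iBT = invertible-· {B} {T} (special-invertible w) T-invertible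
          φBT : φ (B · T) ≡ φ B ∘P τ
          φBT = trans (φ-· B T (special-invertible w) T-invertible) (cong (φ B ∘P_) φT)
          nonsquare : ¬ IsSquare (det (adj A · (B · T)))
          nonsquare s = δ-nonsquare (subst IsSquare (trans (det-· (adj A) (B · T)) (trans (cong₂ _⊛_ (unimodular-adj u) (trans (det-· B T) (trans (cong (_⊛ δ) w) (*-identityˡ δ)))) (*-identityˡ δ))) s)

        Aut-family : ∀ fs → All (IsAut X) fs → Unique fs → Intersecting fs → ∃[ xs ] ∃[ ys ] (FullFamily xs ys × length fs ≡ length xs ℕ.+ length ys)
        Aut-family fs as u int = xs , ys , record
            { first = build-family xs xs-unimodular (AllPairs.zip (xs-unique , pairs⁺ xs (λ p r → int (All.lookup xs-∈ p) (All.lookup xs-∈ r))))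
            ; second = build-family ys ys-unimodular (AllPairs.zip (ys-unique , pairs⁺ ys (λ p r → unreflect (int (All.lookup ys-∈ p) (All.lookup ys-∈ r)))))
            ; cross = All.tabulate (λ {A} p → All.tabulate (λ {B} r → meet⇒orthogonal {A} {B} (All.lookup xs-unimodular p) (All.lookup ys-unimodular r)
                (int (All.lookup xs-∈ p) (All.lookup ys-∈ r)))) }
          , lengths
          where
          open AutSplit (aut-split fs as u)
          unreflect : ∀ {A B} → Meet (φ A ∘P τ) (φ B ∘P τ) → Meet (φ A) (φ B)
          unreflect {A} {B} (v , e) = app τ v , trans (sym (app-∘ (φ A) τ v)) (trans e (app-∘ (φ B) τ v))

        intersecting : ∀ {fs} → AllPairs Meet fs → Intersecting fs
        intersecting {f ∷ fs} (p ∷ ps) (here refl) (here refl) = v₀ , refl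
        intersecting {f ∷ fs} (p ∷ ps) (here refl) (there r) = All.lookup p r
        intersecting {f ∷ fs} (p ∷ ps) (there r) (here refl) = let v , e = All.lookup p r in v , sym e
        intersecting {f ∷ fs} (p ∷ ps) (there r) (there s) = intersecting ps r s

        stabiliser-intersecting : ∀ {fs} → All (λ t → app t v₀ ≡ v₀) fs → Intersecting fs
        stabiliser-intersecting a p r = v₀ , trans (All.lookup a p) (sym (All.lookup a r))

        record Maximum (P : Perm n → Set) (m : ℕ) : Set where
          field
            family : ∃[ fs ] (All P fs × Unique fs × Intersecting fs × length fs ≡ m)
            bound : ∀ fs → All P fs → Unique fs → Intersecting fs → length fs ℕ.≤ m

        density : ∀ {P m a b l hs} → Maximum P m → hs Lists P → length hs ≡ l → m ℕ.* n ℕ.* b ≡ a ℕ.* l → DensityIs hs (a , b)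
        density {m = m} M (to , from) refl e = m ,
          ( (let fs , ps , u , int , l = Maximum.family M in fs , (u , All.map (λ {t} → from t) ps , int) , l)
          , (λ fs (u , ps , int) → Maximum.bound M fs (All.map (λ {t} → to t) ps) u int) ) , e

        special-maximum : ∀ {m} → ∃[ fs ] (All PSL fs × Unique fs × Intersecting fs × length fs ≡ m) →
          (∀ {xs} → SpecialFamily xs → length xs ℕ.≤ m) → Maximum PSL m
        special-maximum {m} f b = record { family = f ; bound = λ fs ps u int → let xs , s , l = PSL-family fs ps u int in subst (ℕ._≤ m) l (b s) }

        full-maximum : ∀ {m} → ∃[ fs ] (All (IsAut X) fs × Unique fs × Intersecting fs × length fs ≡ m) →
          (∀ {xs ys} → FullFamily xs ys → length xs ℕ.+ length ys ℕ.≤ m) → Maximum (IsAut X) m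
        full-maximum {m} f b = record { family = f ; bound = λ fs ps u int → let xs , ys , s , l = Aut-family fs ps u int in subst (ℕ._≤ m) (sym l) (b s) }

        weak-array : ∀ {m m′ a b a′ b′ vals} → Maximum PSL m → Maximum (IsAut X) m′ →
          m ℕ.* n ℕ.* b ≡ a ℕ.* (n ℕ.* 3) → m′ ℕ.* n ℕ.* b′ ≡ a′ ℕ.* (n ℕ.* 3 ℕ.+ n ℕ.* 3) →
          (a , b) ∈ vals → (a′ , b′) ∈ vals → (∀ {r} → r ∈ vals → r ≡ (a , b) ⊎ r ≡ (a′ , b′)) → WeakArrayIs X vals
        weak-array {a = a} {b} {a′} {b′} {vals} M M′ e e′ p p′ cover = every , attained
          where
          psl-lists : pslList Lists PSL
          psl-lists = (λ _ → ∈⇒PSL) , (λ _ → PSL⇒∈)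
          aut-lists : autList Lists IsAut X
          aut-lists = (λ _ → ∈⇒aut) , (λ _ → aut⇒∈)
          every : ∀ hs → ArcTransitiveSubgroup X hs → ∃[ r ] ((r ∈ vals) × DensityIs hs r)
          every hs (sg , at) = [ (λ c → (a , b) , p , density {a = a} M c (trans (same c psl-lists psl-Unique) length-pslList) e)
                               , (λ c → (a′ , b′) , p′ , density {a = a′} M′ c (trans (same c aut-lists autList-Unique) length-autList) e′) ]′ (classification hs sg at)
            where
            same : ∀ {P ks} → hs Lists P → ks Lists P → Unique ks → length hs ≡ length ks
            same c c′ u = Unique-≈-length (proj₁ sg) u (λ {t} t∈ → proj₂ c′ t (proj₁ c t t∈)) (λ {t} t∈ → proj₂ c t (proj₁ c′ t t∈))
          attained : ∀ r → r ∈ vals → ∃[ hs ] (ArcTransitiveSubgroup X hs × DensityIs hs r)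
          attained r r∈ = [ (λ { refl → pslList , (psl-subgroup , psl-transitive) , density {a = a} M psl-lists length-pslList e })
                          , (λ { refl → autList , (aut-subgroup , aut-transitive) , density {a = a′} M′ aut-lists length-autList e′ }) ]′ (cover r∈)

        -- Nonscalar quotients have to be demanded separately: in characteristic 3 a scalar also has
        -- trace ±1.
        special-family⁺ : ∀ xs → All Unimodular xs → AllPairs (λ A B → A ~ B × ¬ Scalar (adj A · B)) xs →
          ∃[ fs ] (All PSL fs × Unique fs × Intersecting fs × length fs ≡ length xs)
        special-family⁺ xs us ps = map φ xs , All.map⁺ (All.map (λ {A} u → A , u , refl) us) ,
            AllPairs.map⁺ (proj₁ both) , intersecting (AllPairs.map⁺ (proj₂ both)) , length-map φ xs
          where
          pair : ∀ {A B} → Unimodular A → Unimodular B → A ~ B → ¬ Scalar (adj A · B) → φ A ≢ φ B × Meet (φ A) (φ B)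
          pair {A} {B} u w a n = (n ∘ φ-equal⇒scalar (special-invertible u) (special-invertible w)) ,
            (let v , e = special-fixes-vertex {adj A · B} (unimodular-· (unimodular-adj u) w) n (subst Sgn (⟨⟩-tr A B) a) in
              v , fixed⇒meet (special-invertible u) (special-invertible w) e)
          convert : ∀ {xs} → All Unimodular xs → AllPairs (λ A B → A ~ B × ¬ Scalar (adj A · B)) xs →
            AllPairs (λ A B → φ A ≢ φ B) xs × AllPairs (λ A B → Meet (φ A) (φ B)) xs
          convert [] [] = [] , []
          convert {A ∷ _} (u ∷ us) (p ∷ ps) = let a , d = convert us ps ; a′ , d′ = row us p in (a′ ∷ a) , (d′ ∷ d)
            where
            row : ∀ {xs} → All Unimodular xs → All (λ B → A ~ B × ¬ Scalar (adj A · B)) xs → All (λ B → φ A ≢ φ B) xs × All (λ B → Meet (φ A) (φ B)) xs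
            row [] [] = [] , []
            row {B ∷ _} (w ∷ us) ((r , s) ∷ ps) = let a , d = row us ps ; a′ , d′ = pair {A} {B} u w r s in (a′ ∷ a) , (d′ ∷ d)
          both : AllPairs (λ A B → φ A ≢ φ B) xs × AllPairs (λ A B → Meet (φ A) (φ B)) xs
          both = convert us ps

        module _ (3≢0 : 3F ≢ 0F) where

          -- A unimodular scalar a has a² = 1 and trace 2a; trace ±1 would give 4 = 1.
          scalar-self-pairing : ∀ {A B} → Unimodular A → Unimodular B → A ~ B → ¬ Scalar (adj A · B)
          scalar-self-pairing {A} {B} u w σ s = 3≢0 (trace-contradiction (subst Sgn (⟨⟩-tr A B) σ) s (unimodular-· (unimodular-adj u) w))
            where
            trace-contradiction : ∀ {C} → Sgn (tr C) → Scalar C → Unimodular C → 3F ≡ 0F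
            trace-contradiction {mat a _ _ _} σ (refl , refl , refl) u = comb₂ (ι -[1+ 3 ]) 1F
              (solve 1 (λ a → :3 :- :0 := :-4 :* ((a :* a :- :0 :* :0) :- :1) :+ :1 :* ((a :+ a) :* (a :+ a) :- :1)) refl a)
              u (sgn-square σ)

          clique-family : ∀ xs → Clique xs → ∃[ fs ] (All PSL fs × Unique fs × Intersecting fs × length fs ≡ length xs)
          clique-family xs (us , ps) = special-family⁺ xs us (attach us ps)
            where
            attach : ∀ {xs} → All Unimodular xs → AllPairs _~_ xs → AllPairs (λ A B → A ~ B × ¬ Scalar (adj A · B)) xs
            attach [] [] = []
            attach {A ∷ _} (u ∷ us) (p ∷ ps) = row us p ∷ attach us ps
              where
              row : ∀ {xs} → All Unimodular xs → All (A ~_) xs → All (λ B → A ~ B × ¬ Scalar (adj A · B)) xs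
              row [] [] = []
              row {B ∷ _} (w ∷ us) (r ∷ ps) = (r , scalar-self-pairing {A} {B} u w r) ∷ row us ps

          private
            2δ≢0 : 2F ⊛ δ ≢ 0F
            2δ≢0 = *-≢0 2≢0 δ≢0

          -- `zs` stands for the other half translated by a matrix of determinant δ, which
          -- multiplies its norms and pairings by δ.
          cross-bound : ∀ {xs zs} → Clique xs → All (λ Z → ⟨ Z , Z ⟩ ≡ 2F ⊛ δ) zs → AllPairs (λ Y Z → ∃[ ε ] (Sgn ε × ⟨ Y , Z ⟩ ≡ ε ⊛ δ)) zs →
            All (λ A → All (λ Z → ⟨ A , Z ⟩ ≡ 0F) zs) xs → (5 ℕ.≤ length xs → length zs ℕ.≤ 0) × (4 ℕ.≤ length xs → length zs ℕ.≤ 1)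
          cross-bound {xs} {zs} c ns ps cr = five zs ns cr , four zs ns ps cr
            where
            five : ∀ zs → All (λ Z → ⟨ Z , Z ⟩ ≡ 2F ⊛ δ) zs → All (λ A → All (λ Z → ⟨ A , Z ⟩ ≡ 0F) zs) xs → 5 ℕ.≤ length xs → length zs ℕ.≤ 0
            five [] _ _ _ = z≤n
            five (Z ∷ _) (e ∷ _) cr l = ⊥-elim (2δ≢0 (trans (sym e) (five-clique-⟂ 2≢0 3≢0 c l (All.map All.head cr))))
            four : ∀ zs → All (λ Z → ⟨ Z , Z ⟩ ≡ 2F ⊛ δ) zs → AllPairs (λ Y Z → ∃[ ε ] (Sgn ε × ⟨ Y , Z ⟩ ≡ ε ⊛ δ)) zs →
              All (λ A → All (λ Z → ⟨ A , Z ⟩ ≡ 0F) zs) xs → 4 ℕ.≤ length xs → length zs ℕ.≤ 1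
            four [] _ _ _ _ = z≤n
            four (_ ∷ []) _ _ _ _ = s≤s z≤n
            four (Y ∷ Z ∷ _) (e ∷ f ∷ _) (((ε , σ , g) ∷ _) ∷ _) cr l =
              ⊥-elim (four-clique-⟂ 2≢0 3≢0 c l δ≢0 (All.map All.head cr) (All.map (All.head ∘ All.tail) cr) e f σ g)

          transposed : ∀ {xs ys : List (Mat q)} {R : Mat q → Mat q → Set} → All (λ A → All (R A) ys) xs → All (λ B → All (λ A → R A B) xs) ys
          transposed a = All.tabulate (λ y∈ → All.map (λ r → All.lookup r y∈) a)

          scaled-images : ∀ {xs} (Z : Mat q) → det Z ≡ δ → Clique xs →
            All (λ Y → ⟨ Y , Y ⟩ ≡ 2F ⊛ δ) (map (_· Z) xs) × AllPairs (λ Y W → ∃[ ε ] (Sgn ε × ⟨ Y , W ⟩ ≡ ε ⊛ δ)) (map (_· Z) xs)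
          scaled-images Z dZ (us , ps) =
            All.map⁺ (All.map (λ {A} u → trans (scale A A) (cong (_⊛ δ) (norm-2 u))) us) ,
            AllPairs.map⁺ (AllPairs.map (λ {A} {B} σ → ⟨ A , B ⟩ , σ , scale A B) ps)
            where
            scale : ∀ A B → ⟨ A · Z , B · Z ⟩ ≡ ⟨ A , B ⟩ ⊛ δ
            scale A B = trans (⟨⟩-·ʳ Z A B) (trans (cong (_⊛ ⟨ A , B ⟩) dZ) (*-comm δ _))

          -- Five members in one half empty the other and four leave at most one, so the extreme
          -- sizes are 6 + 0 and 3 + 3. Multiplying by `adj T` instead of `T` gives the same
          -- constraints with the halves exchanged.
          full-bound : ∀ {xs ys} → FullFamily xs ys → length xs ℕ.+ length ys ℕ.≤ 6
          full-bound {xs} {ys} fam = arithmetic (length xs) (length ys)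
              (ℕ.≮⇒≥ (no-seven-clique 2≢0 3≢0 c₁)) (ℕ.≮⇒≥ (no-seven-clique 2≢0 3≢0 c₂))
              (relength ys (_· T) ∘ proj₁ b₁) (relength ys (_· T) ∘ proj₂ b₁) (relength xs (_· adj T) ∘ proj₁ b₂) (relength xs (_· adj T) ∘ proj₂ b₂)
            where
            open FullFamily fam
            c₁ : Clique xs
            c₁ = SpecialFamily.clique first
            c₂ : Clique ys
            c₂ = SpecialFamily.clique second
            relength : ∀ zs (f : Mat q → Mat q) {k} → length (map f zs) ℕ.≤ k → length zs ℕ.≤ k
            relength zs f {k} = subst (ℕ._≤ k) (length-map f zs)
            cross′ : All (λ B → All (λ A → ⟨ B , A · adj T ⟩ ≡ 0F) xs) ys
            cross′ = All.map (All.map (λ {A} e → trans (⟨⟩-sym _ (A · adj T)) (trans (⟨⟩-adjʳ A _ T) e))) (transposed cross)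
            b₁ = cross-bound c₁ (proj₁ (scaled-images T refl c₂)) (proj₂ (scaled-images T refl c₂)) (All.map All.map⁺ cross)
            b₂ = cross-bound c₂ (proj₁ (scaled-images (adj T) (det-adj T) c₁)) (proj₂ (scaled-images (adj T) (det-adj T) c₁)) (All.map All.map⁺ cross′)
            arithmetic : ∀ x y → x ℕ.≤ 6 → y ℕ.≤ 6 → (5 ℕ.≤ x → y ℕ.≤ 0) → (4 ℕ.≤ x → y ℕ.≤ 1) → (5 ℕ.≤ y → x ℕ.≤ 0) → (4 ℕ.≤ y → x ℕ.≤ 1) → x ℕ.+ y ℕ.≤ 6
            arithmetic x y x≤6 y≤6 x5 x4 y5 y4 = decide (5 ℕ.≤? x) (5 ℕ.≤? y) (4 ℕ.≤? x) (4 ℕ.≤? y)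
              where
              decide : Dec (5 ℕ.≤ x) → Dec (5 ℕ.≤ y) → Dec (4 ℕ.≤ x) → Dec (4 ℕ.≤ y) → x ℕ.+ y ℕ.≤ 6
              decide (yes p) _ _ _ = ℕ.+-mono-≤ x≤6 (x5 p)
              decide (no _) (yes p) _ _ = ℕ.+-mono-≤ (y5 p) y≤6
              decide (no n) (no _) (yes p) _ = ℕ.≤-trans (ℕ.+-mono-≤ (ℕ.≤-pred (ℕ.≰⇒> n)) (x4 p)) (ℕ.n≤1+n 5)
              decide (no _) (no n) (no _) (yes p) = ℕ.≤-trans (ℕ.+-mono-≤ (y4 p) (ℕ.≤-pred (ℕ.≰⇒> n))) (ℕ.n≤1+n 5)
              decide (no _) (no _) (no n) (no m) = ℕ.+-mono-≤ (ℕ.≤-pred (ℕ.≰⇒> n)) (ℕ.≤-pred (ℕ.≰⇒> m))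

          full-maximum-6 : Maximum (IsAut X) 6
          full-maximum-6 = full-maximum (stabiliser , stabiliser-aut , stabiliser-Unique , stabiliser-intersecting stabiliser-v₀ , refl) full-bound

        rotations-family : ∃[ fs ] (All PSL fs × Unique fs × Intersecting fs × length fs ≡ 3)
        rotations-family = rotations , rotations-PSL , rotations-Unique , stabiliser-intersecting rotations-v₀ , refl

        det-minus-I : ∀ A → det (A +M -1F • I) ≡ det A ⊖ tr A ⊕ 1F
        det-minus-I (mat a b c d) = solve 4 (λ a b c d → (a :+ :-1 :* :1) :* (d :+ :-1 :* :1) :- (b :+ :-1 :* :0) :* (c :+ :-1 :* :0)
          := (a :* d :- b :* c) :- (a :+ d) :+ :1) refl a b c d

        tr-minus-I : ∀ A → tr (A +M -1F • I) ≡ tr A ⊖ 2F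
        tr-minus-I (mat a b c d) = solve 2 (λ a d → (a :+ :-1 :* :1) :+ (d :+ :-1 :* :1) := (a :+ d) :- :2) refl a d

        -- Maximum families in characteristic 3

        module _ (3≡0 : 3F ≡ 0F) where

          private
            S : Mat q
            S = proj₁ rotation
            uS : Unimodular S
            uS = proj₁ (proj₂ rotation)
            S-v₀ : app (φ S) v₀ ≡ v₀
            S-v₀ = proj₁ (proj₂ (proj₂ rotation))
            S≢1 : φ S ≢ 1P
            S≢1 = proj₂ (proj₂ (proj₂ rotation))
            signS : Sgn (tr S)
            signS = special-stabiliser {S} {v₀} uS S-v₀ S≢1
            s : Fin q
            s = -F tr S
            σ : Sgn s
            σ = sgn-neg signS
            U : Mat q
            U = s • S
            uU : Unimodular U
            uU = trans (det-• s S) (trans (cong₂ _⊛_ (sgn-square σ) uS) (*-identityˡ 1F))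
            tr-U : tr U ≡ 2F
            tr-U = trans (solve 2 (λ a d → (:- (a :+ d)) :* a :+ (:- (a :+ d)) :* d := :-1 :* ((a :+ d) :* (a :+ d))) refl (Mat.a S) (Mat.d S))
              (trans (cong (-1F ⊛_) (sgn-square signS)) (trans (*-identityʳ -1F) (minus-one-is-two 3≡0)))
            N : Mat q
            N = U +M -1F • I
            tr-N : tr N ≡ 0F
            tr-N = trans (tr-minus-I U) (diff-0 tr-U)
            det-N : det N ≡ 0F
            det-N = trans (det-minus-I U) (trans (cong₂ (λ x y → x ⊖ y ⊕ 1F) uU tr-U) (solve 0 (:1 :- :2 :+ :1 := :0) refl))
            ⟨S,T⟩ : ⟨ S , T ⟩ ≡ 0F
            ⟨S,T⟩ = trans (⟨⟩-tr S T) (nonspecial-stabiliser {adj S · T} {v₀} (invertible-· {adj S} {T} (invertible-adj (special-invertible uS)) T-invertible)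
              (λ sq → δ-nonsquare (subst IsSquare (trans (det-· (adj S) T) (trans (cong (_⊛ δ) (unimodular-adj uS)) (*-identityˡ δ))) sq))
              (quotient-fixes {S} {T} (special-invertible uS) T-invertible (trans S-v₀ (sym (trans (cong (λ t → app t v₀) φT) τ-v₀)))))
            -- For N = sS - I both terms vanish: T has trace 0, and S⁻¹T fixes `v₀` and has
            -- nonsquare determinant.
            ⟨N,T⟩ : ⟨ N , T ⟩ ≡ 0F
            ⟨N,T⟩ = trans (⟨⟩-+ˡ U (-1F • I) T) (trans (⟨⟩-•ˡ s S T) (trans (cong (s ⊛_) ⟨S,T⟩) (zeroʳ s)) ⊕₀
              trans (⟨⟩-•ˡ -1F I T) (trans (cong (-1F ⊛_) (trans (⟨⟩-I T) tr-T)) (zeroʳ -1F)))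

          -- The reflection T normalises the unipotent rotation N + 1, so it preserves the line ker N; if -1 were a square,
          -- the discriminant -4δ of T would be a nonsquare.
          minus-one-nonsquare : ¬ IsSquare -1F
          minus-one-nonsquare (i , i²) = S≢1 (trans (sym (φ-• (sgn-≢0 σ) (special-invertible uS))) (trans (cong φ U≡I) φ-I))
            where
            disc-nonsquare : ¬ IsSquare (disc T)
            disc-nonsquare (y , e) = δ-nonsquare (square-ratio {2F ⊛ i} {δ} {y} (*-≢0 2≢0 (λ z → neg-≢0 1≢0 (trans (sym i²) (trans (cong (_⊛ i) z) (zeroˡ i)))))
              (comb₃ (ι (+ 4) ⊛ δ) -1F (-F tr T) (solve 4 (λ i d y t → ((:2 :* i) :* (:2 :* i)) :* d :- y :* y
                := (:4 :* d) :* (i :* i :- :-1) :+ :-1 :* (y :* y :- (t :* t :- :4 :* d)) :+ (:- t) :* (t :- :0)) refl i δ y (tr T)) i² e tr-T))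
            U≡I : U ≡ I
            U≡I = difference-Zero (nilpotent-⟂ N T tr-N det-N ⟨N,T⟩ disc-nonsquare)

          upper-quotient : ∀ x y → adj (upper x) · upper y ≡ upper (y ⊖ x)
          upper-quotient x y = mat-cong
            (solve 2 (λ x y → :1 :* :1 :+ (:- x) :* :0 := :1) refl x y)
            (solve 2 (λ x y → :1 :* y :+ (:- x) :* :1 := y :- x) refl x y)
            (solve 2 (λ x y → (:- :0) :* :1 :+ :1 :* :0 := :0) refl x y)
            (solve 2 (λ x y → (:- :0) :* y :+ :1 :* :1 := :1) refl x y)

          tr-upper : ∀ x → Sgn (tr (upper x))
          tr-upper x = Sgn-2
            where
            Sgn-2 : Sgn (1F ⊕ 1F)
            Sgn-2 = Sign.- , trans (solve 0 (:1 :+ :1 := :2) refl) (sym (minus-one-is-two 3≡0))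

          upper-adjacent : ∀ {x y} → x ≢ y → upper x ~ upper y × ¬ Scalar (adj (upper x) · upper y)
          upper-adjacent {x} {y} n =
            subst Sgn (sym (trans (⟨⟩-tr (upper x) (upper y)) (cong tr (upper-quotient x y)))) (tr-upper (y ⊖ x)) ,
            λ s → n (sym (0-diff (proj₁ (subst Scalar (upper-quotient x y) s))))

          -- Quotients of these matrices are of the same form, and their trace 2 equals -1.
          unipotents : ∃[ fs ] (All PSL fs × Unique fs × Intersecting fs × length fs ≡ q)
          unipotents = let fs , p , u , i , l = special-family⁺ (map upper elements)
                             (All.map⁺ (All.tabulate {xs = elements} (λ {x} _ → upper-unimodular x)))
                             (AllPairs.map⁺ (AllPairs.map (λ {x} {y} → upper-adjacent {x} {y}) elements-Unique))
                       in fs , p , u , i , trans l (trans (length-map upper elements) (length-tabulate {n = q} (λ x → x)))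
            where import Data.List.Properties

          special-maximum-q : 3 ℕ.≤ q → Maximum PSL q
          special-maximum-q 3≤q = special-maximum unipotents λ fam →
            clique-bound 2≢0 3≡0 minus-one-nonsquare 3≤q (SpecialFamily.clique fam) (SpecialFamily.distinct fam)

          -- Together with the `upper` matrices these form a group of order 2q. They lie outside
          -- PSL(2,q) as -1 is a nonsquare, and mixed quotients have trace 0.
          involution : Fin q → Mat q
          involution x = mat -1F x 0F 1F

          det-involution : ∀ x → det (involution x) ≡ -1F
          det-involution x = solve 1 (λ x → :-1 :* :1 :- x :* :0 := :-1) refl x

          involution-invertible : ∀ x → Invertible (involution x)
          involution-invertible x e = neg-≢0 1≢0 (trans (sym (det-involution x)) e)

          full-unipotents : ∃[ fs ] (All (IsAut X) fs × Unique fs × Intersecting fs × length fs ≡ q ℕ.+ q)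
          full-unipotents = map φ (map upper elements) ++ map φ (map involution elements)
            , All.++⁺ (All.map⁺ (All.map⁺ (All.tabulate {xs = elements} (λ {x} _ → φ-aut (upper x) (special-invertible (upper-unimodular x))))))
                      (All.map⁺ (All.map⁺ (All.tabulate {xs = elements} (λ {x} _ → φ-aut (involution x) (involution-invertible x)))))
            , AllPairs.++⁺ (lift (AllPairs.map (λ {x} {y} → proj₁ ∘ uppers {x} {y}) elements-Unique)) (lift (AllPairs.map (λ {x} {y} → proj₁ ∘ involutions {x} {y}) elements-Unique))
                (All.map⁺ (All.map⁺ (All.tabulate {xs = elements} (λ {x} _ → All.map⁺ (All.map⁺ (All.tabulate {xs = elements} (λ {y} _ → proj₁ (mixed x y))))))))
            , intersecting (AllPairs.++⁺ (lift (AllPairs.map (λ {x} {y} → proj₂ ∘ uppers {x} {y}) elements-Unique)) (lift (AllPairs.map (λ {x} {y} → proj₂ ∘ involutions {x} {y}) elements-Unique))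
                (All.map⁺ (All.map⁺ (All.tabulate {xs = elements} (λ {x} _ → All.map⁺ (All.map⁺ (All.tabulate {xs = elements} (λ {y} _ → proj₂ (mixed x y)))))))))
            , trans (length-++ (map φ (map upper elements))) (cong₂ ℕ._+_ (len upper) (len involution))
            where
            len : ∀ (f : Fin q → Mat q) → length (map φ (map f elements)) ≡ q
            len f = trans (length-map φ (map f elements)) (trans (length-map f elements) (length-tabulate {n = q} (λ x → x)))
            lift : ∀ {R : Perm n → Perm n → Set} {f : Fin q → Mat q} → AllPairs (λ x y → R (φ (f x)) (φ (f y))) elements → AllPairs R (map φ (map f elements))
            lift p = AllPairs.map⁺ (AllPairs.map⁺ p)
            from-quotient : ∀ {A B} → Invertible A → Invertible B → ¬ Scalar (adj A · B) → (∃[ v ] app (φ (adj A · B)) v ≡ v) → φ A ≢ φ B × Meet (φ A) (φ B)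
            from-quotient {A} {B} i j n (v , e) = n ∘ φ-equal⇒scalar i j , v , fixed⇒meet {A} {B} {v} i j e
            special-quotient : ∀ {A B C} → Invertible A → Invertible B → adj A · B ≡ C → Unimodular C → ¬ Scalar C → Sgn (tr C) → φ A ≢ φ B × Meet (φ A) (φ B)
            special-quotient {A} {B} i j refl u n t = from-quotient {A} {B} i j n (special-fixes-vertex {adj A · B} u n t)
            uppers : ∀ {x y} → x ≢ y → φ (upper x) ≢ φ (upper y) × Meet (φ (upper x)) (φ (upper y))
            uppers {x} {y} n = special-quotient {upper x} {upper y} (special-invertible (upper-unimodular x)) (special-invertible (upper-unimodular y))
              (upper-quotient x y) (upper-unimodular (y ⊖ x)) (λ s → n (sym (0-diff (proj₁ s)))) (tr-upper (y ⊖ x))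
            involutions : ∀ {x y} → x ≢ y → φ (involution x) ≢ φ (involution y) × Meet (φ (involution x)) (φ (involution y))
            involutions {x} {y} n = special-quotient {involution x} {involution y} (involution-invertible x) (involution-invertible y)
              (mat-cong
                (solve 2 (λ x y → :1 :* :-1 :+ (:- x) :* :0 := :-1) refl x y)
                (solve 2 (λ x y → :1 :* y :+ (:- x) :* :1 := y :- x) refl x y)
                (solve 2 (λ x y → (:- :0) :* :-1 :+ :-1 :* :0 := :0) refl x y)
                (solve 2 (λ x y → (:- :0) :* y :+ :-1 :* :1 := :-1) refl x y))
              (solve 1 (λ z → :-1 :* :-1 :- z :* :0 := :1) refl (y ⊖ x))
              (λ s → n (sym (0-diff (proj₁ s))))
              (Sign.+ , comb₁ -1F (solve 0 (:-1 :+ :-1 :- :1 := :-1 :* (:3 :- :0)) refl) 3≡0)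
            mixed : ∀ x y → φ (upper x) ≢ φ (involution y) × Meet (φ (upper x)) (φ (involution y))
            mixed x y = from-quotient {upper x} {involution y} (special-invertible (upper-unimodular x)) (involution-invertible y)
                (nonsquare ∘ scalar-square) (nonspecial-fixes-vertex {adj (upper x) · involution y} nonsquare trace)
              where
              nonsquare : ¬ IsSquare (det (adj (upper x) · involution y))
              nonsquare s = minus-one-nonsquare (subst IsSquare (trans (det-· (adj (upper x)) (involution y)) (trans (cong₂ _⊛_ (unimodular-adj (upper-unimodular x)) (det-involution y)) (*-identityˡ -1F))) s)
              trace : tr (adj (upper x) · involution y) ≡ 0F
              trace = solve 2 (λ x y → (:1 :* :-1 :+ (:- x) :* :0) :+ ((:- :0) :* y :+ :1 :* :1) := :0) refl x y

          full-maximum-2q : 3 ℕ.≤ q → Maximum (IsAut X) (q ℕ.+ q)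
          full-maximum-2q 3≤q = full-maximum full-unipotents λ fam → ℕ.+-mono-≤ (bound (FullFamily.first fam)) (bound (FullFamily.second fam))
            where
            bound : ∀ {xs} → SpecialFamily xs → length xs ℕ.≤ q
            bound fam = clique-bound 2≢0 3≡0 minus-one-nonsquare 3≤q (SpecialFamily.clique fam) (SpecialFamily.distinct fam)

        -- The density arrays

        module Conclusion (3≤q : 3 ℕ.≤ q) where

          module P = PentagonRecurrence
          open +-*-Solver using () renaming (solve to solveℕ; _:*_ to _⊗_; _:+_ to _✚_; con to conℕ; _:=_ to _≋_)

          SixthRoot : Fin q → Set
          SixthRoot = OrderThree.SixthRoot

          -- The maxima q and 2q are divided by the stabiliser orders 3 and 6, so both groups have
          -- density q/3.
          characteristic-three : 3F ≡ 0F → ∀ j → q ≡ 3 ℕ.* 3 ^ j → WeakArrayIs X ((3 ^ j , 1) ∷ [])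
          characteristic-three 3≡0 j e = weak-array {m = q} {q ℕ.+ q} {3 ^ j} {1} {3 ^ j} {1} (special-maximum-q 3≡0 3≤q) (full-maximum-2q 3≡0 3≤q)
            (trans (cong (λ t → t ℕ.* n ℕ.* 1) e) (solveℕ 2 (λ t n → conℕ 3 ⊗ t ⊗ n ⊗ conℕ 1 ≋ t ⊗ (n ⊗ conℕ 3)) refl (3 ^ j) n))
            (trans (cong (λ t → (t ℕ.+ t) ℕ.* n ℕ.* 1) e) (solveℕ 2 (λ t n → (conℕ 3 ⊗ t ✚ conℕ 3 ⊗ t) ⊗ n ⊗ conℕ 1 ≋ t ⊗ (n ⊗ conℕ 3 ✚ n ⊗ conℕ 3)) refl (3 ^ j) n))
            (here refl) (here refl) (λ p → inj₁ (∈-singleton p))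

          characteristic-three-q-mod-4 : 3F ≡ 0F → q % 4 ≡ 3
          characteristic-three-q-mod-4 3≡0 = let k , e = SquareRootOfMinusOne.q≡3-mod-4 2≢0 (minus-one-nonsquare 3≡0) in
            trans (cong (_% 4) e) ([m+kn]%n≡m%n 3 k 4)

          module _ (3≢0 : 3F ≢ 0F) where

            -- The entry 1 is the density 6/6 of the full group, attained by a vertex stabiliser.
            array : ∀ {m a b vals} → Maximum PSL m → m ℕ.* n ℕ.* b ≡ a ℕ.* (n ℕ.* 3) →
              vals ≡ (1 , 1) ∷ (a , b) ∷ [] → WeakArrayIs X vals
            array {m} {a} {b} M e refl = weak-array {m = m} {6} {a} {b} {1} {1} M (full-maximum-6 3≢0) e
              (solveℕ 1 (λ n → conℕ 6 ⊗ n ⊗ conℕ 1 ≋ conℕ 1 ⊗ (n ⊗ conℕ 3 ✚ n ⊗ conℕ 3)) refl n)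
              (there (here refl)) (here refl) (λ { (here e) → inj₂ e ; (there p) → inj₁ (∈-singleton p) })

            array-4/3 : Maximum PSL 4 → WeakArrayIs X ((1 , 1) ∷ (4 , 3) ∷ [])
            array-4/3 M = array {4} {4} {3} M (solveℕ 1 (λ n → conℕ 4 ⊗ n ⊗ conℕ 3 ≋ conℕ 4 ⊗ (n ⊗ conℕ 3)) refl n) refl

            array-2 : Maximum PSL 6 → WeakArrayIs X ((1 , 1) ∷ (2 , 1) ∷ [])
            array-2 M = array {6} {2} {1} M (solveℕ 1 (λ n → conℕ 6 ⊗ n ⊗ conℕ 1 ≋ conℕ 2 ⊗ (n ⊗ conℕ 3)) refl n) refl

            array-1 : Maximum PSL 3 → WeakArrayIs X ((1 , 1) ∷ [])
            array-1 M = weak-array {m = 3} {6} {1} {1} {1} {1} M (full-maximum-6 3≢0)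
              (solveℕ 1 (λ n → conℕ 3 ⊗ n ⊗ conℕ 1 ≋ conℕ 1 ⊗ (n ⊗ conℕ 3)) refl n)
              (solveℕ 1 (λ n → conℕ 6 ⊗ n ⊗ conℕ 1 ≋ conℕ 1 ⊗ (n ⊗ conℕ 3 ✚ n ⊗ conℕ 3)) refl n)
              (here refl) (here refl) (λ p → inj₁ (∈-singleton p))

            sixth-root-array-5 : ∀ r → SixthRoot r → ι (+ 5) ≡ 0F → WeakArrayIs X ((1 , 1) ∷ (2 , 1) ∷ [])
            sixth-root-array-5 r h 5≡0 = array-2 (special-maximum (clique-family 3≢0 (map E.⟦_⟧ᴹ sixMatrices) (E.clique sixMatrices-clique))
                λ fam → ℕ.≮⇒≥ (no-seven-clique 2≢0 3≢0 (SpecialFamily.clique fam)))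
              where
              module E = ExplicitCliques.SixthRootOfUnity r h {5} 5≡0

            sixth-root-array : ∀ r → SixthRoot r → ι (+ 5) ≢ 0F → WeakArrayIs X ((1 , 1) ∷ (4 , 3) ∷ [])
            sixth-root-array r h 5≢0 = array-4/3 (special-maximum (clique-family 3≢0 (map E.⟦_⟧ᴹ fourMatrices) (E.clique fourMatrices-clique))
                λ fam → ℕ.≮⇒≥ (no-five-clique 2≢0 3≢0 5≢0 (SpecialFamily.clique fam)))
              where
              module E = ExplicitCliques.SixthRootOfUnity r h {0} refl

            -- A square root s of d gives the root (1 + s)/2 of x² = x + (d - 1)/4.
            half : Fin q
            half = inv 2F
            2half : 2F ⊛ half ≡ 1F
            2half = inv-* 2≢0

            no-sixth-root⇒nonresidue : (∀ r → ¬ SixthRoot r) → ¬ IsSquare (ι -[1+ 2 ])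
            no-sixth-root⇒nonresidue noRoot (s , e) = noRoot ((1F ⊕ s) ⊛ half) (*-cancelˡ (4≢0 2≢0)
              (comb₂ 1F ((1F ⊕ s) ⊛ (1F ⊕ s) ⊛ (2F ⊛ half ⊕ 1F) ⊖ 2F ⊛ (1F ⊕ s))
                (solve 2 (λ s h → :4 :* (((:1 :+ s) :* h) :* ((:1 :+ s) :* h)) :- :4 :* ((:1 :+ s) :* h :- :1)
                  := :1 :* (s :* s :- :-3) :+ ((:1 :+ s) :* (:1 :+ s) :* (:2 :* h :+ :1) :- :2 :* (:1 :+ s)) :* (:2 :* h :- :1)) refl s half)
                e 2half))

            five-square⇒golden : ∀ {s} → s ⊛ s ≡ ι (+ 5) → P.GoldenRatio ((1F ⊕ s) ⊛ half)
            five-square⇒golden {s} e = *-cancelˡ (4≢0 2≢0)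
              (comb₂ 1F ((1F ⊕ s) ⊛ (1F ⊕ s) ⊛ (2F ⊛ half ⊕ 1F) ⊖ 2F ⊛ (1F ⊕ s))
                (solve 2 (λ s h → :4 :* (((:1 :+ s) :* h) :* ((:1 :+ s) :* h)) :- :4 :* (:1 :+ (:1 :+ s) :* h)
                  := :1 :* (s :* s :- :5) :+ ((:1 :+ s) :* (:1 :+ s) :* (:2 :* h :+ :1) :- :2 :* (:1 :+ s)) :* (:2 :* h :- :1)) refl s half)
                e 2half)

            module _ (nonresidue : ¬ IsSquare (ι -[1+ 2 ])) where
              open NonresidueMinusThree 2≢0 3≢0 nonresidue

              no-golden-array : (∀ t → ¬ P.GoldenRatio t) → WeakArrayIs X ((1 , 1) ∷ [])
              no-golden-array noGolden = array-1 (special-maximum rotations-family λ fam → ℕ.≮⇒≥ λ l →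
                let s , e = four-clique⇒five-square (SpecialFamily.clique fam) l in noGolden ((1F ⊕ s) ⊛ half) (five-square⇒golden e))

              -- With -3 a nonresidue the bound stays at four even where 5 = 0, so characteristic 5
              -- needs no separate treatment here.
              golden-array : ∀ t → P.GoldenRatio t → WeakArrayIs X ((1 , 1) ∷ (4 , 3) ∷ [])
              golden-array t g = let u , v , e = SquareRootOfMinusOne.minus-one-as-two-squares nonsquare-* in
                array-4/3 (special-maximum (clique-family 3≢0 (ExplicitCliques.Icosians.icosians 2≢0 {t} {u} {v} g e) (ExplicitCliques.Icosians.icosians-clique 2≢0 {t} {u} {v} g e))
                  λ fam → ℕ.≮⇒≥ (no-five-clique′ (SpecialFamily.clique fam)))

theorem1p3 : (p k q : ℕ) → Prime p → p ≢ 2 → k ≥ 1 → q ≡ p ^ k →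
    (F : FiniteField q) → (n : ℕ) → (X : Graph n) → Cubic X → Type1-2¹ X →
    (φ : Mat q → Perm n) → AutIsPGL F X φ → PSLArcRegular F X φ →
    ((q ≡ 3 ^ k) → k % 2 ≡ 1 → WeakArrayIs X ((3 ^ (k ∸ 1) , 1) ∷ []))
    × ((q ≡ 3 ^ k) → k % 2 ≡ 0 → WeakArrayIs X ((3 ^ (k / 2 ∸ 1) , 1) ∷ []))
    × (q % 3 ≡ 1 → p ≡ 5 → WeakArrayIs X ((1 , 1) ∷ (2 , 1) ∷ []))
    × (q % 3 ≡ 1 → p ≢ 5 → WeakArrayIs X ((1 , 1) ∷ (4 , 3) ∷ []))
    × (q % 3 ≡ 2 → (q % 5 ≡ 2 ⊎ q % 5 ≡ 3) → WeakArrayIs X ((1 , 1) ∷ []))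
    × (q % 3 ≡ 2 → (q % 5 ≡ 1 ⊎ q % 5 ≡ 4 ⊎ q % 5 ≡ 0) →
    WeakArrayIs X ((1 , 1) ∷ (4 , 3) ∷ []))
theorem1p3 p k q isPrime p≢2 k≥1 q≡p^k F n X cubic (regular , arc-regular , _) φ pgl psl =
    (λ e _ → C.characteristic-three (3≡0 e) (k ∸ 1) (trans e (3^k k k≥1)))
  -- Vacuous: an even power of 3 is 1 modulo 4, whereas q is 3 modulo 4.
  , (λ e even → ⊥-elim (1≢3 (trans (sym (even-power-of-3 k even)) (trans (cong (_% 4) (sym e)) (C.characteristic-three-q-mod-4 (3≡0 e))))))
  , (λ { e refl → let r , h = T.q%3≡1⇒root e in C.sixth-root-array-5 (3≢0 (inj₁ e)) r h (ι-power 5 k q≡p^k) })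
  , (λ e p≢5 → let r , h = T.q%3≡1⇒root e in C.sixth-root-array (3≢0 (inj₁ e)) r h (5≢0 p≢5))
  , (λ e f → C.no-golden-array (3≢0 (inj₂ e)) (nonresidue e) (P.q%5≡±2⇒no-golden (q ∸ 3) q≡3+ (5≢0′ f) f))
  , (λ e f → let t , g = golden f in C.golden-array (3≢0 (inj₂ e)) (nonresidue e) t g)
  where
  open Development F
  module T = OrderThree
  module P = PentagonRecurrence

  3≤q : 3 ℕ.≤ q
  3≤q = subst (3 ℕ.≤_) (sym q≡p^k) (odd-prime-power-≥3 k isPrime p≢2 k≥1)

  q≡3+ : q ≡ 3 ℕ.+ (q ∸ 3)
  q≡3+ = sym (ℕ.m+[n∸m]≡n 3≤q)

  1≢3 : 1 ≢ 3
  1≢3 ()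

  vanishing-numeral : ∀ m .{{_ : ℕ.NonZero m}} {r} → q % m ≡ r → ι (+ m) ≡ 0F → ι (+ r) ≡ 0F
  vanishing-numeral m refl = ι-remainder m

  prime-∤q : ∀ {r} .{{_ : ℕ.NonZero r}} → Prime r → p ≢ r → q % r ≢ 0
  prime-∤q {r} pr n e = n (sym (prime-∣-power k pr isPrime (subst (r ℕ.∣_) q≡p^k (ℕ.m%n≡0⇒n∣m q r e))))

  2≢0 : 2F ≢ 0F
  2≢0 z = odd (q % 2) refl (m%n<n q 2)
    where
    odd : ∀ r → q % 2 ≡ r → r ℕ.< 2 → ⊥
    odd 0 e _ = prime-∤q prime[2] p≢2 e
    odd 1 e _ = 1≢0 (vanishing-numeral 2 e z)
    odd (suc (suc _)) _ (s≤s (s≤s ()))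

  3≢0 : q % 3 ≡ 1 ⊎ q % 3 ≡ 2 → 3F ≢ 0F
  3≢0 (inj₁ e) z = 1≢0 (vanishing-numeral 3 e z)
  3≢0 (inj₂ e) z = 2≢0 (vanishing-numeral 3 e z)

  5≢0-residue : ∀ r → q % 5 ≡ r → r ≢ 0 → r ℕ.< 5 → ι (+ 5) ≢ 0F
  5≢0-residue 0 _ n _ _ = n refl
  5≢0-residue 1 e _ _ z = 1≢0 (vanishing-numeral 5 e z)
  5≢0-residue 2 e _ _ z = 2≢0 (vanishing-numeral 5 e z)
  5≢0-residue 3 e _ _ z = 2≢0 (comb₂ 1F -1F (solve 0 (:2 :- :0 := :1 :* (:5 :- :0) :+ :-1 :* (:3 :- :0)) refl) z (vanishing-numeral 5 e z))
  5≢0-residue 4 e _ _ z = 1≢0 (comb₂ 1F -1F (solve 0 (:1 :- :0 := :1 :* (:5 :- :0) :+ :-1 :* (:4 :- :0)) refl) z (vanishing-numeral 5 e z))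
  5≢0-residue (suc (suc (suc (suc (suc _))))) _ _ (s≤s (s≤s (s≤s (s≤s (s≤s ())))))

  5≢0 : p ≢ 5 → ι (+ 5) ≢ 0F
  5≢0 n = 5≢0-residue (q % 5) refl (prime-∤q prime-5 n) (m%n<n q 5)

  5≢0′ : q % 5 ≡ 2 ⊎ q % 5 ≡ 3 → ι (+ 5) ≢ 0F
  5≢0′ (inj₁ e) = 5≢0-residue 2 e (λ ()) (s≤s (s≤s (s≤s z≤n)))
  5≢0′ (inj₂ e) = 5≢0-residue 3 e (λ ()) (s≤s (s≤s (s≤s (s≤s z≤n))))

  3≡0 : q ≡ 3 ^ k → 3F ≡ 0F
  3≡0 = ι-power 3 k

  3^k : ∀ k → k ≥ 1 → 3 ^ k ≡ 3 ℕ.* 3 ^ (k ∸ 1)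
  3^k (suc k) _ = refl

  golden : q % 5 ≡ 1 ⊎ q % 5 ≡ 4 ⊎ q % 5 ≡ 0 → ∃[ t ] P.GoldenRatio t
  golden (inj₁ e) = P.q%5≡±1⇒golden (q ∸ 3) q≡3+ (inj₁ e)
  golden (inj₂ (inj₁ e)) = P.q%5≡±1⇒golden (q ∸ 3) q≡3+ (inj₂ e)
  -- In characteristic 5 the polynomial t² - t - 1 is (t - 3)².
  golden (inj₂ (inj₂ e)) = ι (+ 3) , comb₁ 1F (solve 0 (:3 :* :3 :- (:1 :+ :3) := :1 :* (:5 :- :0)) refl)
    (ι-power 5 k (trans q≡p^k (cong (_^ k) (sym (prime-∣-power k prime-5 isPrime (subst (5 ℕ.∣_) q≡p^k (ℕ.m%n≡0⇒n∣m q 5 e)))))))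

  base-vertex : Fin n
  base-vertex = decide vertex
    where
    decide : ((s t : Perm n) → s ≡ t) ⊎ Fin n → Fin n
    decide (inj₂ v) = v
    -- A nontrivial transvection is not scalar, so its image differs from the identity.
    decide (inj₁ all-equal) = ⊥-elim (1≢0 (proj₁ (proj₁ (proj₂ (proj₂ (proj₂ pgl)) (mat 1F 1F 0F 1F)
      (λ e → 1≢0 (trans (solve 0 (:1 := :1 :* :1 :- :1 :* :0) refl) e))) (all-equal _ _))))

  module C = ProjectiveAction.BasePoint.FullGroups.Conclusion X cubic regular φ pgl psl base-vertex 2≢0 arc-regular 3≤q

  nonresidue : q % 3 ≡ 2 → ¬ IsSquare (ι -[1+ 2 ])
  nonresidue e = C.no-sixth-root⇒nonresidue (3≢0 (inj₂ e)) (T.q%3≡2⇒no-root (3≢0 (inj₂ e)) e)
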